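{- The Grouped Knapsack Allocation algorithm (described in the context) computes the exact grouped allocation $z^{\mathrm{gp}}$ in $\mathcal O(n+m\log m+|\Gamma|\log|\Gamma|)$ time and $\mathcal O(m+|\Gamma|)$ auxiliary space, where $m$ is the number of groups and $\Gamma$ is the boundary group. If the water level on $\Gamma$ is determined via median-based (linear-time) selection rather than by sorting, the running time improves to $\mathcal O(n+m\log m)$. Furthermore, if in this selection-based version the input already provides the representative ratios in sorted order, the running time drops to $\mathcal O(n)$.
   Context: Data: $[n]=\{0,\dots,n-1\}$; each item $i\in[n]$ has value $v_i>0$, cost $w_i>0$, ceiling $u_i\in[0,1]$; the budget satisfies $0\le C<\sum_{i}w_iu_i$. Items have attributes $a_i$ in a metric space $(A,d)$ with $v_i=v(a_i)$, $w_i=w(a_i)$ for Lipschitz functions $v:A\to(0,v_{\max}]$, $w:A\to[w_{\min},\infty)$, $w_{\min}>0$. A metric grouping with tolerance $\delta>0$ is a partition $\mathcal G=\{G_0,\dots,G_{m-1}\}$ of $[n]$ into non-empty sets with representatives $\widehat a_k\in A$ such that $d(a_i,\widehat a_k)\le\delta$ for all $i\in G_k$. Representative ratios: $\widehat\rho_k=v(\widehat a_k)/w(\widehat a_k)$. The input is $\{v_i,w_i,u_i\}_{i\in[n]}$, $\mathcal G$ with its representatives, and $C$; real arithmetic operations, comparisons and evaluations of $v,w$ have unit cost. Grouped allocation $z^{\mathrm{gp}}$: index groups so that $\widehat\rho_0\ge\dots\ge\widehat\rho_{m-1}$; $F^w_{S}=\sum_{i\in S}w_iu_i$, $F^w_{\le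 k}=\sum_{j\le k}F^w_{G_j}$, $F^w_{\le -1}=0$; $k^\star=\min\{k:F^w_{\le k}>C\}$; $c^\star=C-F^w_{\le k^\star-1}$; $\Gamma=G_{k^\star}$. Then $z^{\mathrm{gp}}_i=u_i$ for $i\in G_j$, $j<k^\star$; $z^{\mathrm{gp}}_i=0$ for $i\in G_j$, $j>k^\star$; and $z^{\mathrm{gp}}_i=\min\{u_i,\zeta^\star\}$ for $i\in\Gamma$, where $\zeta^\star\in[0,\max_{i\in\Gamma}u_i]$ is the unique solution of $W_\Gamma(\zeta)=\sum_{i\in\Gamma}w_i\min\{u_i,\zeta\}=c^\star$. Algorithm (Grouped Knapsack Allocation). Stage 1: compute $\widehat\rho_k$ and $F^w_{G_k}$ for all $k$; sort the groups by non-increasing $\widehat\rho_k$; compute the prefix sums $F^w_{\le k}$; find $k^\star$ and $c^\star$. Stage 2: set $z^{\mathrm{gp}}_i=u_i$ on groups $j<k^\star$ and $0$ on groups $j>k^\star$; compute $\zeta^\star$ with the subroutine SolveWaterLevel on $\Gamma$ and $c=c^\star$; set $z^{\mathrm{gp}}_i=\min\{u_i,\zeta^\star\}$ on $\Gamma$. SolveWaterLevel: if $c=0$ return $0$; if $c\ge F^w_\Gamma$ return $\max_{i\in\Gamma}u_i$. Otherwise let $q=|\Gamma|$, sort the ceilings $u_{(0)}\le\dots\le u_{(q-1)}$ (with corresponding costs $w_{(r)}$), set $u_{(-1)}=0$, $W=0$, $S=\sum_{r}w_{(r)}$; for $\ell=0,\dots,q-1$: let $\Delta u=u_{(\ell)}-u_{(\ell-1)}$;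 if $W+S\Delta u\ge c$ return $u_{(\ell-1)}+(c-W)/S$; else $W\leftarrow W+S\Delta u$, $S\leftarrow S-w_{(\ell)}$. In the selection-based version, the sort in SolveWaterLevel is replaced by weighted-median selection over the breakpoints (ceilings) of the increasing piecewise-linear function $W_\Gamma$ to locate the segment containing the root. Auxiliary space excludes input and output. -}

module Defs where

open import Algebra.Structures using (IsCommutativeRing)
import Algebra.Construct.NaturalChoice.Max as Max
import Algebra.Construct.NaturalChoice.Min as Min
open import Data.Bool using (Bool; if_then_else_)
open import Data.Fin using (Fin; toℕ)
open import Data.Fin.Permutation using (Permutation′; _⟨$⟩ʳ_)
open import Data.List using (List; []; _∷_; map; foldr; foldl; length; take; tabulate; concat; allFin)
import Data.List.Extrema as Extrema
open import Data.List.Membership.Propositional using (_∈_)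
open import Data.List.Relation.Binary.Permutation.Propositional using (_↭_)
open import Data.Nat as ℕ using (ℕ; zero; suc; ⌊_/2⌋)
open import Data.Nat.ListAction using (sum)
open import Data.Product using (∃; _×_; _,_; proj₁)
open import Data.Unit using (⊤; tt)
open import Data.Vec.Functional using (updateAt)
open import Function using (const; id)
open import Function.Metric.Structures using (IsGeneralMetric)
open import Relation.Binary.Bundles using (DecTotalOrder)
open import Relation.Binary.Structures using (IsDecTotalOrder)
import Relation.Binary.Construct.NonStrictToStrict as NonStrictToStrict
open import Relation.Binary.PropositionalEquality using (_≡_; _≢_)
open import Relation.Nullary using (¬_; does)

------------------------------------------------------------------------
-- Scalars

-- The library has no real numbers. Everything below is stated for an
-- arbitrary ordered field whose order is decidable (comparisons are
-- unit-cost operations of the machine); ℝ, read classically, is one.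

record OrderedField : Set₁ where
  infix  8 _⁻¹
  infix  8 -_
  infixl 7 _*_
  infixl 6 _+_ _-_
  infix  4 _≤_
  field
    Carrier           : Set
    _≤_               : Carrier → Carrier → Set
    _+_ _*_           : Carrier → Carrier → Carrier
    -_                : Carrier → Carrier
    _⁻¹               : Carrier → Carrier      -- 0# ⁻¹ is unspecified
    0# 1#             : Carrier
    isCommutativeRing : IsCommutativeRing _≡_ _+_ _*_ -_ 0# 1#
    isDecTotalOrder   : IsDecTotalOrder _≡_ _≤_
    1≢0               : 1# ≢ 0#
    *-inverseʳ        : ∀ x → x ≢ 0# → x * x ⁻¹ ≡ 1#
    +-monoʳ-≤         : ∀ z {x y} → x ≤ y → z + x ≤ z + y
    *-nonneg          : ∀ {x y} → 0# ≤ x → 0# ≤ y → 0# ≤ x * y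

  open IsDecTotalOrder isDecTotalOrder public using (_≟_; _≤?_)
  open NonStrictToStrict _≡_ _≤_ public using (_<_)

  decTotalOrder : DecTotalOrder _ _ _
  decTotalOrder = record { isDecTotalOrder = isDecTotalOrder }

  open Min (DecTotalOrder.totalOrder decTotalOrder) public using (_⊓_)
  open Max (DecTotalOrder.totalOrder decTotalOrder) public using (_⊔_)
  open Extrema (DecTotalOrder.totalOrder decTotalOrder) public using (max)

  _-_ : Carrier → Carrier → Carrier
  x - y = x + (- y)

  ∣_∣ : Carrier → Carrier
  ∣ x ∣ = x ⊔ (- x)

  ∑ : {X : Set} → List X → (X → Carrier) → Carrier
  ∑ xs f = foldr _+_ 0# (map f xs)

------------------------------------------------------------------------
-- Instances and the grouped allocation

-- `n` items and `m` groups. A group is stored as the list of its members;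
-- by `partition` every item occurs exactly once in exactly one group.

record Instance (F : OrderedField) (n m : ℕ) : Set₁ where
  open OrderedField F
  field
    Point       : Set
    dist        : Point → Point → Carrier
    isMetric    : IsGeneralMetric _≡_ _≡_ _≤_ 0# _+_ dist

    v w         : Point → Carrier
    vmax wmin   : Carrier
    0<v         : ∀ a → 0# < v a
    v≤vmax      : ∀ a → v a ≤ vmax
    0<wmin      : 0# < wmin
    wmin≤w      : ∀ a → wmin ≤ w a
    v-lipschitz : ∃ λ L → ∀ a b → ∣ v a - v b ∣ ≤ L * dist a b
    w-lipschitz : ∃ λ L → ∀ a b → ∣ w a - w b ∣ ≤ L * dist a b

    attribute   : Fin n → Point
    ceiling     : Fin n → Carrier
    0≤ceiling   : ∀ i → 0# ≤ ceiling i
    ceiling≤1   : ∀ i → ceiling i ≤ 1#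

  value : Fin n → Carrier
  value i = v (attribute i)

  cost : Fin n → Carrier
  cost i = w (attribute i)

  -- F^w_S = Σ_{i ∈ S} w_i u_i
  mass : List (Fin n) → Carrier
  mass S = ∑ S (λ i → cost i * ceiling i)

  field
    budget      : Carrier
    0≤budget    : 0# ≤ budget
    budget<mass : budget < mass (allFin n)

    δ           : Carrier
    0<δ         : 0# < δ
    members     : Fin m → List (Fin n)
    nonempty    : ∀ k → members k ≢ []
    partition   : concat (tabulate members) ↭ allFin n
    rep         : Fin m → Point
    close       : ∀ k i → i ∈ members k → dist (attribute i) (rep k) ≤ δ

  ratio : Fin m → Carrier
  ratio k = v (rep k) * w (rep k) ⁻¹

module Allocation {F : OrderedField} {n m : ℕ} (I : Instance F n m) where
  open OrderedField F
  open Instance I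

  -- W_S(ζ) = Σ_{i ∈ S} w_i min{u_i, ζ}
  filled : List (Fin n) → Carrier → Carrier
  filled S ζ = ∑ S (λ i → cost i * (ceiling i ⊓ ζ))

  -- Ceilings are non-negative, so for non-empty S the default 0# of `max`
  -- does not matter.
  maxCeiling : List (Fin n) → Carrier
  maxCeiling S = max 0# (map ceiling S)

  record IsWaterLevel (S : List (Fin n)) (c ζ : Carrier) : Set where
    field
      nonnegative : 0# ≤ ζ
      below-max   : ζ ≤ maxCeiling S
      solves      : filled S ζ ≡ c
      unique      : ∀ ζ′ → 0# ≤ ζ′ → ζ′ ≤ maxCeiling S → filled S ζ′ ≡ c → ζ′ ≡ ζ

  -- `order ⟨$⟩ʳ j` is the group in position j.

  NonIncreasing : Permutation′ m → Set
  NonIncreasing order = ∀ j k → toℕ j ℕ.≤ toℕ k → ratio (order ⟨$⟩ʳ k) ≤ ratio (order ⟨$⟩ʳ j)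

  groupAt : Permutation′ m → Fin m → List (Fin n)
  groupAt order j = members (order ⟨$⟩ʳ j)

  -- Mass of the first r groups, so that F^w_{≤k} is `prefix order (suc (toℕ k))`
  -- and F^w_{≤k-1} is `prefix order (toℕ k)`, which is 0# for k = 0.
  prefix : Permutation′ m → ℕ → Carrier
  prefix order r = ∑ (take r (tabulate (groupAt order))) mass

  -- Ties between ratios leave several admissible orders, and the
  -- allocation depends on the order chosen.
  record IsGroupedAllocation (order : Permutation′ m) (z : Fin n → Carrier) : Set where
    field
      sorted   : NonIncreasing order
      k⋆       : Fin m
      exceeds  : budget < prefix order (suc (toℕ k⋆))
      minimal  : ∀ (k : Fin m) → toℕ k ℕ.< toℕ k⋆ → ¬ (budget < prefix order (suc (toℕ k)))

    Γ : List (Fin n)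
    Γ = groupAt order k⋆

    c⋆ : Carrier
    c⋆ = budget - prefix order (toℕ k⋆)

    field
      ζ⋆       : Carrier
      level    : IsWaterLevel Γ c⋆ ζ⋆
      before   : ∀ j → toℕ j ℕ.< toℕ k⋆ → ∀ i → i ∈ groupAt order j → z i ≡ ceiling i
      after    : ∀ j → toℕ k⋆ ℕ.< toℕ j → ∀ i → i ∈ groupAt order j → z i ≡ 0#
      boundary : ∀ i → i ∈ Γ → z i ≡ ceiling i ⊓ ζ⋆

------------------------------------------------------------------------
-- Programs of a unit-cost real-arithmetic machine

data Ty : Set where
  unit bool nat real point item group items : Ty
  list : Ty → Ty
  _⊗_  : Ty → Ty → Ty

infixr 5 _⊗_

-- `Real` and `Point` are abstract parameters: programs can handle scalars
-- and points only through the primitive operations.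

module Machine (Real Point : Set) (n m : ℕ) where

  -- `items` is a reference to a list of items inside the input.
  ⟦_⟧ : Ty → Set
  ⟦ unit ⟧   = ⊤
  ⟦ bool ⟧   = Bool
  ⟦ nat ⟧    = ℕ
  ⟦ real ⟧   = Real
  ⟦ point ⟧  = Point
  ⟦ item ⟧   = Fin n
  ⟦ group ⟧  = Fin m
  ⟦ items ⟧  = List (Fin n)
  ⟦ list t ⟧ = List ⟦ t ⟧
  ⟦ s ⊗ t ⟧  = ⟦ s ⟧ × ⟦ t ⟧

  infixl 1 _>>=_ _>>_
  infixl 6 _⊕_ _⊖_
  infixl 7 _⊛_ _⊘_
  infix  4 _≤ᴿ_ _≡ᴿ_ _<ᴺ_

  data Prog : Ty → Set where
    return : ∀ {t} → ⟦ t ⟧ → Prog t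
    _>>=_  : ∀ {s t} → Prog s → (⟦ s ⟧ → Prog t) → Prog t
    step   : ∀ {t} → Prog t → Prog t
    loop   : ∀ s {t} → List ⟦ s ⟧ → ⟦ t ⟧ → (⟦ t ⟧ → ⟦ s ⟧ → Prog t) → Prog t

    zeroᴿ               : Prog real
    _⊕_ _⊖_ _⊛_ _⊘_     : Real → Real → Prog real
    _≤ᴿ_ _≡ᴿ_           : Real → Real → Prog bool
    eval-v eval-w       : Point → Prog real

    _+ᴺ_ _∸ᴺ_           : ℕ → ℕ → Prog nat
    halfᴺ               : ℕ → Prog nat
    _<ᴺ_                : ℕ → ℕ → Prog bool

    value cost ceiling  : Fin n → Prog real
    budget              : Prog real
    members             : Fin m → Prog items
    rep                 : Fin m → Prog point

    write               : Fin n → Real → Prog unit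

  _>>_ : ∀ {t} → Prog unit → Prog t → Prog t
  p >> q = p >>= λ _ → q

  -- Number of words occupied by a value.
  size : ∀ t → ⟦ t ⟧ → ℕ
  size (list t) xs     = suc (sum (map (λ x → suc (size t x)) xs))
  size (s ⊗ t) (x , y) = size s x ℕ.+ size t y
  size _ _             = 1

------------------------------------------------------------------------
-- Semantics: result, effect on the output array, time, auxiliary space

module Run {F : OrderedField} {n m : ℕ} (I : Instance F n m) where
  open OrderedField F
  private module I = Instance I
  open Machine Carrier I.Point n m

  result : ∀ {t} → Prog t → ⟦ t ⟧
  result (return x)      = x
  result (p >>= f)       = result (f (result p))
  result (step p)        = result p
  result (loop s xs a f) = foldl (λ b x → result (f b x)) a xs
  result zeroᴿ           = 0#
  result (x ⊕ y)         = x + y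
  result (x ⊖ y)         = x - y
  result (x ⊛ y)         = x * y
  result (x ⊘ y)         = x * y ⁻¹
  result (x ≤ᴿ y)        = does (x ≤? y)
  result (x ≡ᴿ y)        = does (x ≟ y)
  result (eval-v a)      = I.v a
  result (eval-w a)      = I.w a
  result (x +ᴺ y)        = x ℕ.+ y
  result (x ∸ᴺ y)        = x ℕ.∸ y
  result (halfᴺ x)       = ⌊ x /2⌋
  result (x <ᴺ y)        = does (x ℕ.<? y)
  result (value i)       = I.value i
  result (cost i)        = I.cost i
  result (ceiling i)     = I.ceiling i
  result budget          = I.budget
  result (members k)     = I.members k
  result (rep k)         = I.rep k
  result (write _ _)     = tt

  Output : Set
  Output = Fin n → Carrier

  loopOutput : {A X : Set} → (A → X → A) → (A → X → Output → Output) →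
               A → List X → Output → Output
  loopOutput next body a []       z = z
  loopOutput next body a (x ∷ xs) z = loopOutput next body (next a x) xs (body a x z)

  -- The output array is write-only.
  output : ∀ {t} → Prog t → Output → Output
  output (p >>= f)       z = output (f (result p)) (output p z)
  output (step p)        z = output p z
  output (loop s xs a f) z = loopOutput (λ b x → result (f b x)) (λ b x → output (f b x)) a xs z
  output (write i x)     z = updateAt z i (const x)
  output _               z = z

  loopTime : {A X : Set} → (A → X → A) → (A → X → ℕ) → A → List X → ℕ
  loopTime next body a []       = 1
  loopTime next body a (x ∷ xs) = suc (body a x ℕ.+ loopTime next body (next a x) xs)

  time : ∀ {t} → Prog t → ℕ
  time (return x)      = 0
  time (p >>= f)       = time p ℕ.+ time (f (result p))
  time (step p)        = suc (time p)
  time (loop s xs a f) = loopTime (λ b x → result (f b x)) (λ b x → time (f b x)) a xs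
  time _               = 1

  loopSpace : {A X : Set} → (A → ℕ) → (A → X → A) → (A → X → ℕ) → A → List X → ℕ
  loopSpace words next body a []       = 0
  loopSpace words next body a (x ∷ xs) =
    suc (words a ℕ.+ body a x) ℕ.⊔ loopSpace words next body (next a x) xs

  -- Peak number of words in use. A bound value is kept until the program
  -- binding it has finished; a pending continuation takes one word; a loop
  -- keeps its position and its current state only. No value is ever freed
  -- earlier than that, even if it is no longer needed.
  space : ∀ {t} → Prog t → ℕ
  space (_>>=_ {s} p f)    = suc (space p) ℕ.⊔ (size s (result p) ℕ.+ space (f (result p)))
  space (step p)           = space p
  space (loop s {t} xs a f) =
    loopSpace (size t) (λ b x → result (f b x)) (λ b x → space (f b x)) a xs
  space _                  = 0

------------------------------------------------------------------------
-- The algorithms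

-- Matching on a value and applying `return` to a constructor are free, so
-- every recursive call is made under a `step`; lists are built only inside
-- `return`, so that their size is charged where they are bound. Functions
-- recursing on a number called `fuel` do so only to be structural: the
-- length of the list always suffices, and the clause for `zero` is then
-- never entered with work left to do.

module Algorithms (Real Point : Set) (n m : ℕ) where
  open Machine Real Point n m

  -- Merge sort

  module _ (t : Ty) (_≼_ : ⟦ t ⟧ → ⟦ t ⟧ → Prog bool) where

    split : List ⟦ t ⟧ → Prog (list t ⊗ list t)
    split []           = return ([] , [])
    split (x ∷ [])     = return (x ∷ [] , [])
    split (x ∷ y ∷ xs) = step do
      (ls , rs) ← split xs
      return (x ∷ ls , y ∷ rs)

    merge : List ⟦ t ⟧ → List ⟦ t ⟧ → Prog (list t)
    merge []       ys       = return ys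
    merge (x ∷ xs) []       = return (x ∷ xs)
    merge (x ∷ xs) (y ∷ ys) = step do
      b ← x ≼ y
      if b then (do zs ← merge xs (y ∷ ys)
                    return (x ∷ zs))
           else (do zs ← merge (x ∷ xs) ys
                    return (y ∷ zs))

    mergeSort : (fuel : ℕ) → List ⟦ t ⟧ → Prog (list t)
    mergeSort fuel       []           = return []
    mergeSort fuel       (x ∷ [])     = return (x ∷ [])
    mergeSort zero       (x ∷ y ∷ xs) = return (x ∷ y ∷ xs)
    mergeSort (suc fuel) (x ∷ y ∷ xs) = step do
      (ls , rs) ← split (x ∷ y ∷ xs)
      ls′ ← mergeSort fuel ls
      rs′ ← mergeSort fuel rs
      merge ls′ rs′

    sort : List ⟦ t ⟧ → Prog (list t)
    sort xs = mergeSort (length xs) xs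

  -- Linear-time selection by medians of medians of five. An incomplete
  -- last block of five contributes no median; lists shorter than five are
  -- sorted. Ranks start from 0.

  count : ∀ t → List ⟦ t ⟧ → Prog nat
  count t xs = loop t xs 0 λ k _ → k +ᴺ 1

  nth : ℕ → List Real → Prog real
  nth r       []       = zeroᴿ
  nth zero    (x ∷ xs) = return x
  nth (suc r) (x ∷ xs) = step (nth r xs)

  mediansOfFive : List Real → Prog (list real)
  mediansOfFive (a ∷ b ∷ c ∷ d ∷ e ∷ xs) = step do
    block ← return {list real} (a ∷ b ∷ c ∷ d ∷ e ∷ [])
    block′ ← sort real _≤ᴿ_ block
    μ ← nth 2 block′
    μs ← mediansOfFive xs
    return (μ ∷ μs)
  mediansOfFive _ = return []

  -- Elements with key smaller than, equal to, and larger than the pivot.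
  partition : ∀ t → (⟦ t ⟧ → Real) → Real → List ⟦ t ⟧ → Prog (list t ⊗ list t ⊗ list t)
  partition t key p []       = return ([] , [] , [])
  partition t key p (x ∷ xs) = step do
    ≤p ← key x ≤ᴿ p
    ≥p ← p ≤ᴿ key x
    (lt , eq , gt) ← partition t key p xs
    return (if ≤p then (if ≥p then (lt , x ∷ eq , gt) else (x ∷ lt , eq , gt))
                  else (lt , eq , x ∷ gt))

  select : (fuel : ℕ) → ℕ → List Real → Prog real
  selectFrom : (fuel : ℕ) → ℕ → List Real → List Real → Prog real

  select zero       r xs = zeroᴿ
  select (suc fuel) r xs = step do
    medians ← mediansOfFive xs
    selectFrom fuel r xs medians

  selectFrom fuel r xs []       = do
    xs′ ← sort real _≤ᴿ_ xs
    nth r xs′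
  selectFrom fuel r xs (μ ∷ μs) = do
    k ← count real (μ ∷ μs)
    h ← halfᴺ k
    p ← select fuel h (μ ∷ μs)
    (lt , eq , gt) ← partition real id p xs
    nlt ← count real lt
    neq ← count real eq
    nle ← nlt +ᴺ neq
    in-lt ← r <ᴺ nlt
    in-le ← r <ᴺ nle
    if in-lt then select fuel r lt
      else if in-le then return p
      else (do r′ ← r ∸ᴺ nle
               select fuel r′ gt)

  median : List Real → Prog real
  median xs = do
    k ← count real xs
    h ← halfᴺ k
    select (length xs) h xs

  -- Water levels. A breakpoint is a pair (u_i , w_i).

  Breakpoint : Ty
  Breakpoint = real ⊗ real

  totalCost totalMass : List ⟦ Breakpoint ⟧ → Prog real
  totalCost bs = do
    o ← zeroᴿ
    loop Breakpoint bs o λ s (u , w) → s ⊕ w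
  totalMass bs = do
    o ← zeroᴿ
    loop Breakpoint bs o λ s (u , w) → do
      x ← w ⊛ u
      s ⊕ x

  -- The procedures below that find the level for 0 < c < F^w_Γ, given the
  -- breakpoints of Γ.
  Locator : Set
  Locator = Real → List ⟦ Breakpoint ⟧ → Prog real

  -- The arguments W, S and u⁻ are W, S and u_(ℓ-1) at the start of round ℓ.
  rounds : Real → Real → Real → Real → List ⟦ Breakpoint ⟧ → Prog real
  rounds c W S u⁻ []             = return u⁻
  rounds c W S u⁻ ((u , w) ∷ bs) = step do
    Δu ← u ⊖ u⁻
    SΔu ← S ⊛ Δu
    W′ ← W ⊕ SΔu
    b ← c ≤ᴿ W′
    if b then (do r ← c ⊖ W
                  x ← r ⊘ S
                  u⁻ ⊕ x)
         else (do S′ ← S ⊖ w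
                  rounds c W′ S′ u bs)

  lowerCeiling : ⟦ Breakpoint ⟧ → ⟦ Breakpoint ⟧ → Prog bool
  lowerCeiling (u , _) (u′ , _) = u ≤ᴿ u′

  bySorting : Locator
  bySorting c bs = do
    bs′ ← sort Breakpoint lowerCeiling bs
    o ← zeroᴿ
    S ← totalCost bs′
    rounds c o S o bs′

  ceilings : List ⟦ Breakpoint ⟧ → Prog (list real)
  ceilings []             = return []
  ceilings ((u , w) ∷ bs) = step do
    us ← ceilings bs
    return (u ∷ us)

  -- Weighted-median selection. The list holds the breakpoints still strictly
  -- between the two ends of the search interval; W is the total mass of the
  -- items discarded to its left and S the total cost of those discarded to
  -- its right, so that W_Γ(ζ) = W + S ζ once no breakpoint is left.
  search : (fuel : ℕ) → Real → Real → Real → List ⟦ Breakpoint ⟧ → Prog real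
  search fuel       c W S []       = do
    r ← c ⊖ W
    r ⊘ S
  search zero       c W S (_ ∷ _)  = zeroᴿ
  search (suc fuel) c W S (b ∷ bs) = step do
    us ← ceilings (b ∷ bs)
    p ← median us
    (lt , eq , gt) ← partition Breakpoint proj₁ p (b ∷ bs)
    masslt ← totalMass lt
    masseq ← totalMass eq
    costeq ← totalCost eq
    costgt ← totalCost gt
    W₁ ← W ⊕ masslt
    W₂ ← W₁ ⊕ masseq
    S₁ ← S ⊕ costgt
    S₂ ← S₁ ⊕ costeq
    x ← p ⊛ S₁
    y ← W₂ ⊕ x
    left ← c ≤ᴿ y
    if left then search fuel c W S₂ lt
            else search fuel c W₂ S gt

  bySelection : Locator
  bySelection c bs = do
    o ← zeroᴿ
    search (length bs) c o o bs

  breakpoints : List (Fin n) → Prog (list Breakpoint)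
  breakpoints []       = return []
  breakpoints (i ∷ is) = step do
    u ← ceiling i
    w ← cost i
    bs ← breakpoints is
    return ((u , w) ∷ bs)

  largestCeiling : List (Fin n) → Prog real
  largestCeiling is = do
    o ← zeroᴿ
    loop item is o λ x i → do
      u ← ceiling i
      b ← x ≤ᴿ u
      return (if b then u else x)

  -- The argument FΓ is F^w_Γ, known from the first stage.
  solveWaterLevel : Locator → List (Fin n) → Real → Real → Prog real
  solveWaterLevel locate Γ FΓ c = do
    o ← zeroᴿ
    empty ← c ≡ᴿ o
    if empty then return o else do
      full ← FΓ ≤ᴿ c
      if full then largestCeiling Γ else do
        bs ← breakpoints Γ
        locate c bs

  -- First stage

  -- (ρ̂_k , F^w_{G_k} , k)
  Row : Ty
  Row = real ⊗ real ⊗ group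

  rows : List (Fin m) → Prog (list Row)
  rows []       = return []
  rows (k ∷ ks) = step do
    â ← rep k
    v̂ ← eval-v â
    ŵ ← eval-w â
    ρ̂ ← v̂ ⊘ ŵ
    is ← members k
    o ← zeroᴿ
    Fₖ ← loop item is o λ s i → do
      w ← cost i
      u ← ceiling i
      x ← w ⊛ u
      s ⊕ x
    rs ← rows ks
    return ((ρ̂ , Fₖ , k) ∷ rs)

  higherRatio : ⟦ Row ⟧ → ⟦ Row ⟧ → Prog bool
  higherRatio (ρ , _) (ρ′ , _) = ρ′ ≤ᴿ ρ

  sortRows : List ⟦ Row ⟧ → Prog (list Row)
  sortRows = sort Row higherRatio

  -- The ratio of each row is replaced by the prefix sum of the masses.
  prefixSums : Real → List ⟦ Row ⟧ → Prog (list Row)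
  prefixSums F⁻ []                  = return []
  prefixSums F⁻ ((ρ̂ , Fₖ , k) ∷ rs) = step do
    F≤k ← F⁻ ⊕ Fₖ
    rs′ ← prefixSums F≤k rs
    return ((F≤k , Fₖ , k) ∷ rs′)

  -- The groups before k⋆, the prefix sum F^w_{≤k⋆-1}, and the rows from k⋆ on.
  findBoundary : Real → Real → List ⟦ Row ⟧ → Prog (list group ⊗ real ⊗ list Row)
  findBoundary C F⁻ []                   = return ([] , F⁻ , [])
  findBoundary C F⁻ ((F≤k , Fₖ , k) ∷ rs) = step do
    b ← F≤k ≤ᴿ C
    if b then (do (ks , F⁻⋆ , rs⋆) ← findBoundary C F≤k rs
                  return (k ∷ ks , F⁻⋆ , rs⋆))
         else return ([] , F⁻ , (F≤k , Fₖ , k) ∷ rs)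

  -- Second stage

  saturate clear : Fin m → Prog unit
  saturate k = do
    is ← members k
    loop item is tt λ _ i → do
      u ← ceiling i
      write i u
  clear k = do
    is ← members k
    loop item is tt λ _ i → do
      o ← zeroᴿ
      write i o

  fill : Locator → Real → List (Fin m) → Real → List ⟦ Row ⟧ → Prog unit
  fill locate C ks F⁻ []                  = return tt
  fill locate C ks F⁻ ((_ , FΓ , k⋆) ∷ rs) = do
    loop group ks tt (λ _ k → saturate k)
    loop Row rs tt (λ _ (_ , _ , k) → clear k)
    c⋆ ← C ⊖ F⁻
    Γ ← members k⋆
    ζ⋆ ← solveWaterLevel locate Γ FΓ c⋆
    loop item Γ tt λ _ i → do
      u ← ceiling i
      b ← u ≤ᴿ ζ⋆
      write i (if b then u else ζ⋆)

  groupedKnapsack : (List ⟦ Row ⟧ → Prog (list Row)) → Locator → Prog unit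
  groupedKnapsack arrange locate = do
    C ← budget
    rs ← rows (allFin m)
    rs′ ← arrange rs
    o ← zeroᴿ
    ps ← prefixSums o rs′
    (ks , F⁻ , rs⋆) ← findBoundary C o ps
    fill locate C ks F⁻ rs⋆

  sortingBased selectionBased presortedSelectionBased : Prog unit
  sortingBased            = groupedKnapsack sortRows bySorting
  selectionBased          = groupedKnapsack sortRows bySelection
  presortedSelectionBased = groupedKnapsack return   bySelection

-- An algorithm is a single program text, used for all instances.
Algorithm : Set₁
Algorithm = ∀ (Real Point : Set) (n m : ℕ) → Machine.Prog Real Point n m unit

open Algorithms public using (sortingBased; selectionBased; presortedSelectionBased)

module _ (alg : Algorithm) {F : OrderedField} {n m : ℕ} (I : Instance F n m) where

  private
    program : Machine.Prog (OrderedField.Carrier F) (Instance.Point I) n m unit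
    program = alg _ _ n m

  -- The contents of the output array after running on initial contents z₀.
  outputOf : Run.Output I → Fin n → OrderedField.Carrier F
  outputOf z₀ = Run.output I program z₀

  timeOf spaceOf : ℕ
  timeOf  = Run.time I program
  spaceOf = Run.space I program

∣Γ∣ : ∀ {F n m} {I : Instance F n m} {order z} → Allocation.IsGroupedAllocation I order z → ℕ
∣Γ∣ gp = length (Allocation.IsGroupedAllocation.Γ gp)

{-# OPTIONS --safe #-}

{-
Water level.  W_Γ is nondecreasing and piecewise linear.  The scan over sorted
breakpoints and the weighted-median search both keep the root bracketed, and on
the segment where they stop W_Γ(ζ) = W + S ζ with S > 0, so the root is
(c - W) / S.  Uniqueness comes from the item with the largest ceiling.  The root
exists because the choice of k⋆ gives 0 ≤ c⋆ < F_Γ.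

Selection.  Each median on one side of the pivot brings three elements of its
block of five with it.  With G medians and R survivors among n elements this
gives 2 R + 3 G ≤ 2 n, hence G + R ≤ n - G/2, and T(n) ≤ T(G) + T(R) + O(n) is
linear.  The weighted-median search halves the list in every round, so it is
linear as well.

Groups are non-empty and disjoint, so m ≤ n, loops over all groups cost O(n),
and the writes for different groups do not interfere.
-}

module Submission where

open import Defs
open import Algebra.Bundles using (CommutativeRing)
import Algebra.Construct.NaturalChoice.Min as Min
import Algebra.Construct.NaturalChoice.MinOp as MinOp
import Algebra.Solver.Ring.NaturalCoefficients.Default as SemiringSolver
open import Data.Bool using (Bool; true; false; if_then_else_; T)
open import Data.Empty using (⊥-elim; ⊥)
open import Data.Fin using (Fin; zero; suc; toℕ; cast)
open import Data.Fin.Permutation using (Permutation′; _⟨$⟩ʳ_; _∘ₚ_; cast-id)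
import Data.Fin.Properties as Fin
open import Data.List using (List; []; _∷_; _++_; map; length; foldl; filter; take; tabulate; lookup; concat; allFin)
import Data.List.Extrema as Extrema
import Data.List.Membership.DecPropositional as DecMembership
open import Data.List.Membership.Propositional using (_∈_; _∉_; lose)
open import Data.List.Membership.Propositional.Properties using (∈-map⁻; ∈-map⁺; ∈-++⁺ˡ; ∈-++⁺ʳ; ∈-concat⁺′; ∈-tabulate⁺)
open import Data.List.Properties using (length-++; length-map; ++-assoc; ++-identityʳ; filter-++; filter-all; filter-none; map-++; map-∘; ∷-injectiveˡ; ∷-injectiveʳ; length-tabulate; lookup-tabulate; tabulate-cong; tabulate-lookup; concat-++; take-map; map-tabulate)
import Data.List.Relation.Binary.Permutation.Homogeneous as ↭ₛ
open import Data.List.Relation.Binary.Permutation.Propositional using (_↭_; refl; prep; swap; trans; ↭-refl; ↭-trans; ↭-sym; ↭-reflexive; ↭⇒↭ₛ)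
open import Data.List.Relation.Binary.Permutation.Propositional.Properties as ↭ using (↭-length; All-resp-↭; filter-↭; map⁺; ↭-map-inv)
import Data.List.Relation.Binary.Permutation.Setoid.Properties as ↭ₛ
open import Data.List.Relation.Unary.All as All using (All; []; _∷_)
import Data.List.Relation.Unary.All.Properties as All
open import Data.List.Relation.Unary.AllPairs using (AllPairs; []; _∷_)
import Data.List.Relation.Unary.AllPairs.Properties as AllPairs
open import Data.List.Relation.Unary.Any as Any using (here; there; Any; any?)
import Data.List.Relation.Unary.Any.Properties as Any
open import Data.List.Relation.Unary.Unique.Propositional using (Unique)
open import Data.List.Relation.Unary.Unique.Propositional.Properties using (allFin⁺)
open import Data.Nat as Nat using (ℕ; zero; suc; _⊔_; z≤n; s≤s; ⌊_/2⌋; ⌈_/2⌉)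
open import Data.Nat.ListAction using (sum)
open import Data.Nat.Logarithm using (⌈log₂_⌉; ⌈log₂⌉-mono-≤; ⌈log₂⌈n/2⌉⌉≡⌈log₂n⌉∸1)
import Data.Nat.Properties as ℕₚ
open import Data.Nat.Tactic.RingSolver using (solve-∀)
open import Data.Product using (∃; _×_; _,_; proj₁; proj₂; ∃-syntax; Σ-syntax)
open import Data.Sum using (inj₁; inj₂)
open import Data.Unit using (tt)
open import Data.Vec.Functional using (updateAt)
open import Data.Vec.Functional.Properties using (updateAt-updates; updateAt-minimal)
open import Function as Function using (const; _∘_)
open import Level using (0ℓ)
open import Relation.Binary.Bundles using (DecTotalOrder)
open import Relation.Binary.PropositionalEquality as ≡ using (_≡_; _≢_; refl; sym; cong; cong₂; subst; subst₂)
open import Relation.Nullary using (¬_; yes; no; does; Dec)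
open import Relation.Unary using (Pred; Decidable)

-- The cost inequalities are certified as nonnegative combinations of hypotheses plus a slack, so
-- their coefficients record what pays for what. In selection, taking `2 R + 3 G ≤ 2 n` 200 times
-- leaves `200 * G` unspent within `400 * n`. This has to pay for the block sorts, the counting, the
-- partition and every constant, which works because `1 ≤ G` and `n ≤ 4 + 5 * G`; lists without a
-- full block of five are treated apart.
--
-- Space needs more care than time, since a bound value stays alive until its binder finishes. A
-- finished recursive call, however, leaves only its result behind. In merge sort the lists held
-- along one branch therefore form a geometric series, because each half is at most a fixed fraction
-- of its list. Adding the space of the two calls instead of taking their maximum would give n log
-- n.
--
-- Ties make several orders of the groups admissible, so no order is fixed beforehand: it is
-- reconstructed from the list that merge sort returns, and the allocation is proved for that order.

-- Ordered fields, finite sums, and the filled amount as a function of the level.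

module OrderedFieldProperties (F : OrderedField) where
  open OrderedField F
  open ≡.≡-Reasoning

  commutativeRing : CommutativeRing 0ℓ 0ℓ
  commutativeRing = record { isCommutativeRing = isCommutativeRing }

  open CommutativeRing commutativeRing public
    using (commutativeSemiring; +-comm; +-assoc; +-identityˡ; +-identityʳ; *-identityʳ;
           zeroˡ; zeroʳ; -‿inverseˡ; -‿inverseʳ)

  open SemiringSolver commutativeSemiring using (solve; _:=_; _:+_; _:*_)

  open DecTotalOrder decTotalOrder public
    using () renaming (refl to ≤-refl; reflexive to ≤-reflexive; trans to ≤-trans; antisym to ≤-antisym; total to ≤-total)

  open Min (DecTotalOrder.totalOrder decTotalOrder) public using (x≤y⇒x⊓y≈x; x≤y⇒y⊓x≈x; minOperator)
  open MinOp minOperator public using (⊓-monoʳ-≤)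

  +-cancelʳ-≡ : ∀ z {x y} → x + z ≡ y + z → x ≡ y
  +-cancelʳ-≡ z {x} {y} eq = begin
    x              ≡⟨ +-identityʳ x ⟨
    x + 0#         ≡⟨ cong (x +_) (-‿inverseʳ z) ⟨
    x + (z + - z)  ≡⟨ +-assoc x z (- z) ⟨
    x + z + - z    ≡⟨ cong (_+ - z) eq ⟩
    y + z + - z    ≡⟨ +-assoc y z (- z) ⟩
    y + (z + - z)  ≡⟨ cong (y +_) (-‿inverseʳ z) ⟩
    y + 0#         ≡⟨ +-identityʳ y ⟩
    y              ∎

  x-y+y≡x : ∀ x y → (x - y) + y ≡ x
  x-y+y≡x x y = begin
    x + - y + y    ≡⟨ +-assoc x (- y) y ⟩
    x + (- y + y)  ≡⟨ cong (x +_) (-‿inverseˡ y) ⟩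
    x + 0#         ≡⟨ +-identityʳ x ⟩
    x              ∎

  x+y≡z⇒x≡z-y : ∀ {x y z} → x + y ≡ z → x ≡ z - y
  x+y≡z⇒x≡z-y {x} {y} {z} eq = +-cancelʳ-≡ y (≡.trans eq (sym (x-y+y≡x z y)))

  -- Both sides are moved so that no subtraction occurs in the certificate.
  ≤-from : ∀ {a b x y} → x ≤ y → a + y ≡ b + x → a ≤ b
  ≤-from {a} {b} {x} {y} x≤y eq =
    subst₂ _≤_ (lhs a) (lhs b) (+-monoʳ-≤ (- y) (≤-trans (≤-reflexive eq) (+-monoʳ-≤ b x≤y)))
    where
    lhs : ∀ c → - y + (c + y) ≡ c
    lhs c = ≡.trans (+-comm (- y) (c + y)) (sym (x+y≡z⇒x≡z-y refl))

  <-from : ∀ {a b x y} → x < y → a + y ≡ b + x → a < b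
  <-from {a} {b} {x} {y} (x≤y , x≢y) eq = ≤-from x≤y eq , λ { refl →
    x≢y (+-cancelʳ-≡ b (≡.trans (+-comm x b) (≡.trans (sym eq) (+-comm b y)))) }

  +-mono-≤ : ∀ {a b x y} → a ≤ b → x ≤ y → a + x ≤ b + y
  +-mono-≤ {a} {b} {x} {y} a≤b x≤y =
    ≤-trans (+-monoʳ-≤ a x≤y) (≤-from a≤b (solve 3 (λ a b y → (a :+ y) :+ b := (b :+ y) :+ a) refl a b y))

  <-≤-trans : ∀ {x y z} → x < y → y ≤ z → x < z
  <-≤-trans (x≤y , x≢y) y≤z = ≤-trans x≤y y≤z , λ { refl → x≢y (≤-antisym x≤y y≤z) }

  ≤-<-trans : ∀ {x y z} → x ≤ y → y < z → x < z
  ≤-<-trans x≤y (y≤z , y≢z) = ≤-trans x≤y y≤z , λ { refl → y≢z (≤-antisym y≤z x≤y) }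

  <⇒≤ : ∀ {x y} → x < y → x ≤ y
  <⇒≤ = proj₁

  <⇒≱ : ∀ {x y} → x < y → ¬ (y ≤ x)
  <⇒≱ (x≤y , x≢y) y≤x = x≢y (≤-antisym x≤y y≤x)

  ≰⇒> : ∀ {x y} → ¬ (x ≤ y) → y < x
  ≰⇒> {x} {y} x≰y with ≤-total x y
  ... | inj₁ x≤y = ⊥-elim (x≰y x≤y)
  ... | inj₂ y≤x = y≤x , λ { refl → x≰y ≤-refl }

  0≤y-x : ∀ {x y} → x ≤ y → 0# ≤ y - x
  0≤y-x {x} {y} x≤y = ≤-from x≤y (≡.trans (+-identityˡ y) (sym (x-y+y≡x y x)))

  *-monoʳ-≤ : ∀ {z x y} → 0# ≤ z → x ≤ y → z * x ≤ z * y
  *-monoʳ-≤ {z} {x} {y} 0≤z x≤y = ≤-from (*-nonneg 0≤z (0≤y-x x≤y)) (begin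
    z * x + z * (y - x)    ≡⟨ solve 3 (λ z x d → z :* x :+ z :* d := z :* (d :+ x)) refl z x (y - x) ⟩
    z * (y - x + x)        ≡⟨ cong (z *_) (x-y+y≡x y x) ⟩
    z * y                  ≡⟨ +-identityʳ (z * y) ⟨
    z * y + 0#             ∎)

  x*[y*x⁻¹]≡y : ∀ {x} y → x ≢ 0# → x * (y * x ⁻¹) ≡ y
  x*[y*x⁻¹]≡y {x} y x≢0 = begin
    x * (y * x ⁻¹)  ≡⟨ solve 3 (λ x y z → x :* (y :* z) := y :* (x :* z)) refl x y (x ⁻¹) ⟩
    y * (x * x ⁻¹)  ≡⟨ cong (y *_) (*-inverseʳ x x≢0) ⟩
    y * 1#          ≡⟨ *-identityʳ y ⟩
    y               ∎

  *-cancelˡ-≡ : ∀ {z x y} → z ≢ 0# → z * x ≡ z * y → x ≡ y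
  *-cancelˡ-≡ {z} {x} {y} z≢0 eq = ≡.trans (sym (z⁻¹zt x)) (≡.trans (cong (z ⁻¹ *_) eq) (z⁻¹zt y))
    where
    z⁻¹zt : ∀ t → z ⁻¹ * (z * t) ≡ t
    z⁻¹zt t = ≡.trans (solve 3 (λ i z t → i :* (z :* t) := z :* (t :* i)) refl (z ⁻¹) z t) (x*[y*x⁻¹]≡y t z≢0)

  -- By totality: in the opposite case monotonicity forces the two products to be equal, and
  -- cancelling an equation suffices. The sign of `z ⁻¹` never has to be determined.
  *-cancelˡ-≤ : ∀ {z x y} → 0# < z → z * x ≤ z * y → x ≤ y
  *-cancelˡ-≤ {z} {x} {y} (0≤z , 0≢z) zx≤zy with ≤-total x y
  ... | inj₁ x≤y = x≤y
  ... | inj₂ y≤x = ≤-reflexive (*-cancelˡ-≡ (λ z≡0 → 0≢z (sym z≡0)) (≤-antisym zx≤zy (*-monoʳ-≤ 0≤z y≤x)))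

  module _ {X : Set} where

    ∑-++ : ∀ (xs ys : List X) (f : X → Carrier) → ∑ (xs ++ ys) f ≡ ∑ xs f + ∑ ys f
    ∑-++ []       ys f = sym (+-identityˡ _)
    ∑-++ (x ∷ xs) ys f = ≡.trans (cong (f x +_) (∑-++ xs ys f)) (sym (+-assoc _ _ _))

    ∑-↭ : ∀ {xs ys : List X} (f : X → Carrier) → xs ↭ ys → ∑ xs f ≡ ∑ ys f
    ∑-↭ f refl           = refl
    ∑-↭ f (prep x p)     = cong (f x +_) (∑-↭ f p)
    ∑-↭ f (swap {xs = xs} x y p) = ≡.trans
      (solve 3 (λ a b c → a :+ (b :+ c) := b :+ (a :+ c)) refl (f x) (f y) (∑ xs f))
      (cong (λ s → f y + (f x + s)) (∑-↭ f p))
    ∑-↭ f (trans p q)    = ≡.trans (∑-↭ f p) (∑-↭ f q)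

    ∑-cong : ∀ {f g : X → Carrier} {xs} → All (λ x → f x ≡ g x) xs → ∑ xs f ≡ ∑ xs g
    ∑-cong []         = refl
    ∑-cong (eq ∷ eqs) = cong₂ _+_ eq (∑-cong eqs)

    ∑-mono : ∀ {f g : X → Carrier} {xs} → All (λ x → f x ≤ g x) xs → ∑ xs f ≤ ∑ xs g
    ∑-mono []       = ≤-refl
    ∑-mono (p ∷ ps) = +-mono-≤ p (∑-mono ps)

    ∑-*ʳ : ∀ (f : X → Carrier) xs z → ∑ xs (λ x → f x * z) ≡ ∑ xs f * z
    ∑-*ʳ f []       z = sym (zeroˡ z)
    ∑-*ʳ f (x ∷ xs) z = ≡.trans (cong (f x * z +_) (∑-*ʳ f xs z))
      (solve 3 (λ a s z → a :* z :+ s :* z := (a :+ s) :* z) refl (f x) (∑ xs f) z)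

    ∑-nonneg : ∀ {f : X → Carrier} {xs} → All (λ x → 0# ≤ f x) xs → 0# ≤ ∑ xs f
    ∑-nonneg []       = ≤-refl
    ∑-nonneg (p ∷ ps) = ≤-trans (≤-reflexive (sym (+-identityˡ _))) (+-mono-≤ p (∑-nonneg ps))

    -- A strict gain in one term could only be offset by a loss elsewhere, which the termwise
    -- inequality forbids. Uniqueness of the water level rests on this.
    ∑-tight : ∀ {f g : X → Carrier} {xs} → All (λ x → f x ≤ g x) xs → ∑ xs f ≡ ∑ xs g →
              ∀ {x} → x ∈ xs → f x ≡ g x
    ∑-tight {f} {g} {x ∷ xs} (p ∷ ps) eq = λ where
        (here refl) → f≡g
        (there x∈)  → ∑-tight ps (+-cancelʳ-≡ (f x) (begin
          ∑ xs f + f x  ≡⟨ +-comm _ _ ⟩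
          f x + ∑ xs f  ≡⟨ eq ⟩
          g x + ∑ xs g  ≡⟨ cong (_+ ∑ xs g) f≡g ⟨
          f x + ∑ xs g  ≡⟨ +-comm _ _ ⟩
          ∑ xs g + f x  ∎)) x∈
      where
      f≡g : f x ≡ g x
      f≡g = ≤-antisym p (≤-from (∑-mono ps) (sym eq))

  module WaterLevel where

    -- A breakpoint (u , w) is the ceiling and the cost of an item.
    fillᴮ : List (Carrier × Carrier) → Carrier → Carrier
    fillᴮ bs ζ = ∑ bs λ (u , w) → w * (u ⊓ ζ)

    massᴮ costᴮ : List (Carrier × Carrier) → Carrier
    massᴮ bs = ∑ bs λ (u , w) → w * u
    costᴮ bs = ∑ bs proj₂

    Weighted : List (Carrier × Carrier) → Set
    Weighted = All λ (u , w) → 0# ≤ w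

    -- Saturated breakpoints contribute a constant; in `fillᴮ-below` the unsaturated ones contribute
    -- a slope. Both searches reduce the curve to these two regimes.
    fillᴮ-above : ∀ {ζ bs} → All (λ (u , w) → u ≤ ζ) bs → fillᴮ bs ζ ≡ massᴮ bs
    fillᴮ-above us≤ζ = ∑-cong (All.map (λ {(u , w)} u≤ζ → cong (w *_) (x≤y⇒x⊓y≈x u≤ζ)) us≤ζ)

    fillᴮ-below : ∀ {ζ bs} → All (λ (u , w) → ζ ≤ u) bs → fillᴮ bs ζ ≡ costᴮ bs * ζ
    fillᴮ-below {ζ} {bs} ζ≤us = ≡.trans
      (∑-cong (All.map (λ {(u , w)} ζ≤u → cong (w *_) (x≤y⇒y⊓x≈x ζ≤u)) ζ≤us))
      (∑-*ʳ proj₂ bs ζ)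

    fillᴮ-mono : ∀ {bs ζ ζ′} → Weighted bs → ζ ≤ ζ′ → fillᴮ bs ζ ≤ fillᴮ bs ζ′
    fillᴮ-mono {ζ = ζ} {ζ′} ws ζ≤ζ′ = ∑-mono (All.map (λ {(u , w)} 0≤w → *-monoʳ-≤ 0≤w (⊓-monoʳ-≤ u ζ≤ζ′)) ws)

-- Certificates for linear inequalities, halving, and the space recurrence of merge sort.

module _ where
  open Nat using (_+_; _*_; _≤_)

  -- A linear inequality is certified by a combination x ≤ y of hypotheses and
  -- a slack s, leaving a semiring identity.
  lin : ∀ {a b x y} s → x ≤ y → a + y + s ≡ b + x → a ≤ b
  lin {a} {b} {x} {y} s x≤y eq = ℕₚ.+-cancelʳ-≤ y a b (begin
    a + y      ≤⟨ ℕₚ.m≤m+n (a + y) s ⟩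
    a + y + s  ≡⟨ eq ⟩
    b + x      ≤⟨ ℕₚ.+-monoʳ-≤ b x≤y ⟩
    b + y      ∎)
    where open ℕₚ.≤-Reasoning

  slack : ∀ {a b} s → a + s ≡ b → a ≤ b
  slack {a} s refl = ℕₚ.m≤m+n a s

  infixl 6 _+≤_
  infixl 7 _*≤_

  _+≤_ : ∀ {a b c d} → a ≤ b → c ≤ d → a + c ≤ b + d
  _+≤_ = ℕₚ.+-mono-≤

  _*≤_ : ∀ {a b} k → a ≤ b → k * a ≤ k * b
  k *≤ p = ℕₚ.*-monoʳ-≤ k p

  -- Rounding the half up lowers the ceiling logarithm by exactly one, so the recurrence of merge
  -- sort closes without an error term. The half rounded down follows by monotonicity.
  ⌈log₂⌉-halves : ∀ n → ∃ λ L → ⌈log₂ suc (suc n) ⌉ ≡ suc L ×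
                  ⌈log₂ ⌈ suc (suc n) /2⌉ ⌉ ≤ L × ⌈log₂ ⌊ suc (suc n) /2⌋ ⌉ ≤ L
  ⌈log₂⌉-halves n = L , L-eq , ℕₚ.≤-reflexive half , ℕₚ.≤-trans (⌈log₂⌉-mono-≤ (ℕₚ.⌊n/2⌋≤⌈n/2⌉ (suc (suc n)))) (ℕₚ.≤-reflexive half)
    where
    L = ⌈log₂ suc (suc n) ⌉ Nat.∸ 1
    half : ⌈log₂ ⌈ suc (suc n) /2⌉ ⌉ ≡ L
    half = ⌈log₂⌈n/2⌉⌉≡⌈log₂n⌉∸1 (suc (suc n))
    L-eq : ⌈log₂ suc (suc n) ⌉ ≡ suc L
    L-eq = sym (ℕₚ.m+[n∸m]≡n {1} (⌈log₂⌉-mono-≤ {2} {suc (suc n)} (s≤s (s≤s z≤n))))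

  ⊔≤ : ∀ x y {k} → x ≤ k → y ≤ k → x ⊔ y ≤ k
  ⊔≤ x y = ℕₚ.⊔-lub

  +⊔-lub : ∀ {x y k} z → z + x ≤ k → z + y ≤ k → z + (x ⊔ y) ≤ k
  +⊔-lub {x} {y} z zx≤k zy≤k = ℕₚ.≤-trans (ℕₚ.≤-reflexive (ℕₚ.+-distribˡ-⊔ z x y)) (ℕₚ.⊔-lub zx≤k zy≤k)

  -- The space recurrence of merge sort on a list of a + b elements of w words,
  -- split into lists of a and b elements.
  mergeSort-space-bound : ∀ w a′ b′ {s₁ s₂ s₃ s₄ z z₁ z₂} →
    let a = suc a′; b = suc b′; W = suc w; C = suc W; D = 8 * C in
    b ≤ a → a ≤ 2 * b →
    s₁ ≤ 2 + W * (a + b) → z ≡ 2 + W * (a + b) → s₂ ≤ D * a → z₁ ≡ suc (W * a) →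
    s₃ ≤ D * b → z₂ ≡ suc (W * b) → s₄ ≤ 2 + C * (a + b) →
    suc s₁ ⊔ (z + (suc s₂ ⊔ (z₁ + (suc s₃ ⊔ (z₂ + s₄))))) ≤ D * (a + b)
  mergeSort-space-bound w a′ b′ {s₁} {s₂} {s₃} {s₄} b≤a a≤2b s₁≤ refl s₂≤ refl s₃≤ refl s₄≤ = ⊔≤ (suc s₁) (z + (suc s₂ ⊔ (z₁ + (suc s₃ ⊔ (suc (W * b) + s₄)))))
    (lin {x = s₁} {2 + W * (a + b)} (27 + 14 * (a′ + b′) + (w + 6 * w) * (a + b) + (a′ + b′)) s₁≤ (eq₁ w a′ b′ s₁))
    (+⊔-lub {suc s₂} {z₁ + (suc s₃ ⊔ (suc (W * b) + s₄))} z
      (lin (10 + 13 * b′ + 5 * (w * b)) (s₂≤ +≤ (W *≤ a≤2b)) (eq₂ w a′ b′ s₂))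
      (ℕₚ.≤-trans (ℕₚ.≤-reflexive (sym (ℕₚ.+-assoc z z₁ (suc s₃ ⊔ (suc (W * b) + s₄)))))
        (+⊔-lub {suc s₃} {suc (W * b) + s₄} (z + z₁)
          (lin (9 + 13 * a′ + 5 * (w * a)) (s₃≤ +≤ (W *≤ b≤a)) (eq₃ w a′ b′ s₃))
          (lin (18 + 12 * (a′ + b′) + 5 * (w * (a + b))) s₄≤ (eq₄ w a′ b′ s₄)))))
    where
    a = suc a′
    b = suc b′
    W = suc w
    z = 2 + W * (a + b)
    z₁ = suc (W * a)
    eq₁ : ∀ w a b s → suc s + (2 + suc w * (suc a + suc b)) + (27 + 14 * (a + b) + (w + 6 * w) * (suc a + suc b) + (a + b))
                    ≡ 8 * suc (suc w) * (suc a + suc b) + s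
    eq₁ = solve-∀
    eq₂ : ∀ w a b s → 2 + suc w * (suc a + suc b) + suc s + (8 * suc (suc w) * suc a + suc w * (2 * suc b)) + (10 + 13 * b + 5 * (w * suc b))
                    ≡ 8 * suc (suc w) * (suc a + suc b) + (s + suc w * suc a)
    eq₂ = solve-∀
    eq₃ : ∀ w a b s → 2 + suc w * (suc a + suc b) + suc (suc w * suc a) + suc s + (8 * suc (suc w) * suc b + suc w * suc a) + (9 + 13 * a + 5 * (w * suc a))
                    ≡ 8 * suc (suc w) * (suc a + suc b) + (s + suc w * suc b)
    eq₃ = solve-∀
    eq₄ : ∀ w a b s → 2 + suc w * (suc a + suc b) + suc (suc w * suc a) + (suc (suc w * suc b) + s) + (2 + suc (suc w) * (suc a + suc b))
                        + (18 + 12 * (a + b) + 5 * (w * (suc a + suc b)))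
                    ≡ 8 * suc (suc w) * (suc a + suc b) + s
    eq₄ = solve-∀

-- Cost rules for branches and loops, and merge sort.

module Programs {F : OrderedField} {n m : ℕ} (I : Instance F n m) where
  open OrderedField F using (Carrier)
  open Machine Carrier (Instance.Point I) n m
  open Run I
  open Algorithms Carrier (Instance.Point I) n m using (split; merge; mergeSort; sort)
  open Nat using (_+_; _*_; _≤_)

  result-if : ∀ t (P : ⟦ t ⟧ → Set) {p q : Prog t} b →
              (b ≡ true → P (result p)) → (b ≡ false → P (result q)) → P (result (if b then p else q))
  result-if t P true  Pp Pq = Pp refl
  result-if t P false Pp Pq = Pq refl

  time-if : ∀ {t} {p q : Prog t} {k} b → time p ≤ k → time q ≤ k → time (if b then p else q) ≤ k
  time-if true  p≤k q≤k = p≤k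
  time-if false p≤k q≤k = q≤k

  space-if : ∀ {t} {p q : Prog t} {k} b → space p ≤ k → space q ≤ k → space (if b then p else q) ≤ k
  space-if true  p≤k q≤k = p≤k
  space-if false p≤k q≤k = q≤k

  loopTime-≤ : ∀ {A X : Set} {next : A → X → A} {body : A → X → ℕ} {f : X → ℕ} →
               (∀ a x → body a x ≤ f x) →
               ∀ a xs → loopTime next body a xs ≤ suc (sum (map (λ x → suc (f x)) xs))
  loopTime-≤ h a []       = s≤s z≤n
  loopTime-≤ {f = f} h a (x ∷ xs) = s≤s (ℕₚ.≤-trans (h a x +≤ loopTime-≤ h _ xs)
    (ℕₚ.≤-reflexive (ℕₚ.+-suc (f x) _)))

  loopTime-const : ∀ {A X : Set} {next : A → X → A} {body : A → X → ℕ} {k : ℕ} →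
                   (∀ a x → body a x ≤ k) → ∀ a xs → loopTime next body a xs ≤ suc (suc k * length xs)
  loopTime-const {k = k} h a []       = s≤s z≤n
  loopTime-const {next = next} {body} {k} h a (x ∷ xs) = s≤s (lin 0 (h a x +≤ loopTime-const {next = next} h (next a x) xs)
    (eq (body a x) (loopTime next body (next a x) xs) k (length xs)))
    where
    eq : ∀ b t k l → b + t + (k + suc (suc k * l)) + 0 ≡ suc k * suc l + (b + t)
    eq = solve-∀

  -- Iterations do not accumulate: a loop takes the maximum over its rounds, so a uniform bound per
  -- round holds whatever the length of the list.
  loopSpace-const : ∀ {A X : Set} {words : A → ℕ} {next : A → X → A} {body : A → X → ℕ} {k : ℕ} →
                    (∀ a x → suc (words a + body a x) ≤ k) → ∀ a xs → loopSpace words next body a xs ≤ k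
  loopSpace-const h a []       = z≤n
  loopSpace-const h a (x ∷ xs) = ℕₚ.⊔-lub (h a x) (loopSpace-const h _ xs)

  size-list : ∀ t {w} → (∀ x → size t x ≡ w) → ∀ xs → size (list t) xs ≡ suc (suc w * length xs)
  size-list t {w} sz []       = cong suc (sym (ℕₚ.*-zeroʳ (suc w)))
  size-list t {w} sz (x ∷ xs) = cong suc (≡.trans (cong₂ _+_ (cong suc (sz x)) (ℕₚ.suc-injective (size-list t sz xs)))
    (sym (ℕₚ.*-suc (suc w) (length xs))))

  module MergeSort (t : Ty) (_≼_ : ⟦ t ⟧ → ⟦ t ⟧ → Prog bool) where

    split-↭ : ∀ xs → proj₁ (result (split t _≼_ xs)) ++ proj₂ (result (split t _≼_ xs)) ↭ xs
    split-↭ []           = ↭-refl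
    split-↭ (x ∷ [])     = ↭-refl
    split-↭ (x ∷ y ∷ xs) = prep x (↭-trans (↭.shift y _ _) (prep y (split-↭ xs)))

    length-split : ∀ xs → length (proj₁ (result (split t _≼_ xs))) ≡ ⌈ length xs /2⌉
                        × length (proj₂ (result (split t _≼_ xs))) ≡ ⌊ length xs /2⌋
    length-split []           = refl , refl
    length-split (x ∷ [])     = refl , refl
    length-split (x ∷ y ∷ xs) = cong suc (proj₁ (length-split xs)) , cong suc (proj₂ (length-split xs))

    time-split : ∀ xs → time (split t _≼_ xs) ≤ length xs
    time-split []           = z≤n
    time-split (x ∷ [])     = z≤n
    time-split (x ∷ y ∷ xs) = s≤s (ℕₚ.≤-trans (ℕₚ.≤-reflexive (ℕₚ.+-identityʳ _)) (ℕₚ.m≤n⇒m≤1+n (time-split xs)))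

    merge-↭ : ∀ xs ys → result (merge t _≼_ xs ys) ↭ xs ++ ys
    merge-↭ []       ys       = ↭-refl
    merge-↭ (x ∷ xs) []       = ↭-reflexive (sym (++-identityʳ (x ∷ xs)))
    merge-↭ (x ∷ xs) (y ∷ ys) = result-if (list t) (_↭ x ∷ xs ++ y ∷ ys) (result (x ≼ y))
      (λ _ → prep x (merge-↭ xs (y ∷ ys)))
      (λ _ → ↭-trans (prep y (merge-↭ (x ∷ xs) ys)) (↭-sym (↭.shift y (x ∷ xs) ys)))

    module _ (time-≼ : ∀ x y → time (x ≼ y) ≡ 1) where

      time-merge : ∀ xs ys → time (merge t _≼_ xs ys) ≤ 2 * (length xs + length ys)
      time-merge []       ys       = z≤n
      time-merge (x ∷ xs) []       = z≤n
      time-merge (x ∷ xs) (y ∷ ys) = s≤s (ℕₚ.≤-trans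
        (ℕₚ.≤-reflexive (time-≼ x y) +≤ time-if (result (x ≼ y))
          (lin 0 (time-merge xs (y ∷ ys)) (eq₁ (time (merge t _≼_ xs (y ∷ ys))) (length xs) (length ys)))
          (lin 0 (time-merge (x ∷ xs) ys) (eq₂ (time (merge t _≼_ (x ∷ xs) ys)) (length xs) (length ys))))
        (ℕₚ.≤-reflexive (eq₃ (length xs) (length ys))))
        where
        eq₁ : ∀ t a b → t + 0 + 2 * (a + suc b) + 0 ≡ 2 * (a + suc b) + t
        eq₁ = solve-∀
        eq₂ : ∀ t a b → t + 0 + 2 * (suc a + b) + 0 ≡ 2 * (a + suc b) + t
        eq₂ = solve-∀
        eq₃ : ∀ a b → suc (2 * (a + suc b)) ≡ a + suc b + suc (a + suc b + 0)
        eq₃ = solve-∀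

    mergeSort-↭ : ∀ fuel xs → result (mergeSort t _≼_ fuel xs) ↭ xs
    mergeSort-↭ fuel       []           = ↭-refl
    mergeSort-↭ fuel       (x ∷ [])     = ↭-refl
    mergeSort-↭ zero       (x ∷ y ∷ xs) = ↭-refl
    mergeSort-↭ (suc fuel) (x ∷ y ∷ xs) = ↭-trans
      (merge-↭ (result (mergeSort t _≼_ fuel ls)) (result (mergeSort t _≼_ fuel rs)))
      (↭-trans (↭.++⁺ (mergeSort-↭ fuel ls) (mergeSort-↭ fuel rs)) (split-↭ (x ∷ y ∷ xs)))
      where
      ls = proj₁ (result (split t _≼_ (x ∷ y ∷ xs)))
      rs = proj₂ (result (split t _≼_ (x ∷ y ∷ xs)))

    sort-↭ : ∀ xs → result (sort t _≼_ xs) ↭ xs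
    sort-↭ xs = mergeSort-↭ (length xs) xs

    module _ (time-≼ : ∀ x y → time (x ≼ y) ≡ 1) where

      time-mergeSort : ∀ fuel xs → time (mergeSort t _≼_ fuel xs) ≤ 4 * (length xs * ⌈log₂ length xs ⌉)
      time-mergeSort fuel       []           = z≤n
      time-mergeSort fuel       (x ∷ [])     = z≤n
      time-mergeSort zero       (x ∷ y ∷ xs) = z≤n
      time-mergeSort (suc fuel) (x ∷ y ∷ xs) with ⌈log₂⌉-halves (length xs)
      ... | L , L-eq , a≤L , b≤L = subst (λ l → suc (τ₁ + (τ₂ + (τ₃ + τ₄))) ≤ 4 * (suc (suc (length xs)) * l)) (sym L-eq)
            -- Outside the recursive calls the cost is at most 1 for the step, `N` for the split and
            -- `2 * N` for the merge. The extra level of the logarithm provides `4 * N`, so `N - 1`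
            -- is left as slack.
            (lin {suc (τ₁ + (τ₂ + (τ₃ + τ₄)))} {4 * (N * suc L)} {τ₁ + τ₂ + τ₃ + τ₄} {bound} (suc (length xs))
              (time-split (x ∷ y ∷ xs) +≤ sortTime ls a≤L (proj₁ lens) +≤ sortTime rs b≤L (proj₂ lens) +≤ mergeTime)
              (≡.trans (cong (λ h → suc (τ₁ + (τ₂ + (τ₃ + τ₄))) + (N + 4 * (length ls * L) + 4 * (length rs * L) + 2 * h) + suc (length xs)) halves)
                (≡.trans (eq τ₁ τ₂ τ₃ τ₄ (length ls) (length rs) L (length xs))
                  (cong (λ h → 4 * (N + L * h) + (τ₁ + τ₂ + τ₃ + τ₄)) halves
                   ⟨≡⟩ eq₂ (length xs) L (τ₁ + τ₂ + τ₃ + τ₄)))))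
        where
        _⟨≡⟩_ = ≡.trans
        N  = suc (suc (length xs))
        ls = proj₁ (result (split t _≼_ (x ∷ y ∷ xs)))
        rs = proj₂ (result (split t _≼_ (x ∷ y ∷ xs)))
        ls′ = result (mergeSort t _≼_ fuel ls)
        rs′ = result (mergeSort t _≼_ fuel rs)
        τ₁ = time (split t _≼_ (x ∷ y ∷ xs))
        τ₂ = time (mergeSort t _≼_ fuel ls)
        τ₃ = time (mergeSort t _≼_ fuel rs)
        τ₄ = time (merge t _≼_ ls′ rs′)
        bound = N + 4 * (length ls * L) + 4 * (length rs * L) + 2 * (length ls + length rs)
        lens = length-split (x ∷ y ∷ xs)
        halves : length ls + length rs ≡ N
        halves = ≡.trans (sym (length-++ ls)) (↭-length (split-↭ (x ∷ y ∷ xs)))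
        sortTime : ∀ zs {h} → ⌈log₂ h ⌉ ≤ L → length zs ≡ h → time (mergeSort t _≼_ fuel zs) ≤ 4 * (length zs * L)
        sortTime zs h≤L refl = ℕₚ.≤-trans (time-mergeSort fuel zs) (4 *≤ (length zs *≤ h≤L))
        mergeTime : τ₄ ≤ 2 * (length ls + length rs)
        mergeTime = subst₂ (λ a b → τ₄ ≤ 2 * (a + b)) (↭-length (mergeSort-↭ fuel ls)) (↭-length (mergeSort-↭ fuel rs))
                      (time-merge time-≼ ls′ rs′)
        eq : ∀ τ₁ τ₂ τ₃ τ₄ a b L l → suc (τ₁ + (τ₂ + (τ₃ + τ₄))) + (suc (suc l) + 4 * (a * L) + 4 * (b * L) + 2 * suc (suc l)) + suc l
                                 ≡ 4 * (suc (suc l) + L * (a + b)) + (τ₁ + τ₂ + τ₃ + τ₄)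
        eq = solve-∀
        eq₂ : ∀ l L τ → 4 * (suc (suc l) + L * suc (suc l)) + τ ≡ 4 * (suc (suc l) * suc L) + τ
        eq₂ = solve-∀

      time-sort : ∀ xs → time (sort t _≼_ xs) ≤ 4 * (length xs * ⌈log₂ length xs ⌉)
      time-sort xs = time-mergeSort (length xs) xs

    module _ {R : ⟦ t ⟧ → ⟦ t ⟧ → Set} (R-trans : ∀ {x y z} → R x y → R y z → R x z)
             (≼-true : ∀ {x y} → result (x ≼ y) ≡ true → R x y)
             (≼-false : ∀ {x y} → result (x ≼ y) ≡ false → R y x) where

      merge-sorted : ∀ {xs ys} → AllPairs R xs → AllPairs R ys → AllPairs R (result (merge t _≼_ xs ys))
      merge-sorted []         ys↗ = ys↗
      merge-sorted (x≤ ∷ xs↗) []  = x≤ ∷ xs↗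
      merge-sorted {x ∷ xs} {y ∷ ys} (x≤ ∷ xs↗) (y≤ ∷ ys↗) = result-if (list t) (AllPairs R) (result (x ≼ y))
        (λ b≡true → All-resp-↭ (↭-sym (merge-↭ xs (y ∷ ys)))
            (All.++⁺ x≤ (≼-true b≡true ∷ All.map (R-trans (≼-true b≡true)) y≤))
          ∷ merge-sorted xs↗ (y≤ ∷ ys↗))
        (λ b≡false → All-resp-↭ (↭-sym (merge-↭ (x ∷ xs) ys))
            (All.++⁺ (≼-false b≡false ∷ All.map (R-trans (≼-false b≡false)) x≤) y≤)
          ∷ merge-sorted (x≤ ∷ xs↗) ys↗)

      mergeSort-sorted : ∀ fuel xs → length xs ≤ fuel → AllPairs R (result (mergeSort t _≼_ fuel xs))
      mergeSort-sorted fuel       []           _ = []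
      mergeSort-sorted fuel       (x ∷ [])     _ = [] ∷ []
      mergeSort-sorted (suc fuel) (x ∷ y ∷ xs) (s≤s l≤fuel) = merge-sorted
        (mergeSort-sorted fuel ls (ℕₚ.≤-trans (ℕₚ.≤-reflexive (proj₁ lens))
          (ℕₚ.≤-trans (ℕₚ.≤-pred (ℕₚ.⌈n/2⌉<n (length xs))) l≤fuel)))
        (mergeSort-sorted fuel rs (ℕₚ.≤-trans (ℕₚ.≤-reflexive (proj₂ lens))
          (ℕₚ.≤-trans (ℕₚ.≤-pred (ℕₚ.⌊n/2⌋<n (suc (length xs)))) l≤fuel)))
        where
        ls = proj₁ (result (split t _≼_ (x ∷ y ∷ xs)))
        rs = proj₂ (result (split t _≼_ (x ∷ y ∷ xs)))
        lens = length-split (x ∷ y ∷ xs)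

      sort-sorted : ∀ xs → AllPairs R (result (sort t _≼_ xs))
      sort-sorted xs = mergeSort-sorted (length xs) xs ℕₚ.≤-refl

    module _ (space-≼ : ∀ x y → space (x ≼ y) ≡ 0) {w : ℕ} (size-≡ : ∀ x → size t x ≡ w) where

      private
        -- `W` counts the words of an element together with its list cell. Each pending level of
        -- `merge` keeps two words, the outcome of the comparison and the continuation; `C` is at
        -- least 2 and so covers them for every `w`. The factor 8 in `D` leaves ample room for the
        -- lists alive at one time.
        W C D : ℕ
        W = suc w
        C = suc W
        D = 8 * C

      size-split : ∀ xs → size (list t ⊗ list t) (result (split t _≼_ xs)) ≡ 2 + W * length xs
      size-split xs = ≡.trans (cong₂ _+_ (size-list t size-≡ ls) (size-list t size-≡ rs))
        (≡.trans (eq w (length ls) (length rs))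
          (cong (λ h → 2 + W * h) (≡.trans (sym (length-++ ls)) (↭-length (split-↭ xs)))))
        where
        ls = proj₁ (result (split t _≼_ xs))
        rs = proj₂ (result (split t _≼_ xs))
        eq : ∀ w a b → suc (suc w * a) + suc (suc w * b) ≡ 2 + suc w * (a + b)
        eq = solve-∀

      space-split : ∀ xs → space (split t _≼_ xs) ≤ 2 + W * length xs
      space-split []           = z≤n
      space-split (x ∷ [])     = z≤n
      space-split (x ∷ y ∷ xs) = ⊔≤ (suc (space (split t _≼_ xs))) (size (list t ⊗ list t) (result (split t _≼_ xs)) + 0)
        (lin (suc (w + w)) (space-split xs) (eq₁ (space (split t _≼_ xs)) w (length xs)))
        (lin (2 * W) (ℕₚ.≤-reflexive (size-split xs)) (eq₂ (size (list t ⊗ list t) (result (split t _≼_ xs))) w (length xs)))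
        where
        eq₁ : ∀ s w l → suc s + (2 + suc w * l) + suc (w + w) ≡ 2 + suc w * suc (suc l) + s
        eq₁ = solve-∀
        eq₂ : ∀ s w l → s + 0 + (2 + suc w * l) + 2 * suc w ≡ 2 + suc w * suc (suc l) + s
        eq₂ = solve-∀

      private
        merge-step : ∀ x xs ys l → length xs + length ys ≡ l → space (merge t _≼_ xs ys) ≤ 2 + C * (length xs + length ys) →
                     suc (space (merge t _≼_ xs ys >>= λ zs → return {list t} (x ∷ zs))) ≤ 2 + C * suc l
        merge-step x xs ys l refl h = s≤s (⊔≤ (suc (space (merge t _≼_ xs ys))) (size (list t) (result (merge t _≼_ xs ys)) + 0)
          (lin w h (eq₁ (space (merge t _≼_ xs ys)) w l))
          (slack (2 + w + l) (≡.trans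
            (cong (λ k → k + 0 + (2 + w + l))
              (≡.trans (size-list t size-≡ (result (merge t _≼_ xs ys)))
                (cong (λ k → suc (W * k)) (≡.trans (↭-length (merge-↭ xs ys)) (length-++ xs)))))
            (eq₂ w l))))
          where
          eq₁ : ∀ s w l → suc s + (2 + suc (suc w) * l) + w ≡ suc (suc (suc w) * suc l) + s
          eq₁ = solve-∀
          eq₂ : ∀ w l → suc (suc w * l) + 0 + (2 + w + l) ≡ suc (suc (suc w) * suc l)
          eq₂ = solve-∀

      space-merge : ∀ xs ys → space (merge t _≼_ xs ys) ≤ 2 + C * (length xs + length ys)
      space-merge []       ys       = z≤n
      space-merge (x ∷ xs) []       = z≤n
      space-merge (x ∷ xs) (y ∷ ys) = ℕₚ.⊔-lub
        (subst (λ s → suc s ≤ 2 + C * (length (x ∷ xs) + length (y ∷ ys))) (sym (space-≼ x y)) (s≤s z≤n))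
        (ℕₚ.≤-trans
          (s≤s (space-if (result (x ≼ y))
            (ℕₚ.≤-pred (merge-step x xs (y ∷ ys) _ refl (space-merge xs (y ∷ ys))))
            (ℕₚ.≤-pred (merge-step y (x ∷ xs) ys _ (sym (ℕₚ.+-suc (length xs) (length ys))) (space-merge (x ∷ xs) ys)))))
          ℕₚ.≤-refl)

      space-mergeSort : ∀ fuel xs → space (mergeSort t _≼_ fuel xs) ≤ D * length xs
      space-mergeSort fuel       []           = z≤n
      space-mergeSort fuel       (x ∷ [])     = z≤n
      space-mergeSort zero       (x ∷ y ∷ xs) = z≤n
      space-mergeSort (suc fuel) (x ∷ y ∷ xs) = subst (λ l → space (mergeSort t _≼_ (suc fuel) (x ∷ y ∷ xs)) ≤ D * l) halves
        (mergeSort-space-bound w (length (proj₁ (result (split t _≼_ xs)))) (length (proj₂ (result (split t _≼_ xs))))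
          (s≤s b≤a) (s≤s a≤2b)
          (subst (λ l → space (split t _≼_ (x ∷ y ∷ xs)) ≤ 2 + W * l) (sym halves) (space-split (x ∷ y ∷ xs)))
          (≡.trans (size-split (x ∷ y ∷ xs)) (cong (λ l → 2 + W * l) (sym halves)))
          (space-mergeSort fuel ls)
          (≡.trans (size-list t size-≡ ls′) (cong (λ l → suc (W * l)) length-ls′))
          (space-mergeSort fuel rs)
          (≡.trans (size-list t size-≡ rs′) (cong (λ l → suc (W * l)) length-rs′))
          (subst₂ (λ a b → space (merge t _≼_ ls′ rs′) ≤ 2 + C * (a + b)) length-ls′ length-rs′ (space-merge ls′ rs′)))
        where
        ls = proj₁ (result (split t _≼_ (x ∷ y ∷ xs)))
        rs = proj₂ (result (split t _≼_ (x ∷ y ∷ xs)))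
        ls′ = result (mergeSort t _≼_ fuel ls)
        rs′ = result (mergeSort t _≼_ fuel rs)
        length-ls′ : length ls′ ≡ length ls
        length-ls′ = ↭-length (mergeSort-↭ fuel ls)
        length-rs′ : length rs′ ≡ length rs
        length-rs′ = ↭-length (mergeSort-↭ fuel rs)
        halves : length ls + length rs ≡ length (x ∷ y ∷ xs)
        halves = ≡.trans (sym (length-++ ls)) (↭-length (split-↭ (x ∷ y ∷ xs)))
        lens = length-split xs
        b≤a : length (proj₂ (result (split t _≼_ xs))) ≤ length (proj₁ (result (split t _≼_ xs)))
        b≤a = subst₂ _≤_ (sym (proj₂ lens)) (sym (proj₁ lens)) (ℕₚ.⌊n/2⌋≤⌈n/2⌉ (length xs))
        a≤2b : length (proj₁ (result (split t _≼_ xs))) ≤ length (proj₂ (result (split t _≼_ xs))) + suc (length (proj₂ (result (split t _≼_ xs))) + 0)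
        a≤2b = subst₂ (λ a b → a ≤ b + suc (b + 0)) (sym (proj₁ lens)) (sym (proj₂ lens))
          (ℕₚ.≤-trans (ℕₚ.⌊n/2⌋-mono (ℕₚ.n≤1+n (suc (length xs))))
            (slack ⌊ length xs /2⌋ (eq ⌊ length xs /2⌋)))
          where
          eq : ∀ h → suc h + h ≡ h + suc (h + 0)
          eq = solve-∀

      space-sort : ∀ xs → space (sort t _≼_ xs) ≤ D * length xs
      space-sort xs = space-mergeSort (length xs) xs

-- Counting, ranks under a three-way partition, and medians of five.

module _ {X : Set} where
  open Nat using (_+_; _*_; _≤_; _<_)

  # : {P : Pred X 0ℓ} → Decidable P → List X → ℕ
  # P? xs = length (filter P? xs)

  module _ {P : Pred X 0ℓ} (P? : Decidable P) where

    #-++ : ∀ xs ys → # P? (xs ++ ys) ≡ # P? xs + # P? ys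
    #-++ xs ys = ≡.trans (cong length (filter-++ P? xs ys)) (length-++ (filter P? xs))

    #-↭ : ∀ {xs ys} → xs ↭ ys → # P? xs ≡ # P? ys
    #-↭ p = ↭-length (filter-↭ P? p)

    #-all : ∀ {xs} → All P xs → # P? xs ≡ length xs
    #-all ps = cong length (filter-all P? ps)

    #-none : ∀ {xs} → All (λ x → ¬ P x) xs → # P? xs ≡ 0
    #-none ps = cong length (filter-none P? ps)

    #-positive : ∀ {xs} → 0 < # P? xs → Any P xs
    #-positive {x ∷ xs} 0<# with P? x
    ... | yes px = here px
    ... | no  _  = there (#-positive 0<#)

    #-∷ : ∀ {x} xs {j k} → (P x → j ≤ k) → j * # P? (x ∷ xs) ≤ k + j * # P? xs
    #-∷ {x} xs {j} {k} h with P? x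
    ... | yes px = ℕₚ.≤-trans (ℕₚ.≤-reflexive (ℕₚ.*-suc j (# P? xs))) (ℕₚ.+-monoˡ-≤ _ (h px))
    ... | no  _  = ℕₚ.m≤n+m _ k

module Selection {F : OrderedField} {n m : ℕ} (I : Instance F n m) where
  open OrderedField F using (Carrier; _≤?_; _<_) renaming (_≤_ to _≤ᶠ_)
  open OrderedFieldProperties F
    using (<⇒≤; <⇒≱; ≰⇒>; ≤-<-trans; <-≤-trans)
    renaming (≤-trans to ≤ᶠ-trans; ≤-refl to ≤ᶠ-refl; ≤-reflexive to ≤ᶠ-reflexive; ≤-antisym to ≤ᶠ-antisym)
  open Machine Carrier (Instance.Point I) n m
  open Run I
  open Algorithms Carrier (Instance.Point I) n m
    using (sort; count; nth; mediansOfFive; partition)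
  open Programs I
  open Nat using (_+_; _*_; _≤_)

  ≤ᴿ-true : ∀ {x y} → result (x ≤ᴿ y) ≡ true → x ≤ᶠ y
  ≤ᴿ-true {x} {y} eq with x ≤? y
  ... | yes x≤y = x≤y

  ≤ᴿ-false : ∀ {x y} → result (x ≤ᴿ y) ≡ false → y < x
  ≤ᴿ-false {x} {y} eq with x ≤? y
  ... | no x≰y = ≰⇒> x≰y

  module _ {t : Ty} where

    result-count : ∀ xs → result (count t xs) ≡ length xs
    result-count = go 0
      where
      go : ∀ k (xs : List ⟦ t ⟧) → foldl (λ k _ → k + 1) k xs ≡ k + length xs
      go k []       = sym (ℕₚ.+-identityʳ k)
      go k (x ∷ xs) = ≡.trans (go (k + 1) xs) (ℕₚ.+-assoc k 1 (length xs))

    time-count : ∀ xs → time (count t xs) ≤ suc (2 * length xs)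
    time-count xs = loopTime-const {k = 1} (λ _ _ → s≤s z≤n) 0 xs

    -- A specification independent of how the three lists were computed; it serves both the
    -- selection on scalars and the search on breakpoints, where the key is the ceiling.
    record Partitioned (key : ⟦ t ⟧ → Carrier) (p : Carrier) (xs : List ⟦ t ⟧)
                       (parts : List ⟦ t ⟧ × List ⟦ t ⟧ × List ⟦ t ⟧) : Set where
      field
        permuted : proj₁ parts ++ proj₁ (proj₂ parts) ++ proj₂ (proj₂ parts) ↭ xs
        all-lt   : All (λ x → key x < p) (proj₁ parts)
        all-eq   : All (λ x → key x ≡ p) (proj₁ (proj₂ parts))
        all-gt   : All (λ x → p < key x) (proj₂ (proj₂ parts))

      length-parts : length (proj₁ parts) + (length (proj₁ (proj₂ parts)) + length (proj₂ (proj₂ parts))) ≡ length xs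
      length-parts = ≡.trans
        (sym (≡.trans (length-++ (proj₁ parts)) (cong (length (proj₁ parts) +_) (length-++ (proj₁ (proj₂ parts))))))
        (↭-length permuted)

    partition-step : ∀ {key p x xs lt eq gt} → Partitioned key p xs (lt , eq , gt) →
      Partitioned key p (x ∷ xs)
        (if does (key x ≤? p) then (if does (p ≤? key x) then (lt , x ∷ eq , gt) else (x ∷ lt , eq , gt))
                              else (lt , eq , x ∷ gt))
    partition-step {key} {p} {x} {xs} {lt} {eq} {gt} parted with key x ≤? p | p ≤? key x
    ... | yes x≤p | yes p≤x = record
      { permuted = ↭-trans (↭.shift x lt (eq ++ gt)) (prep x permuted)
      ; all-lt = all-lt ; all-eq = ≤ᶠ-antisym x≤p p≤x ∷ all-eq ; all-gt = all-gt }
      where open Partitioned parted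
    ... | yes x≤p | no p≰x = record
      { permuted = prep x permuted
      ; all-lt = ≰⇒> p≰x ∷ all-lt ; all-eq = all-eq ; all-gt = all-gt }
      where open Partitioned parted
    ... | no x≰p | _ = record
      { permuted = ↭-trans (↭-reflexive (sym (++-assoc lt eq (x ∷ gt))))
                     (↭-trans (↭.shift x (lt ++ eq) gt)
                       (prep x (↭-trans (↭-reflexive (++-assoc lt eq gt)) permuted)))
      ; all-lt = all-lt ; all-eq = all-eq ; all-gt = ≰⇒> x≰p ∷ all-gt }
      where open Partitioned parted

    partitioned : ∀ key p xs → Partitioned key p xs (result (partition t key p xs))
    partitioned key p []       = record { permuted = ↭-refl ; all-lt = [] ; all-eq = [] ; all-gt = [] }
    partitioned key p (x ∷ xs) = partition-step (partitioned key p xs)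

    time-partition : ∀ key p xs → time (partition t key p xs) ≡ 3 * length xs
    time-partition key p []       = refl
    time-partition key p (x ∷ xs) = ≡.trans (cong (3 +_) (≡.trans (ℕₚ.+-identityʳ _) (time-partition key p xs)))
      (sym (ℕₚ.*-suc 3 (length xs)))

  -- p has rank r, counted from 0, in xs.
  Ranked : ℕ → Carrier → List Carrier → Set
  Ranked r p xs = r Nat.< # (_≤? p) xs × length xs ≤ r + # (p ≤?_) xs

  module _ {p xs lt eq gt} (parted : Partitioned {real} Function.id p xs (lt , eq , gt)) where
    open Partitioned parted

    #-parts : ∀ {P : Pred Carrier 0ℓ} (P? : Decidable P) → # P? xs ≡ # P? lt + (# P? eq + # P? gt)
    #-parts P? = ≡.trans (sym (#-↭ P? permuted)) (≡.trans (#-++ P? lt (eq ++ gt)) (cong (# P? lt +_) (#-++ P? eq gt)))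

    #≤-pivot : # (_≤? p) xs ≡ length lt + length eq
    #≤-pivot = ≡.trans (#-parts (_≤? p)) (cong₂ _+_ (#-all (_≤? p) (All.map <⇒≤ all-lt))
      (≡.trans (cong₂ _+_ (#-all (_≤? p) (All.map ≤ᶠ-reflexive all-eq)) (#-none (_≤? p) (All.map <⇒≱ all-gt)))
        (ℕₚ.+-identityʳ _)))

    #≥-pivot : # (p ≤?_) xs ≡ length eq + length gt
    #≥-pivot = ≡.trans (#-parts (p ≤?_)) (cong₂ _+_ (#-none (p ≤?_) (All.map <⇒≱ all-lt))
      (cong₂ _+_ (#-all (p ≤?_) (All.map (λ eq → ≤ᶠ-reflexive (sym eq)) all-eq)) (#-all (p ≤?_) (All.map <⇒≤ all-gt))))

    -- Since `r` is smaller than the length of `lt`, the second half of the rank leaves some element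
    -- of `lt` at or above `q`. Hence `q < p`, and all of `eq` and `gt` counts among the elements at
    -- least `q`.
    ranked-lt : ∀ {r q} → r Nat.< length lt → Ranked r q lt → Ranked r q xs
    ranked-lt {r} {q} r<lt (r<# , lt≤#) =
        ℕₚ.<-≤-trans r<# (ℕₚ.≤-trans (ℕₚ.m≤m+n _ _) (ℕₚ.≤-reflexive (sym (#-parts (_≤? q)))))
      , subst₂ (λ k l → k ≤ r + l) length-parts
          (sym (≡.trans (#-parts (q ≤?_)) (cong (# (q ≤?_) lt +_) (cong₂ _+_ (#-all (q ≤?_) (All.map (λ { refl → <⇒≤ q<p }) all-eq))
                 (#-all (q ≤?_) (All.map (λ p<x → ≤ᶠ-trans (<⇒≤ q<p) (<⇒≤ p<x)) all-gt))))))
          (ℕₚ.≤-trans (ℕₚ.+-monoˡ-≤ _ lt≤#) (ℕₚ.≤-reflexive (ℕₚ.+-assoc r _ _)))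
      where
      0<# : 0 Nat.< # (q ≤?_) lt
      0<# = ℕₚ.+-cancelˡ-< r 0 _ (ℕₚ.<-≤-trans (ℕₚ.≤-<-trans (ℕₚ.≤-reflexive (ℕₚ.+-identityʳ r)) r<lt) lt≤#)
      q<p : q < p
      q<p = All.lookupWith (λ x<p q≤x → ≤-<-trans q≤x x<p) all-lt (#-positive (q ≤?_) 0<#)

    ranked-gt : ∀ {r q} → Ranked r q gt → Ranked (length lt + length eq + r) q xs
    ranked-gt {r} {q} (r<# , gt≤#) =
        subst (length lt + length eq + r Nat.<_)
          (sym (≡.trans (#-parts (_≤? q)) (≡.trans (cong₂ _+_ (#-all (_≤? q) (All.map (λ x<p → ≤ᶠ-trans (<⇒≤ x<p) (<⇒≤ p<q)) all-lt))
            (cong (_+ # (_≤? q) gt) (#-all (_≤? q) (All.map (λ { refl → <⇒≤ p<q }) all-eq)))) (sym (ℕₚ.+-assoc (length lt) _ _)))))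
          (ℕₚ.+-monoʳ-< (length lt + length eq) r<#)
      , subst₂ _≤_ (≡.trans (ℕₚ.+-assoc (length lt) _ _) length-parts) (sym (ℕₚ.+-assoc (length lt + length eq) r _))
          (ℕₚ.+-monoʳ-≤ (length lt + length eq) (ℕₚ.≤-trans gt≤#
            (ℕₚ.+-monoʳ-≤ r (ℕₚ.≤-trans (ℕₚ.m≤n+m _ (# (q ≤?_) lt + # (q ≤?_) eq))
              (ℕₚ.≤-reflexive (sym (≡.trans (#-parts (q ≤?_)) (sym (ℕₚ.+-assoc (# (q ≤?_) lt) _ _)))))))))
      where
      p<q : p < q
      -- The mirror image: here the first half of the rank supplies an element of `gt` that is at
      -- most `q`.
      p<q = All.lookupWith (λ p<x x≤q → <-≤-trans p<x x≤q) all-gt (#-positive (_≤? q) (ℕₚ.≤-<-trans z≤n r<#))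

    ranked-pivot : ∀ {r} → length lt ≤ r → r Nat.< length lt + length eq → Ranked r p xs
    ranked-pivot {r} lt≤r r<le =
        subst (r Nat.<_) (sym #≤-pivot) r<le
      , subst₂ (λ k l → k ≤ r + l) length-parts (sym #≥-pivot) (ℕₚ.+-monoˡ-≤ _ lt≤r)

  ranked-↭ : ∀ {r p xs ys} → xs ↭ ys → Ranked r p xs → Ranked r p ys
  ranked-↭ {r} {p} xs↭ys (r<# , xs≤#) =
    subst (r Nat.<_) (#-↭ (_≤? p) xs↭ys) r<# , subst₂ (λ k l → k ≤ r + l) (↭-length xs↭ys) (#-↭ (p ≤?_) xs↭ys) xs≤#

  #-accept : ∀ {X : Set} {P : Pred X 0ℓ} (P? : Decidable P) {x} xs → P x → # P? (x ∷ xs) ≡ suc (# P? xs)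
  #-accept P? xs px = #-++ P? (_ ∷ []) xs ⟨≡⟩ cong (_+ # P? xs) (#-all P? (px ∷ []))
    where _⟨≡⟩_ = ≡.trans

  -- Passing from the tail to the whole list raises the rank by one because the head also counts as
  -- at most `q`: the rank in the tail guarantees some element there that is at most `q`, and the
  -- head is below that element.
  nth-ranked : ∀ r {xs} → AllPairs _≤ᶠ_ xs → r Nat.< length xs → Ranked r (result (nth r xs)) xs
  nth-ranked zero    {x ∷ xs} (x≤ ∷ xs↗) _ =
      subst (0 Nat.<_) (sym (#-accept (_≤? x) xs ≤ᶠ-refl)) (s≤s z≤n)
    , ℕₚ.≤-reflexive (sym (#-all (x ≤?_) (≤ᶠ-refl ∷ x≤)))
  nth-ranked (suc r) {x ∷ xs} (x≤ ∷ xs↗) (s≤s r<) =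
      subst (suc r Nat.<_) (sym (#-accept (_≤? q) xs x≤q)) (s≤s (proj₁ ranked))
    , s≤s (ℕₚ.≤-trans (proj₂ ranked) (ℕₚ.+-monoʳ-≤ r
        (ℕₚ.≤-trans (ℕₚ.m≤n+m _ _) (ℕₚ.≤-reflexive (sym (#-++ (q ≤?_) (x ∷ []) xs))))))
    where
    q = result (nth r xs)
    ranked = nth-ranked r xs↗ r<
    x≤q : x ≤ᶠ q
    x≤q = All.lookupWith (λ x≤y y≤q → ≤ᶠ-trans x≤y y≤q) x≤ (#-positive (_≤? q) (ℕₚ.≤-<-trans z≤n (proj₁ ranked)))

  time-nth : ∀ r xs → time (nth r xs) ≤ suc r
  time-nth r       []       = s≤s z≤n
  time-nth zero    (x ∷ xs) = z≤n
  time-nth (suc r) (x ∷ xs) = s≤s (time-nth r xs)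

  sortᴿ-sorted : ∀ xs → AllPairs _≤ᶠ_ (result (sort real _≤ᴿ_ xs))
  sortᴿ-sorted = MergeSort.sort-sorted real _≤ᴿ_ ≤ᶠ-trans ≤ᴿ-true (λ eq → <⇒≤ (≤ᴿ-false eq))

  sortᴿ-↭ : ∀ xs → result (sort real _≤ᴿ_ xs) ↭ xs
  sortᴿ-↭ = MergeSort.sort-↭ real _≤ᴿ_

  time-sortᴿ : ∀ xs → time (sort real _≤ᴿ_ xs) ≤ 4 * (length xs * ⌈log₂ length xs ⌉)
  time-sortᴿ = MergeSort.time-sort real _≤ᴿ_ (λ _ _ → refl)

  middle-of-five : ∀ p ys → length ys ≡ 5 → AllPairs _≤ᶠ_ ys →
    (p ≤ᶠ result (nth 2 ys) → 3 ≤ # (p ≤?_) ys) × (result (nth 2 ys) ≤ᶠ p → 3 ≤ # (_≤? p) ys)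
  middle-of-five p (a ∷ b ∷ c ∷ d ∷ e ∷ []) refl
    ((_ ∷ a≤c ∷ _) ∷ (b≤c ∷ _) ∷ (c≤d ∷ c≤e ∷ _) ∷ _) =
      (λ p≤c → ℕₚ.≤-trans
        (ℕₚ.≤-trans (ℕₚ.≤-reflexive (sym (#-all (p ≤?_) (p≤c ∷ ≤ᶠ-trans p≤c c≤d ∷ ≤ᶠ-trans p≤c c≤e ∷ []))))
          (ℕₚ.m≤n+m _ (# (p ≤?_) (a ∷ b ∷ []))))
        (ℕₚ.≤-reflexive (sym (#-++ (p ≤?_) (a ∷ b ∷ []) (c ∷ d ∷ e ∷ [])))))
    , (λ c≤p → ℕₚ.≤-trans
        (ℕₚ.≤-trans (ℕₚ.≤-reflexive (sym (#-all (_≤? p) (≤ᶠ-trans a≤c c≤p ∷ ≤ᶠ-trans b≤c c≤p ∷ c≤p ∷ []))))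
          (ℕₚ.m≤m+n _ (# (_≤? p) (d ∷ e ∷ []))))
        (ℕₚ.≤-reflexive (sym (#-++ (_≤? p) (a ∷ b ∷ c ∷ []) (d ∷ e ∷ [])))))

  private
    medians : List Carrier → List Carrier
    medians xs = result (mediansOfFive xs)

    block-median : Carrier → Carrier → Carrier → Carrier → Carrier → Carrier
    block-median a b c d e = result (nth 2 (result (sort real _≤ᴿ_ (a ∷ b ∷ c ∷ d ∷ e ∷ []))))

    middle : ∀ p a b c d e → let block = a ∷ b ∷ c ∷ d ∷ e ∷ [] in
      (p ≤ᶠ block-median a b c d e → 3 ≤ # (p ≤?_) block) × (block-median a b c d e ≤ᶠ p → 3 ≤ # (_≤? p) block)
    middle p a b c d e =
        (λ h → subst (3 ≤_) (#-↭ (p ≤?_) (sortᴿ-↭ block)) (proj₁ mid h))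
      , (λ h → subst (3 ≤_) (#-↭ (_≤? p) (sortᴿ-↭ block)) (proj₂ mid h))
      where
      block = a ∷ b ∷ c ∷ d ∷ e ∷ []
      mid = middle-of-five p (result (sort real _≤ᴿ_ block)) (↭-length (sortᴿ-↭ block)) (sortᴿ-sorted block)

  medians-≥ : ∀ p xs → 3 * # (p ≤?_) (medians xs) ≤ # (p ≤?_) xs
  medians-≥ p (a ∷ b ∷ c ∷ d ∷ e ∷ xs) = ℕₚ.≤-trans
    (#-∷ (p ≤?_) (medians xs) (proj₁ (middle p a b c d e)))
    (ℕₚ.≤-trans (ℕₚ.+-monoʳ-≤ _ (medians-≥ p xs)) (ℕₚ.≤-reflexive (sym (#-++ (p ≤?_) (a ∷ b ∷ c ∷ d ∷ e ∷ []) xs))))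
  medians-≥ p []                      = z≤n
  medians-≥ p (_ ∷ [])                = z≤n
  medians-≥ p (_ ∷ _ ∷ [])            = z≤n
  medians-≥ p (_ ∷ _ ∷ _ ∷ [])        = z≤n
  medians-≥ p (_ ∷ _ ∷ _ ∷ _ ∷ [])    = z≤n

  medians-≤ : ∀ p xs → 3 * # (_≤? p) (medians xs) ≤ # (_≤? p) xs
  medians-≤ p (a ∷ b ∷ c ∷ d ∷ e ∷ xs) = ℕₚ.≤-trans
    (#-∷ (_≤? p) (medians xs) (proj₂ (middle p a b c d e)))
    (ℕₚ.≤-trans (ℕₚ.+-monoʳ-≤ _ (medians-≤ p xs)) (ℕₚ.≤-reflexive (sym (#-++ (_≤? p) (a ∷ b ∷ c ∷ d ∷ e ∷ []) xs))))
  medians-≤ p []                      = z≤n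
  medians-≤ p (_ ∷ [])                = z≤n
  medians-≤ p (_ ∷ _ ∷ [])            = z≤n
  medians-≤ p (_ ∷ _ ∷ _ ∷ [])        = z≤n
  medians-≤ p (_ ∷ _ ∷ _ ∷ _ ∷ [])    = z≤n

  length-medians : ∀ xs → 5 * length (medians xs) ≤ length xs × length xs ≤ 4 + 5 * length (medians xs)
  length-medians (a ∷ b ∷ c ∷ d ∷ e ∷ xs) with length-medians xs
  ... | lo , hi = ℕₚ.≤-trans (ℕₚ.≤-reflexive (ℕₚ.*-suc 5 _)) (ℕₚ.+-monoʳ-≤ 5 lo)
                , ℕₚ.≤-trans (ℕₚ.+-monoʳ-≤ 5 hi) (ℕₚ.≤-reflexive (cong (4 +_) (sym (ℕₚ.*-suc 5 (length (medians xs))))))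
  length-medians []                   = z≤n , z≤n
  length-medians (_ ∷ [])             = z≤n , s≤s z≤n
  length-medians (_ ∷ _ ∷ [])         = z≤n , s≤s (s≤s z≤n)
  length-medians (_ ∷ _ ∷ _ ∷ [])     = z≤n , s≤s (s≤s (s≤s z≤n))
  length-medians (_ ∷ _ ∷ _ ∷ _ ∷ []) = z≤n , s≤s (s≤s (s≤s (s≤s z≤n)))

  -- Each block costs 1 for the step, 4 times 5 times 3 = 60 for the sort, since the ceiling
  -- logarithm of 5 is 3, and 3 for reading position 2.
  time-mediansOfFive : ∀ xs → time (mediansOfFive xs) ≤ 64 * length (medians xs)
  time-mediansOfFive (a ∷ b ∷ c ∷ d ∷ e ∷ xs) = ℕₚ.≤-trans
    (s≤s (time-sortᴿ block +≤ (time-nth 2 (result (sort real _≤ᴿ_ block)) +≤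
      (ℕₚ.≤-trans (ℕₚ.≤-reflexive (ℕₚ.+-identityʳ _)) (time-mediansOfFive xs)))))
    (ℕₚ.≤-reflexive (sym (ℕₚ.*-suc 64 (length (medians xs)))))
    where block = a ∷ b ∷ c ∷ d ∷ e ∷ []
  time-mediansOfFive []                   = z≤n
  time-mediansOfFive (_ ∷ [])             = z≤n
  time-mediansOfFive (_ ∷ _ ∷ [])         = z≤n
  time-mediansOfFive (_ ∷ _ ∷ _ ∷ [])     = z≤n
  time-mediansOfFive (_ ∷ _ ∷ _ ∷ _ ∷ []) = z≤n

-- Linear-time selection.

module _ where
  open Nat using (_+_; _*_; _≤_)

  n≤1+2⌊n/2⌋ : ∀ n → n ≤ 1 + 2 * ⌊ n /2⌋
  n≤1+2⌊n/2⌋ zero          = z≤n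
  n≤1+2⌊n/2⌋ (suc zero)    = s≤s z≤n
  n≤1+2⌊n/2⌋ (suc (suc n)) = s≤s (ℕₚ.≤-trans (s≤s (n≤1+2⌊n/2⌋ n)) (ℕₚ.≤-reflexive (eq ⌊ n /2⌋)))
    where
    eq : ∀ h → suc (1 + 2 * h) ≡ 2 * suc h
    eq = solve-∀

  2⌊n/2⌋≤n : ∀ n → 2 * ⌊ n /2⌋ ≤ n
  2⌊n/2⌋≤n zero          = z≤n
  2⌊n/2⌋≤n (suc zero)    = z≤n
  2⌊n/2⌋≤n (suc (suc n)) = ℕₚ.≤-trans (ℕₚ.≤-reflexive (ℕₚ.*-suc 2 ⌊ n /2⌋)) (s≤s (s≤s (2⌊n/2⌋≤n n)))

  -- The recurrence for selection from n elements with G medians, where at most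
  -- R of the elements survive the partition.
  select-time-bound : ∀ {n G R l e τ₁ τ₂ τ₃ τ₄ τ₅ τ₆ τ₇} → 1 ≤ G → n ≤ 4 + 5 * G → 2 * R + 3 * G ≤ 2 * n → l + e ≤ n →
    τ₁ ≤ 64 * G → τ₂ ≤ suc (2 * G) → τ₃ ≤ 400 * G + 40 → τ₄ ≡ 3 * n →
    τ₅ ≤ suc (2 * l) → τ₆ ≤ suc (2 * e) → τ₇ ≤ 400 * R + 41 →
    suc (τ₁ + (τ₂ + suc (τ₃ + (τ₄ + (τ₅ + (τ₆ + suc (suc (suc τ₇)))))))) ≤ 400 * n + 40
  select-time-bound {n} {G} {R} {l} {e} {τ₁} {τ₂} {τ₃} {_} {τ₅} {τ₆} {τ₇} h₁ h₂ h₃ h₄ t₁ t₂ t₃ refl t₅ t₆ t₇ =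
    -- Of the `200 * G` gained from `h₃`, 66 parts go to finding and counting the medians. The
    -- `5 * n` for the partition and the two counts becomes `25 * G + 20` by `h₂`. The remaining
    -- `109 * G` pays for the additive constants, which also sum to 109.
    lin 40 (109 *≤ h₁ +≤ 5 *≤ h₂ +≤ 200 *≤ h₃ +≤ 2 *≤ h₄ +≤ t₁ +≤ t₂ +≤ t₃ +≤ t₅ +≤ t₆ +≤ t₇) (eq n G R l e τ₁ τ₂ τ₃ τ₅ τ₆ τ₇)
    where
    eq : ∀ n G R l e τ₁ τ₂ τ₃ τ₅ τ₆ τ₇ →
      suc (τ₁ + (τ₂ + suc (τ₃ + (3 * n + (τ₅ + (τ₆ + suc (suc (suc τ₇))))))))
        + (109 * G + 5 * (4 + 5 * G) + 200 * (2 * n) + 2 * n + 64 * G + suc (2 * G) + (400 * G + 40) + suc (2 * l) + suc (2 * e) + (400 * R + 41)) + 40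
      ≡ 400 * n + 40 + (109 * 1 + 5 * n + 200 * (2 * R + 3 * G) + 2 * (l + e) + τ₁ + τ₂ + τ₃ + τ₅ + τ₆ + τ₇)
    eq = solve-∀

  -- `does (i <? j)` computes to `i <ᵇ j`, so abstracting that boolean rewrites the goal. The
  -- explicit motive lets a whole conditional program depend on the comparison.
  <?-elim : ∀ (P : Bool → Set) i j → (i Nat.< j → P true) → (j ≤ i → P false) → P (does (i Nat.<? j))
  <?-elim P i j i<j⇒ j≤i⇒ with i Nat.<ᵇ j in eq
  ... | true  = i<j⇒ (ℕₚ.<ᵇ⇒< i j (subst T (sym eq) tt))
  ... | false = j≤i⇒ (ℕₚ.≮⇒≥ λ i<j → subst T eq (ℕₚ.<⇒<ᵇ i<j))

module Select {F : OrderedField} {n m : ℕ} (I : Instance F n m) where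
  open OrderedField F using (Carrier; _≤?_)
  open Machine Carrier (Instance.Point I) n m
  open Run I
  open Algorithms Carrier (Instance.Point I) n m
    using (sort; count; mediansOfFive; partition; select; selectFrom; median)
  open Programs I
  open Selection I
  open Nat using (_+_; _*_; _≤_)

  SelectSpec : ℕ → List Carrier → Prog real → ℕ → Set
  SelectSpec r xs p k = Ranked r (result p) xs × time p ≤ k

  select-spec : ∀ fuel r xs → length xs ≤ fuel → r Nat.< length xs →
                SelectSpec r xs (select fuel r xs) (400 * length xs + 40)
  -- The medians enter as a variable with an equation so that the case split of `selectFrom` can be
  -- followed. The time includes computing them and the step of `select`, which makes `select-spec`
  -- an immediate consequence.
  selectFrom-spec : ∀ fuel r xs ms → result (mediansOfFive xs) ≡ ms → length xs ≤ suc fuel → r Nat.< length xs →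
                    Ranked r (result (selectFrom fuel r xs ms)) xs
                    × suc (time (mediansOfFive xs) + time (selectFrom fuel r xs ms)) ≤ 400 * length xs + 40

  select-spec zero       r xs xs≤ r< with () ← ℕₚ.<-≤-trans r< xs≤
  select-spec (suc fuel) r xs xs≤ r< = selectFrom-spec fuel r xs (result (mediansOfFive xs)) refl xs≤ r<

  selectFrom-spec fuel r xs [] eq xs≤ r< =
      ranked-↭ (sortᴿ-↭ xs) (nth-ranked r (sortᴿ-sorted xs) (subst (r Nat.<_) (sym (↭-length (sortᴿ-↭ xs))) r<))
    , ℕₚ.≤-trans
        (s≤s (subst (λ ms → time (mediansOfFive xs) ≤ 64 * length ms) eq (time-mediansOfFive xs)
          +≤ (ℕₚ.≤-trans (time-sortᴿ xs) (4 *≤ ℕₚ.*-mono-≤ xs≤4 (⌈log₂⌉-mono-≤ xs≤4))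
          +≤ ℕₚ.≤-trans (time-nth r (result (sort real _≤ᴿ_ xs))) (ℕₚ.≤-trans r< xs≤4))))
        -- At most four elements remain: 1 for the step, 4 times 4 times 2 = 32 for sorting and 4
        -- for `nth`. The additive 40 in the bound exists for this case.
        (ℕₚ.≤-trans (ℕₚ.m≤m+n 37 3) (ℕₚ.m≤n+m 40 (400 * length xs)))
    where
    xs≤4 : length xs ≤ 4
    xs≤4 = subst (λ ms → length xs ≤ 4 + 5 * length ms) eq (proj₂ (length-medians xs))
  selectFrom-spec fuel r xs (μ ∷ μs) eq xs≤ r< =
      proj₁ branches
    , select-time-bound {length xs} {G} {R} {length lt} {length es}
        (s≤s z≤n) xs≤4+5G (proj₂ (proj₂ (proj₂ branches)))
        (ℕₚ.≤-trans (ℕₚ.+-monoʳ-≤ (length lt) (ℕₚ.m≤m+n (length es) (length gt))) (ℕₚ.≤-reflexive length-parts))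
        (subst (λ ms → time (mediansOfFive xs) ≤ 64 * length ms) eq (time-mediansOfFive xs))
        (time-count ms)
        (proj₂ p-spec)
        (time-partition Function.id p xs)
        (time-count lt)
        (time-count es)
        (proj₁ (proj₂ (proj₂ branches)))
    where
    ms = μ ∷ μs
    G = length ms
    k = result (count real ms)
    k≡G : k ≡ G
    k≡G = result-count ms
    5G≤xs : 5 * G ≤ length xs
    5G≤xs = subst (λ ms → 5 * length ms ≤ length xs) eq (proj₁ (length-medians xs))
    xs≤4+5G : length xs ≤ 4 + 5 * G
    xs≤4+5G = subst (λ ms → length xs ≤ 4 + 5 * length ms) eq (proj₂ (length-medians xs))
    h<G : ⌊ k /2⌋ Nat.< G
    h<G = subst (λ k → ⌊ k /2⌋ Nat.< G) (sym k≡G) (ℕₚ.⌊n/2⌋<n (length μs))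
    G≤fuel : G ≤ fuel
    -- A positive `G` satisfies `suc G ≤ 5 * G`, so the list of medians is strictly shorter than
    -- `xs` and one unit of fuel less is enough.
    G≤fuel = ℕₚ.≤-pred (ℕₚ.≤-trans (slack (3 + 4 * length μs) (ar (length μs))) (ℕₚ.≤-trans 5G≤xs xs≤))
      where
      ar : ∀ g → suc (suc g) + (3 + 4 * g) ≡ 5 * suc g
      ar = solve-∀
    p = result (select fuel ⌊ k /2⌋ ms)
    p-spec : SelectSpec ⌊ k /2⌋ ms (select fuel ⌊ k /2⌋ ms) (400 * G + 40)
    p-spec = select-spec fuel ⌊ k /2⌋ ms G≤fuel h<G
    lt = proj₁ (result (partition real Function.id p xs))
    es = proj₁ (proj₂ (result (partition real Function.id p xs)))
    gt = proj₂ (proj₂ (result (partition real Function.id p xs)))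
    parted : Partitioned {real} Function.id p xs (lt , es , gt)
    parted = partitioned Function.id p xs
    open Partitioned parted using (length-parts)
    nlt = result (count real lt)
    nle = nlt + result (count real es)
    nlt≡ : nlt ≡ length lt
    nlt≡ = result-count lt
    nle≡ : nle ≡ length lt + length es
    nle≡ = cong₂ _+_ nlt≡ (result-count es)

    2h≤G : 2 * ⌊ k /2⌋ ≤ G
    2h≤G = subst (λ g → 2 * ⌊ k /2⌋ ≤ g) k≡G (2⌊n/2⌋≤n k)
    G≤2h+1 : G ≤ 1 + 2 * ⌊ k /2⌋
    G≤2h+1 = subst (λ g → g ≤ 1 + 2 * ⌊ k /2⌋) k≡G (n≤1+2⌊n/2⌋ k)

    -- Half of the medians are at least the pivot, each of them with three
    -- elements of its block.
    lt-small : 2 * length lt + 3 * G ≤ 2 * length xs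
    lt-small = arith (length lt) (length es) (length gt) ⌊ k /2⌋ (# (p ≤?_) ms) G (length xs)
      length-parts (subst (λ ms → 3 * # (p ≤?_) ms ≤ length es + length gt) eq
        (ℕₚ.≤-trans (medians-≥ p xs) (ℕₚ.≤-reflexive (#≥-pivot parted))))
      (proj₂ (proj₁ p-spec)) 2h≤G
      where
      arith : ∀ l e g h q G N → l + (e + g) ≡ N → 3 * q ≤ e + g → G ≤ h + q → 2 * h ≤ G → 2 * l + 3 * G ≤ 2 * N
      arith l e g h q G N refl h₁ h₂ h₃ = lin 0 (2 *≤ h₁ +≤ 6 *≤ h₂ +≤ 3 *≤ h₃) (ar l e g h q G)
        where
        ar : ∀ l e g h q G → 2 * l + 3 * G + (2 * (e + g) + 6 * (h + q) + 3 * G) + 0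
                             ≡ 2 * (l + (e + g)) + (2 * (3 * q) + 6 * G + 3 * (2 * h))
        ar = solve-∀
    -- Ranks start from 0, so `suc h` medians are at most the pivot, and three times as many
    -- elements stay out of `gt`. The extra one makes up for an odd `G`.
    gt-small : 2 * length gt + 3 * G ≤ 2 * length xs
    gt-small = arith (length lt) (length es) (length gt) ⌊ k /2⌋ (# (_≤? p) ms) G (length xs)
      length-parts (subst (λ ms → 3 * # (_≤? p) ms ≤ length lt + length es) eq
        (ℕₚ.≤-trans (medians-≤ p xs) (ℕₚ.≤-reflexive (#≤-pivot parted))))
      (proj₁ (proj₁ p-spec)) G≤2h+1
      where
      arith : ∀ l e g h q G N → l + (e + g) ≡ N → 3 * q ≤ l + e → suc h ≤ q → G ≤ 1 + 2 * h → 2 * g + 3 * G ≤ 2 * N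
      arith l e g h q G N refl h₁ h₂ h₃ = lin 3 (2 *≤ h₁ +≤ 6 *≤ h₂ +≤ 3 *≤ h₃) (ar l e g h q G)
        where
        ar : ∀ l e g h q G → 2 * g + 3 * G + (2 * (l + e) + 6 * q + 3 * (1 + 2 * h)) + 3
                             ≡ 2 * (l + (e + g)) + (2 * (3 * q) + 6 * suc h + 3 * G)
        ar = solve-∀

    shrinks : ∀ l → 2 * l + 3 * G ≤ 2 * length xs → l ≤ fuel
    shrinks l h = ℕₚ.≤-pred (ℕₚ.≤-trans (ℕₚ.*-cancelˡ-< 2 l (length xs) (lin (length μs + 2 * G) h (ar l (length μs) (length xs)))) xs≤)
      where
      ar : ∀ l g N → suc (2 * l) + 2 * N + (g + 2 * suc g) ≡ 2 * N + (2 * l + 3 * suc g)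
      ar = solve-∀

    -- `R` is the length of the list recursed on, or 0 when the pivot is returned. The bound is 41
    -- instead of 40 because the upper branch also computes `r ∸ nle`.
    Good : Prog real → Set
    Good b = Ranked r (result b) xs × ∃ λ R → time b ≤ 400 * R + 41 × 2 * R + 3 * G ≤ 2 * length xs

    below = select fuel r lt
    above = (r ∸ᴺ nle) >>= λ r′ → select fuel r′ gt

    good-below : r Nat.< nlt → Good below
    good-below r<nlt =
        ranked-lt parted r<lt (proj₁ rec)
      , length lt , ℕₚ.≤-trans (proj₂ rec) (ℕₚ.+-monoʳ-≤ (400 * length lt) (ℕₚ.n≤1+n 40)) , lt-small
      where
      r<lt = subst (r Nat.<_) nlt≡ r<nlt
      rec = select-spec fuel r lt (shrinks (length lt) lt-small) r<lt

    good-pivot : nlt ≤ r → r Nat.< nle → Good (return p)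
    good-pivot nlt≤r r<nle =
        ranked-pivot parted (subst (_≤ r) nlt≡ nlt≤r) (subst (r Nat.<_) nle≡ r<nle)
      , 0 , z≤n , ℕₚ.≤-trans (ℕₚ.*-monoˡ-≤ G (ℕₚ.m≤m+n 3 2)) (ℕₚ.≤-trans 5G≤xs (ℕₚ.m≤m+n (length xs) _))

    good-above : nle ≤ r → Good above
    good-above nle≤r =
        subst (λ r → Ranked r q xs) (≡.trans (cong (_+ r′) (sym nle≡)) (ℕₚ.m+[n∸m]≡n nle≤r))
          (ranked-gt parted (proj₁ rec))
      , length gt , ℕₚ.≤-trans (s≤s (proj₂ rec)) (ℕₚ.≤-reflexive (sym (ℕₚ.+-suc (400 * length gt) 40))) , gt-small
      where
      r′ = r Nat.∸ nle
      q = result (select fuel r′ gt)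
      r′<gt : r′ Nat.< length gt
      r′<gt = ℕₚ.+-cancelˡ-< nle r′ (length gt) (subst₂ Nat._<_ (sym (ℕₚ.m+[n∸m]≡n nle≤r))
        (≡.trans (sym length-parts) (≡.trans (sym (ℕₚ.+-assoc (length lt) _ _)) (cong (_+ length gt) (sym nle≡)))) r<)
      rec = select-spec fuel r′ gt (shrinks (length gt) gt-small) r′<gt

    branches : Good (if does (r Nat.<? nlt) then below else (if does (r Nat.<? nle) then return p else above))
    branches = <?-elim (λ b → Good (if b then below else (if does (r Nat.<? nle) then return p else above))) r nlt
      good-below
      (λ nlt≤r → <?-elim (λ b → Good (if b then return p else above)) r nle (good-pivot nlt≤r) good-above)
    R = proj₁ (proj₂ branches)

  median-spec : ∀ xs → 1 ≤ length xs → SelectSpec ⌊ length xs /2⌋ xs (median xs) (402 * length xs + 42)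
  median-spec xs@(x ∷ xs′) _ =
      subst (λ h → Ranked h (result (median xs)) xs) (cong ⌊_/2⌋ k≡) (proj₁ spec)
    , ℕₚ.≤-trans (time-count xs +≤ s≤s (proj₂ spec)) (ℕₚ.≤-reflexive (ar (length xs)))
    where
    k≡ : result (count real xs) ≡ length xs
    k≡ = result-count xs
    ar : ∀ l → suc (2 * l) + suc (400 * l + 40) ≡ 402 * l + 42
    ar = solve-∀
    spec = select-spec (length xs) ⌊ result (count real xs) /2⌋ xs ℕₚ.≤-refl
      (subst (λ k → ⌊ k /2⌋ Nat.< length xs) (sym k≡) (ℕₚ.⌊n/2⌋<n (length xs′)))

  module _ {t : Ty} {key : ⟦ t ⟧ → Carrier} {p xs lt es gt} (parted : Partitioned {t} key p xs (lt , es , gt)) where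
    open Partitioned parted

    -- The median is selected among the keys alone. This carries the counts of keys back to the
    -- breakpoints they belong to.
    partitioned-map : Partitioned {real} Function.id p (map key xs) (map key lt , map key es , map key gt)
    partitioned-map = record
      { permuted = ↭-trans (↭-reflexive (sym (≡.trans (map-++ key lt (es ++ gt)) (cong (map key lt ++_) (map-++ key es gt)))))
                     (map⁺ key permuted)
      ; all-lt = All.map⁺ all-lt ; all-eq = All.map⁺ all-eq ; all-gt = All.map⁺ all-gt }

    -- With `h` the rank, at most `h` elements lie strictly below the pivot, and all but `suc h` at
    -- most strictly above it; both are at most half. Elements equal to the pivot fall on neither
    -- side.
    median-balances : Ranked ⌊ length xs /2⌋ p (map key xs) → 2 * length lt ≤ length xs × 2 * length gt ≤ length xs
    median-balances (h<# , k≤#) =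
        arith₁ (length lt) (length es) (length gt) ⌊ length xs /2⌋ length-parts
          (subst₂ (λ k l → k ≤ ⌊ length xs /2⌋ + l) (length-map key xs)
            (≡.trans (#≥-pivot partitioned-map) (cong₂ _+_ (length-map key es) (length-map key gt))) k≤#)
          (2⌊n/2⌋≤n (length xs))
      , arith₂ (length lt) (length es) (length gt) ⌊ length xs /2⌋ length-parts
          (subst (⌊ length xs /2⌋ Nat.<_)
            (≡.trans (#≤-pivot partitioned-map) (cong₂ _+_ (length-map key lt) (length-map key es))) h<#)
          (n≤1+2⌊n/2⌋ (length xs))
      where
      arith₁ : ∀ l e g h {k} → l + (e + g) ≡ k → k ≤ h + (e + g) → 2 * h ≤ k → 2 * l ≤ k
      arith₁ l e g h refl k≤ h≤ = lin 0 (2 *≤ k≤ +≤ h≤) (eq l e g h)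
        where
        eq : ∀ l e g h → 2 * l + (2 * (h + (e + g)) + (l + (e + g))) + 0 ≡ l + (e + g) + (2 * (l + (e + g)) + 2 * h)
        eq = solve-∀
      arith₂ : ∀ l e g h {k} → l + (e + g) ≡ k → suc h ≤ l + e → k ≤ 1 + 2 * h → 2 * g ≤ k
      arith₂ l e g h refl h< k≤ = lin 1 (2 *≤ h< +≤ k≤) (eq l e g h)
        where
        eq : ∀ l e g h → 2 * g + (2 * (l + e) + (1 + 2 * h)) + 1 ≡ l + (e + g) + (2 * suc h + (l + (e + g)))
        eq = solve-∀

-- Correctness of the scan and of the weighted-median search.

module LocatorCorrectness {F : OrderedField} {n m : ℕ} (I : Instance F n m) where
  open OrderedField F
  open OrderedFieldProperties F
  open WaterLevel
  open SemiringSolver commutativeSemiring using (solve; _:=_; _:+_; _:*_; con)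
  open Machine Carrier (Instance.Point I) n m
  open Run I
  open Algorithms Carrier (Instance.Point I) n m
    using (sort; partition; median; Breakpoint; totalCost; totalMass; rounds; lowerCeiling; bySorting; bySelection; ceilings; search)
  open Programs I
  open Selection I
  open Select I

  foldl-+ : ∀ {X : Set} (f : X → Carrier) a xs → foldl (λ s x → s + f x) a xs ≡ a + ∑ xs f
  foldl-+ f a []       = sym (+-identityʳ a)
  foldl-+ f a (x ∷ xs) = ≡.trans (foldl-+ f (a + f x) xs) (+-assoc a (f x) (∑ xs f))

  result-totalCost : ∀ bs → result (totalCost bs) ≡ costᴮ bs
  result-totalCost bs = ≡.trans (foldl-+ proj₂ 0# bs) (+-identityˡ _)

  result-totalMass : ∀ bs → result (totalMass bs) ≡ massᴮ bs
  result-totalMass bs = ≡.trans (foldl-+ (λ (u , w) → w * u) 0# bs) (+-identityˡ _)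

  Positive : List ⟦ Breakpoint ⟧ → Set
  Positive = All λ (u , w) → 0# < w

  Positive⇒Weighted : ∀ {bs} → Positive bs → Weighted bs
  Positive⇒Weighted = All.map <⇒≤

  private
    <⇒≢0 : ∀ {S} → 0# < S → S ≢ 0#
    <⇒≢0 (_ , 0≢S) S≡0 = 0≢S (sym S≡0)

  -- W is the filled amount at level u⁻, of which bs contributes S * u⁻.
  rounds-spec : ∀ {c W S u⁻ hi bs} → Positive bs → AllPairs (λ b b′ → proj₁ b ≤ proj₁ b′) bs →
    All (λ b → u⁻ ≤ proj₁ b) bs → All (λ b → proj₁ b ≤ hi) bs → S ≡ costᴮ bs →
    W < c → c + S * u⁻ ≤ W + massᴮ bs →
    let ζ = result (rounds c W S u⁻ bs) in u⁻ ≤ ζ × ζ ≤ hi × W + fillᴮ bs ζ ≡ c + S * u⁻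
  -- With no breakpoint left `S` is `0#`, so the mass bound collapses to `c ≤ W` and contradicts
  -- `W < c`: the fallback answer is never returned.
  rounds-spec {c} {W} {S} {u⁻} {bs = []} _ _ _ _ refl W<c c≤ =
    ⊥-elim (<⇒≱ W<c (≤-from c≤ (solve 3 (λ c W u → c :+ (W :+ con 0) := W :+ (c :+ con 0 :* u)) refl c W u⁻)))
  rounds-spec {c} {W} {S} {u⁻} {hi} {(u , w) ∷ bs} (0<w ∷ 0<ws) (u≤us ∷ bs↗) (u⁻≤u ∷ _) (u≤hi ∷ us≤hi) S≡ W<c c≤
    with c ≤? W + S * (u - u⁻)
  ... | yes c≤W′ =
      ≤-trans (≤-reflexive (sym (+-identityʳ u⁻))) (+-monoʳ-≤ u⁻ 0≤e)
    , ≤-trans ζ≤u u≤hi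
    , (begin
        W + fillᴮ ((u , w) ∷ bs) (u⁻ + e)       ≡⟨ cong (W +_) (fillᴮ-below (ζ≤u ∷ All.map (≤-trans ζ≤u) u≤us)) ⟩
        W + costᴮ ((u , w) ∷ bs) * (u⁻ + e)     ≡⟨ cong (λ S → W + S * (u⁻ + e)) S≡ ⟨
        W + S * (u⁻ + e)                        ≡⟨ solve 4 (λ W S u e → W :+ S :* (u :+ e) := (S :* e :+ W) :+ S :* u) refl W S u⁻ e ⟩
        S * e + W + S * u⁻                      ≡⟨ cong (λ d → d + W + S * u⁻) S*e≡d ⟩
        c - W + W + S * u⁻                      ≡⟨ cong (_+ S * u⁻) (x-y+y≡x c W) ⟩
        c + S * u⁻                              ∎)
    where
    open ≡.≡-Reasoning
    e = (c - W) * S ⁻¹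
    0<S : 0# < S
    0<S = <-≤-trans 0<w (≤-trans (≤-reflexive (sym (+-identityʳ w)))
      (≤-trans (+-monoʳ-≤ w (∑-nonneg (Positive⇒Weighted 0<ws))) (≤-reflexive (sym S≡))))
    S*e≡d : S * e ≡ c - W
    S*e≡d = x*[y*x⁻¹]≡y (c - W) (<⇒≢0 0<S)
    0≤e : 0# ≤ e
    0≤e = *-cancelˡ-≤ 0<S (≤-trans (≤-reflexive (zeroʳ S)) (≤-trans (0≤y-x (<⇒≤ W<c)) (≤-reflexive (sym S*e≡d))))
    e≤Δ : e ≤ u - u⁻
    e≤Δ = *-cancelˡ-≤ 0<S (≤-trans (≤-reflexive S*e≡d) (≤-from c≤W′
      (≡.trans (solve 3 (λ d W x → d :+ (W :+ x) := x :+ (d :+ W)) refl (c - W) W (S * (u - u⁻)))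
        (cong (S * (u - u⁻) +_) (x-y+y≡x c W)))))
    ζ≤u : u⁻ + e ≤ u
    ζ≤u = ≤-trans (+-monoʳ-≤ u⁻ e≤Δ) (≤-reflexive (≡.trans (+-comm u⁻ (u - u⁻)) (x-y+y≡x u u⁻)))
  ... | no c≰W′ =
      ≤-trans u⁻≤u (proj₁ rec)
    , proj₁ (proj₂ rec)
    -- Adding `S * Δ` to both sides leaves an identity without subtraction: `Δ` and `S′` are atoms
    -- for the semiring solver, and what they abbreviate enters only through `x-y+y≡x`.
    , +-cancelʳ-≡ (S * Δ) (begin
        W + (w * (u ⊓ ζ) + fillᴮ bs ζ) + S * Δ    ≡⟨ cong (λ h → W + (w * h + fillᴮ bs ζ) + S * Δ) (x≤y⇒x⊓y≈x (proj₁ rec)) ⟩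
        W + (w * u + fillᴮ bs ζ) + S * Δ          ≡⟨ solve 4 (λ W x f y → W :+ (x :+ f) :+ y := (W :+ y) :+ f :+ x) refl W (w * u) (fillᴮ bs ζ) (S * Δ) ⟩
        W + S * Δ + fillᴮ bs ζ + w * u            ≡⟨ cong (_+ w * u) (proj₂ (proj₂ rec)) ⟩
        c + S′ * u + w * u                        ≡⟨ solve 4 (λ c s u w → c :+ s :* u :+ w :* u := c :+ (s :+ w) :* u) refl c S′ u w ⟩
        c + (S′ + w) * u                          ≡⟨ cong₂ (λ s u → c + s * u) (x-y+y≡x S w) (sym (x-y+y≡x u u⁻)) ⟩
        c + S * (Δ + u⁻)                          ≡⟨ solve 4 (λ c s d u → c :+ s :* (d :+ u) := c :+ s :* u :+ s :* d) refl c S Δ u⁻ ⟩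
        c + S * u⁻ + S * Δ                        ∎)
    where
    open ≡.≡-Reasoning
    Δ = u - u⁻
    S′ = S - w
    S′≡ : S′ ≡ costᴮ bs
    S′≡ = sym (x+y≡z⇒x≡z-y (≡.trans (+-comm (costᴮ bs) w) (sym S≡)))
    ζ = result (rounds c (W + S * Δ) S′ u bs)
    rec : u ≤ ζ × ζ ≤ hi × W + S * Δ + fillᴮ bs ζ ≡ c + S′ * u
    rec = rounds-spec 0<ws bs↗ u≤us us≤hi S′≡ (≰⇒> c≰W′) (≤-from c≤ (begin
      c + S′ * u + (W + (w * u + massᴮ bs))
        ≡⟨ solve 6 (λ c s u W w M → c :+ s :* u :+ (W :+ (w :* u :+ M)) := c :+ (s :+ w) :* u :+ (W :+ M)) refl c S′ u W w (massᴮ bs) ⟩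
      c + (S′ + w) * u + (W + massᴮ bs)
        ≡⟨ cong₂ (λ s u → c + s * u + (W + massᴮ bs)) (x-y+y≡x S w) (sym (x-y+y≡x u u⁻)) ⟩
      c + S * (Δ + u⁻) + (W + massᴮ bs)
        ≡⟨ solve 6 (λ c s d u W M → c :+ s :* (d :+ u) :+ (W :+ M) := (W :+ s :* d :+ M) :+ (c :+ s :* u)) refl c S Δ u⁻ W (massᴮ bs) ⟩
      W + S * Δ + massᴮ bs + (c + S * u⁻)       ∎))

  record Root (bs : List ⟦ Breakpoint ⟧) (c hi ζ : Carrier) : Set where
    constructor root
    field
      0≤ζ  : 0# ≤ ζ
      ζ≤hi : ζ ≤ hi
      fill : fillᴮ bs ζ ≡ c

  -- The upper end `hi` is any bound on the ceilings; taken as the largest ceiling it yields the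
  -- range condition of a water level.
  Locates : (Carrier → List ⟦ Breakpoint ⟧ → Prog real) → Set
  Locates locate = ∀ {c hi bs} → Positive bs → All (λ b → 0# ≤ proj₁ b) bs → All (λ b → proj₁ b ≤ hi) bs →
                   0# < c → c ≤ massᴮ bs → Root bs c hi (result (locate c bs))

  bySorting-locates : Locates bySorting
  bySorting-locates {c} {hi} {bs} 0<ws 0≤us us≤hi 0<c c≤ = root (proj₁ spec) (proj₁ (proj₂ spec)) (begin
      fillᴮ bs ζ         ≡⟨ ∑-↭ _ bs′↭bs ⟨
      fillᴮ bs′ ζ        ≡⟨ +-identityˡ _ ⟨
      0# + fillᴮ bs′ ζ   ≡⟨ proj₂ (proj₂ spec) ⟩
      c + S * 0#         ≡⟨ cong (c +_) (zeroʳ S) ⟩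
      c + 0#             ≡⟨ +-identityʳ c ⟩
      c                  ∎)
    where
    open ≡.≡-Reasoning
    bs′ = result (sort Breakpoint lowerCeiling bs)
    bs′↭bs : bs′ ↭ bs
    bs′↭bs = MergeSort.sort-↭ Breakpoint lowerCeiling bs
    S = result (totalCost bs′)
    ζ = result (rounds c 0# S 0# bs′)
    spec = rounds-spec {c} {0#} {S} {0#} {hi} {bs′} (All-resp-↭ (↭-sym bs′↭bs) 0<ws)
      (MergeSort.sort-sorted Breakpoint lowerCeiling ≤-trans ≤ᴿ-true (λ eq → <⇒≤ (≤ᴿ-false eq)) bs)
      (All-resp-↭ (↭-sym bs′↭bs) 0≤us) (All-resp-↭ (↭-sym bs′↭bs) us≤hi) (result-totalCost bs′) 0<c
      (≤-trans (≤-reflexive (≡.trans (cong (c +_) (zeroʳ S)) (+-identityʳ c)))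
        (≤-trans c≤ (≤-reflexive (≡.trans (sym (∑-↭ _ bs′↭bs)) (sym (+-identityˡ _))))))

  result-ceilings : ∀ bs → result (ceilings bs) ≡ map proj₁ bs
  result-ceilings []       = refl
  result-ceilings (b ∷ bs) = cong (proj₁ b ∷_) (result-ceilings bs)

  module _ {p bs lt es gt} (parted : Partitioned {Breakpoint} proj₁ p bs (lt , es , gt)) where
    open Partitioned parted
    open ≡.≡-Reasoning

    fillᴮ-parts : ∀ ζ → fillᴮ bs ζ ≡ fillᴮ lt ζ + (fillᴮ es ζ + fillᴮ gt ζ)
    fillᴮ-parts ζ = ≡.trans (sym (∑-↭ _ permuted)) (≡.trans (∑-++ lt (es ++ gt) _) (cong (fillᴮ lt ζ +_) (∑-++ es gt _)))

    -- Up to the pivot, `es` and `gt` are unsaturated and act as pure slope, so they may be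
    -- discarded into `S`. Dually, `fillᴮ-right` discards the saturated `lt` and `es` into `W`.
    fillᴮ-left : ∀ S W {ζ} → ζ ≤ p → W + S * ζ + fillᴮ bs ζ ≡ W + (S + costᴮ gt + costᴮ es) * ζ + fillᴮ lt ζ
    fillᴮ-left S W {ζ} ζ≤p = begin
      W + S * ζ + fillᴮ bs ζ
        ≡⟨ cong (W + S * ζ +_) (fillᴮ-parts ζ) ⟩
      W + S * ζ + (fillᴮ lt ζ + (fillᴮ es ζ + fillᴮ gt ζ))
        ≡⟨ cong₂ (λ x y → W + S * ζ + (fillᴮ lt ζ + (x + y)))
             (fillᴮ-below (All.map (λ u≡p → ≤-trans ζ≤p (≤-reflexive (sym u≡p))) all-eq))
             (fillᴮ-below (All.map (λ p<u → ≤-trans ζ≤p (<⇒≤ p<u)) all-gt)) ⟩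
      W + S * ζ + (fillᴮ lt ζ + (costᴮ es * ζ + costᴮ gt * ζ))
        ≡⟨ solve 6 (λ W S z f e g → W :+ S :* z :+ (f :+ (e :* z :+ g :* z)) := W :+ (S :+ g :+ e) :* z :+ f) refl
             W S ζ (fillᴮ lt ζ) (costᴮ es) (costᴮ gt) ⟩
      W + (S + costᴮ gt + costᴮ es) * ζ + fillᴮ lt ζ ∎

    fillᴮ-right : ∀ S W {ζ} → p ≤ ζ → W + S * ζ + fillᴮ bs ζ ≡ (W + massᴮ lt + massᴮ es) + S * ζ + fillᴮ gt ζ
    fillᴮ-right S W {ζ} p≤ζ = begin
      W + S * ζ + fillᴮ bs ζ
        ≡⟨ cong (W + S * ζ +_) (fillᴮ-parts ζ) ⟩
      W + S * ζ + (fillᴮ lt ζ + (fillᴮ es ζ + fillᴮ gt ζ))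
        ≡⟨ cong₂ (λ x y → W + S * ζ + (x + (y + fillᴮ gt ζ)))
             (fillᴮ-above (All.map (λ u<p → ≤-trans (<⇒≤ u<p) p≤ζ) all-lt))
             (fillᴮ-above (All.map (λ u≡p → ≤-trans (≤-reflexive u≡p) p≤ζ) all-eq)) ⟩
      W + S * ζ + (massᴮ lt + (massᴮ es + fillᴮ gt ζ))
        ≡⟨ solve 5 (λ W s f e g → W :+ s :+ (f :+ (e :+ g)) := (W :+ f :+ e) :+ s :+ g) refl
             W (S * ζ) (massᴮ lt) (massᴮ es) (fillᴮ gt ζ) ⟩
      (W + massᴮ lt + massᴮ es) + S * ζ + fillᴮ gt ζ ∎

    -- The right-hand side is what `search` computes and compares with `c`: it is the curve at the
    -- pivot, obtained without evaluating any minimum.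
    fillᴮ-pivot : ∀ S W → W + S * p + fillᴮ bs p ≡ W + massᴮ lt + massᴮ es + p * (S + costᴮ gt)
    fillᴮ-pivot S W = begin
      W + S * p + fillᴮ bs p
        ≡⟨ fillᴮ-right S W ≤-refl ⟩
      (W + massᴮ lt + massᴮ es) + S * p + fillᴮ gt p
        ≡⟨ cong (W + massᴮ lt + massᴮ es + S * p +_) (fillᴮ-below (All.map <⇒≤ all-gt)) ⟩
      (W + massᴮ lt + massᴮ es) + S * p + costᴮ gt * p
        ≡⟨ solve 4 (λ W s p g → W :+ s :* p :+ g :* p := W :+ p :* (s :+ g)) refl
             (W + massᴮ lt + massᴮ es) S p (costᴮ gt) ⟩
      W + massᴮ lt + massᴮ es + p * (S + costᴮ gt) ∎

  module _ {S W : Carrier} {bs : List ⟦ Breakpoint ⟧} (0≤S : 0# ≤ S) (0≤ws : Weighted bs) where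

    curve : Carrier → Carrier
    curve ζ = W + S * ζ + fillᴮ bs ζ

    curve-mono : ∀ {ζ ζ′} → ζ ≤ ζ′ → curve ζ ≤ curve ζ′
    curve-mono ζ≤ζ′ = +-mono-≤ (+-monoʳ-≤ W (*-monoʳ-≤ 0≤S ζ≤ζ′)) (fillᴮ-mono 0≤ws ζ≤ζ′)

    -- Monotonicity read contrapositively; the curve need not be strictly increasing, being flat
    -- above all ceilings when `S` is zero. It places the retained end of a bracket on the correct
    -- side of the pivot.
    curve-reflects-< : ∀ {ζ ζ′} → curve ζ < curve ζ′ → ζ < ζ′
    curve-reflects-< {ζ} {ζ′} lt = ≰⇒> λ ζ′≤ζ → <⇒≱ lt (curve-mono ζ′≤ζ)

  -- The facts about one round that correctness and cost share: correctness needs the halving so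
  -- that the fuel never runs out, cost needs it for the geometric series.
  module Halving (b : ⟦ Breakpoint ⟧) (bs′ : List ⟦ Breakpoint ⟧) where
    open Nat using () renaming (_+_ to _+ₙ_; _*_ to _*ₙ_; _≤_ to _≤ₙ_)

    bs lt es gt : List ⟦ Breakpoint ⟧
    bs = b ∷ bs′
    p : Carrier
    p = result (median (result (ceilings bs)))
    lt = proj₁ (result (partition Breakpoint proj₁ p bs))
    es = proj₁ (proj₂ (result (partition Breakpoint proj₁ p bs)))
    gt = proj₂ (proj₂ (result (partition Breakpoint proj₁ p bs)))

    parted : Partitioned {Breakpoint} proj₁ p bs (lt , es , gt)
    parted = partitioned proj₁ p bs

    p-spec : SelectSpec ⌊ length bs /2⌋ (map proj₁ bs) (median (result (ceilings bs))) (402 *ₙ length bs +ₙ 42)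
    p-spec = subst (λ us → SelectSpec ⌊ length bs /2⌋ (map proj₁ bs) (median us) (402 *ₙ length bs +ₙ 42)) (sym (result-ceilings bs))
      (subst (λ l → SelectSpec ⌊ l /2⌋ (map proj₁ bs) (median (map proj₁ bs)) (402 *ₙ l +ₙ 42)) (length-map proj₁ bs)
        (median-spec (map proj₁ bs) (s≤s z≤n)))

    balanced : 2 *ₙ length lt ≤ₙ length bs × 2 *ₙ length gt ≤ₙ length bs
    balanced = median-balances parted (proj₁ p-spec)

    halved⇒≤ : ∀ {l fuel} → 2 *ₙ l ≤ₙ length bs → length bs ≤ₙ suc fuel → l ≤ₙ fuel
    halved⇒≤ {zero}  _ _ = z≤n
    halved⇒≤ {suc l} {fuel} 2l≤ ≤fuel = ℕₚ.≤-pred (ℕₚ.≤-trans (s≤s (ℕₚ.m≤n+m (suc l) l))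
      (ℕₚ.≤-trans (ℕₚ.≤-reflexive (cong (λ k → suc (l +ₙ suc k)) (sym (ℕₚ.+-identityʳ l)))) (ℕₚ.≤-trans 2l≤ ≤fuel)))

  -- The root stays bracketed between lo and hi whatever the pivots are; that
  -- they are medians matters only for fuel and running time.
  search-spec : ∀ fuel {c W S lo hi bs} → length bs Nat.≤ fuel → 0# ≤ S → Weighted bs →
    W + S * lo + fillᴮ bs lo < c → c ≤ W + S * hi + fillᴮ bs hi →
    let ζ = result (search fuel c W S bs) in lo ≤ ζ × ζ ≤ hi × W + S * ζ + fillᴮ bs ζ ≡ c
  search-spec fuel {c} {W} {S} {lo} {hi} {[]} _ 0≤S _ <c c≤ =
      *-cancelˡ-≤ 0<S (≤-trans (≤-from (<⇒≤ <c) (lhs lo)) (≤-reflexive (sym S*ζ≡)))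
    , *-cancelˡ-≤ 0<S (≤-trans (≤-reflexive S*ζ≡) (≤-from c≤ (rhs hi)))
    , (begin
        W + S * ζ + 0#   ≡⟨ +-identityʳ _ ⟩
        W + S * ζ        ≡⟨ cong (W +_) S*ζ≡ ⟩
        W + (c - W)      ≡⟨ +-comm W (c - W) ⟩
        c - W + W        ≡⟨ x-y+y≡x c W ⟩
        c                ∎)
    where
    open ≡.≡-Reasoning
    ζ = (c - W) * S ⁻¹
    -- Without breakpoints the curve is `W + S * ζ`. If `S` vanished it would be constant and could
    -- not be below `c` at `lo` and at least `c` at `hi`; this is where the strict inequality at the
    -- lower end is essential.
    S≢0 : S ≢ 0#
    S≢0 refl = <⇒≱ <c (≤-trans c≤ (≤-reflexive
      (solve 3 (λ W h l → W :+ con 0 :* h :+ con 0 := W :+ con 0 :* l :+ con 0) refl W hi lo)))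
    0<S : 0# < S
    0<S = 0≤S , λ 0≡S → S≢0 (sym 0≡S)
    S*ζ≡ : S * ζ ≡ c - W
    S*ζ≡ = x*[y*x⁻¹]≡y (c - W) S≢0
    lhs : ∀ x → S * x + c ≡ c - W + (W + S * x + 0#)
    lhs x = begin
      S * x + c                       ≡⟨ cong (S * x +_) (x-y+y≡x c W) ⟨
      S * x + (c - W + W)             ≡⟨ solve 3 (λ s d W → s :+ (d :+ W) := d :+ (W :+ s :+ con 0)) refl (S * x) (c - W) W ⟩
      c - W + (W + S * x + 0#)        ∎
    rhs : ∀ x → c - W + (W + S * x + 0#) ≡ S * x + c
    rhs x = sym (lhs x)
  search-spec (suc fuel) {c} {W} {S} {lo} {hi} {b ∷ bs′} len≤ 0≤S 0≤ws <c c≤ =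
    result-if real (λ ζ → lo ≤ ζ × ζ ≤ hi × W + S * ζ + fillᴮ bs ζ ≡ c) (result (c ≤ᴿ y)) left right
    where
    open Halving b bs′
    W₁ = W + result (totalMass lt)
    W₂ = W₁ + result (totalMass es)
    S₁ = S + result (totalCost gt)
    S₂ = S₁ + result (totalCost es)
    y = W₂ + p * S₁
    W₂≡ : W₂ ≡ W + massᴮ lt + massᴮ es
    W₂≡ = cong₂ (λ l e → W + l + e) (result-totalMass lt) (result-totalMass es)
    S₁≡ : S₁ ≡ S + costᴮ gt
    S₁≡ = cong (S +_) (result-totalCost gt)
    S₂≡ : S₂ ≡ S + costᴮ gt + costᴮ es
    S₂≡ = cong₂ _+_ S₁≡ (result-totalCost es)
    y≡ : y ≡ curve {S} {W} 0≤S 0≤ws p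
    y≡ = ≡.trans (cong₂ (λ W S → W + p * S) W₂≡ S₁≡) (sym (fillᴮ-pivot parted S W))
    parts-weighted : Weighted (lt ++ es ++ gt)
    parts-weighted = All-resp-↭ (↭-sym (Partitioned.permuted parted)) 0≤ws
    lt-weighted : Weighted lt
    lt-weighted = All.++⁻ˡ lt parts-weighted
    es-weighted : Weighted es
    es-weighted = All.++⁻ˡ es (All.++⁻ʳ lt parts-weighted)
    gt-weighted : Weighted gt
    gt-weighted = All.++⁻ʳ es (All.++⁻ʳ lt parts-weighted)
    0≤S₂ : 0# ≤ S₂
    0≤S₂ = ≤-trans 0≤S (≤-trans (≤-reflexive (≡.trans (sym (+-identityʳ S)) (cong (S +_) (sym (+-identityˡ 0#)))))
      (≤-trans (+-monoʳ-≤ S (+-mono-≤ (∑-nonneg gt-weighted) (∑-nonneg es-weighted)))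
        (≤-reflexive (≡.trans (sym (+-assoc S _ _)) (sym S₂≡)))))
    leftwards : ∀ {ζ} → ζ ≤ p → W + S * ζ + fillᴮ bs ζ ≡ W + S₂ * ζ + fillᴮ lt ζ
    leftwards ζ≤p = ≡.trans (fillᴮ-left parted S W ζ≤p) (cong (λ S → W + S * _ + fillᴮ lt _) (sym S₂≡))
    rightwards : ∀ {ζ} → p ≤ ζ → W + S * ζ + fillᴮ bs ζ ≡ W₂ + S * ζ + fillᴮ gt ζ
    rightwards p≤ζ = ≡.trans (fillᴮ-right parted S W p≤ζ) (cong (λ W → W + S * _ + fillᴮ gt _) (sym W₂≡))
    Found : Carrier → Set
    Found ζ = lo ≤ ζ × ζ ≤ hi × W + S * ζ + fillᴮ bs ζ ≡ c

    -- The pivot may lie outside the bracket.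
    left : result (c ≤ᴿ y) ≡ true → Found (result (search fuel c W S₂ lt))
    left eq with upper
      where
      upper : ∃ λ h → h ≤ p × h ≤ hi × c ≤ W + S * h + fillᴮ bs h
      upper with ≤-total p hi
      ... | inj₁ p≤hi = p , ≤-refl , p≤hi , ≤-trans (≤ᴿ-true eq) (≤-reflexive y≡)
      ... | inj₂ hi≤p = hi , hi≤p , ≤-refl , c≤
    ... | h , h≤p , h≤hi , c≤h = proj₁ rec , ≤-trans (proj₁ (proj₂ rec)) h≤hi
        , ≡.trans (leftwards (≤-trans (proj₁ (proj₂ rec)) h≤p)) (proj₂ (proj₂ rec))
      where
      lo<h : lo < h
      lo<h = curve-reflects-< {S} {W} 0≤S 0≤ws (<-≤-trans <c c≤h)
      rec = search-spec fuel {c} {W} {S₂} {lo} {h} {lt} (halved⇒≤ (proj₁ balanced) len≤) 0≤S₂ lt-weighted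
        (subst (_< c) (leftwards (≤-trans (<⇒≤ lo<h) h≤p)) <c)
        (≤-trans c≤h (≤-reflexive (leftwards h≤p)))

    right : result (c ≤ᴿ y) ≡ false → Found (result (search fuel c W₂ S gt))
    right eq with lower
      where
      lower : ∃ λ l → p ≤ l × lo ≤ l × W + S * l + fillᴮ bs l < c
      lower with ≤-total lo p
      ... | inj₁ lo≤p = p , ≤-refl , lo≤p , ≤-<-trans (≤-reflexive (sym y≡)) (≤ᴿ-false eq)
      ... | inj₂ p≤lo = lo , p≤lo , ≤-refl , <c
    ... | l , p≤l , lo≤l , <c = ≤-trans lo≤l (proj₁ rec) , proj₁ (proj₂ rec)
        , ≡.trans (rightwards (≤-trans p≤l (proj₁ rec))) (proj₂ (proj₂ rec))
      where
      l<hi : l < hi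
      l<hi = curve-reflects-< {S} {W} 0≤S 0≤ws (<-≤-trans <c c≤)
      rec = search-spec fuel {c} {W₂} {S} {l} {hi} {gt} (halved⇒≤ (proj₂ balanced) len≤) 0≤S gt-weighted
        (subst (_< c) (rightwards p≤l) <c)
        (≤-trans c≤ (≤-reflexive (rightwards (≤-trans p≤l (<⇒≤ l<hi)))))

  bySelection-locates : Locates bySelection
  bySelection-locates {c} {hi} {bs} 0<ws 0≤us us≤hi 0<c c≤ = root (proj₁ spec) (proj₁ (proj₂ spec)) (begin
      fillᴮ bs ζ                ≡⟨ solve 2 (λ z f → f := con 0 :+ con 0 :* z :+ f) refl ζ (fillᴮ bs ζ) ⟩
      0# + 0# * ζ + fillᴮ bs ζ  ≡⟨ proj₂ (proj₂ spec) ⟩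
      c                         ∎)
    where
    open ≡.≡-Reasoning
    ζ = result (search (length bs) c 0# 0# bs)
    -- The initial bracket runs from `0#`, where nothing is filled, to `hi`, where every breakpoint
    -- is saturated and the curve equals the total mass.
    spec = search-spec (length bs) {c} {0#} {0#} {0#} {hi} {bs} ℕₚ.≤-refl ≤-refl (Positive⇒Weighted 0<ws)
      (≤-<-trans (≤-reflexive (≡.trans (cong (0# + 0# * 0# +_) (fillᴮ-below 0≤us))
        (solve 1 (λ C → con 0 :+ con 0 :* con 0 :+ C :* con 0 := con 0) refl (costᴮ bs)))) 0<c)
      (≤-trans c≤ (≤-reflexive (≡.trans (sym (fillᴮ-above us≤hi))
        (solve 2 (λ z f → f := con 0 :+ con 0 :* z :+ f) refl hi (fillᴮ bs hi)))))

-- Time and space of the two water-level procedures.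

module LocatorCost {F : OrderedField} {n m : ℕ} (I : Instance F n m) where
  open OrderedField F using (Carrier; 0#)
  open Machine Carrier (Instance.Point I) n m
  open Run I
  open Algorithms Carrier (Instance.Point I) n m
    using (sort; Breakpoint; totalCost; totalMass; rounds; lowerCeiling; bySorting; bySelection; ceilings; search)
  open Programs I
  open Selection I
  open Select I
  open LocatorCorrectness I
  open Nat using (_+_; _*_; _≤_)

  time-totalCost : ∀ bs → time (totalCost bs) ≤ 2 + 2 * length bs
  time-totalCost bs = s≤s (loopTime-const {k = 1} (λ _ _ → ℕₚ.≤-refl) _ bs)

  time-totalMass : ∀ bs → time (totalMass bs) ≤ 2 + 3 * length bs
  time-totalMass bs = s≤s (loopTime-const {k = 2} (λ _ _ → ℕₚ.≤-refl) _ bs)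

  time-rounds : ∀ c W S u⁻ bs → time (rounds c W S u⁻ bs) ≤ 8 * length bs
  time-rounds c W S u⁻ []       = z≤n
  time-rounds c W S u⁻ (b ∷ bs) = ℕₚ.≤-trans
    (ℕₚ.+-monoʳ-≤ 5 (time-if {k = 3 + 8 * length bs} (result (c ≤ᴿ _)) (ℕₚ.m≤m+n 3 _)
      (s≤s (ℕₚ.≤-trans (time-rounds c _ _ _ bs) (ℕₚ.m≤n+m _ 2)))))
    (ℕₚ.≤-reflexive (sym (ℕₚ.*-suc 8 (length bs))))

  time-bySorting : ∀ c bs → time (bySorting c bs) ≤ 4 * (length bs * ⌈log₂ length bs ⌉) + (10 * length bs + 3)
  time-bySorting c bs = MergeSort.time-sort Breakpoint lowerCeiling (λ _ _ → refl) bs +≤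
    subst (λ l → suc (time (totalCost bs′) + time (rounds c 0# S 0# bs′)) ≤ 10 * l + 3) (↭-length (MergeSort.sort-↭ Breakpoint lowerCeiling bs))
      (ℕₚ.≤-trans (s≤s (time-totalCost bs′ +≤ time-rounds c 0# S 0# bs′)) (ℕₚ.≤-reflexive (eq (length bs′))))
    where
    bs′ = result (sort Breakpoint lowerCeiling bs)
    S = result (totalCost bs′)
    eq : ∀ l → suc (2 + 2 * l + 8 * l) ≡ 10 * l + 3
    eq = solve-∀

  time-ceilings : ∀ bs → time (ceilings bs) ≡ length bs
  time-ceilings []       = refl
  time-ceilings (b ∷ bs) = cong suc (≡.trans (ℕₚ.+-identityʳ _) (time-ceilings bs))

  time-search : ∀ fuel c W S bs → length bs ≤ fuel → time (search fuel c W S bs) ≤ 940 * length bs + 2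
  time-search fuel       c W S []        _    = s≤s (s≤s z≤n)
  time-search (suc fuel) c W S (b ∷ bs′) len≤ =
    bound {length bs} {length lt} {length es} {length gt} (s≤s z≤n)
      (ℕₚ.≤-trans (ℕₚ.+-monoʳ-≤ (length lt) (ℕₚ.m≤m+n (length es) (length gt))) (ℕₚ.≤-reflexive length-parts))
      (ℕₚ.≤-trans (ℕₚ.m≤n+m _ (length lt)) (ℕₚ.≤-reflexive length-parts))
      (time-ceilings bs) (proj₂ p-spec) (time-partition proj₁ p bs)
      (time-totalMass lt) (time-totalMass es) (time-totalCost es) (time-totalCost gt)
      (time-if {k = 470 * length bs + 2} (result (c ≤ᴿ _))
        (ℕₚ.≤-trans (time-search fuel c _ _ lt (halved⇒≤ (proj₁ balanced) len≤)) (half {length lt} (proj₁ balanced)))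
        (ℕₚ.≤-trans (time-search fuel c _ _ gt (halved⇒≤ (proj₂ balanced) len≤)) (half {length gt} (proj₂ balanced))))
    where
    open Halving b bs′
    open Partitioned parted using (length-parts)
    half : ∀ {l} → 2 * l ≤ length bs → 940 * l + 2 ≤ 470 * length bs + 2
    half {l} 2l≤ = ℕₚ.+-monoˡ-≤ 2 (ℕₚ.≤-trans (ℕₚ.≤-reflexive (ℕₚ.*-assoc 470 2 l)) (470 *≤ 2l≤))
    bound : ∀ {k l e g τ₁ τ₂ τ₃ τ₄ τ₅ τ₆ τ₇ τ₈} → 1 ≤ k → l + e ≤ k → e + g ≤ k → τ₁ ≡ k → τ₂ ≤ 402 * k + 42 → τ₃ ≡ 3 * k →
      τ₄ ≤ 2 + 3 * l → τ₅ ≤ 2 + 3 * e → τ₆ ≤ 2 + 2 * e → τ₇ ≤ 2 + 2 * g → τ₈ ≤ 470 * k + 2 →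
      suc (τ₁ + (τ₂ + (τ₃ + (τ₄ + (τ₅ + (τ₆ + (τ₇ + (7 + τ₈)))))))) ≤ 940 * k + 2
    bound {k} {l} {e} {g} {_} {τ₂} {_} {τ₄} {τ₅} {τ₆} {τ₇} {τ₈} h₁ h₂ h₃ refl t₂ refl t₄ t₅ t₆ t₇ t₈ =
      -- One round costs 406 per breakpoint for ceilings, median and partition, 5 for the four
      -- totals, and constants that `1 ≤ k` turns into 58. That is 469, one less than the 470 that
      -- halving leaves of 940.
      lin k (58 *≤ h₁ +≤ 3 *≤ h₂ +≤ 2 *≤ h₃ +≤ t₂ +≤ t₄ +≤ t₅ +≤ t₆ +≤ t₇ +≤ t₈) (eq k l e g τ₂ τ₄ τ₅ τ₆ τ₇ τ₈)
      where
      eq : ∀ k l e g τ₂ τ₄ τ₅ τ₆ τ₇ τ₈ →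
        suc (k + (τ₂ + (3 * k + (τ₄ + (τ₅ + (τ₆ + (τ₇ + (7 + τ₈))))))))
          + (58 * k + 3 * k + 2 * k + (402 * k + 42) + (2 + 3 * l) + (2 + 3 * e) + (2 + 2 * e) + (2 + 2 * g) + (470 * k + 2)) + k
        ≡ 940 * k + 2 + (58 * 1 + 3 * (l + e) + 2 * (e + g) + τ₂ + τ₄ + τ₅ + τ₆ + τ₇ + τ₈)
      eq = solve-∀

  time-bySelection : ∀ c bs → time (bySelection c bs) ≤ 940 * length bs + 3
  time-bySelection c bs = ℕₚ.≤-trans (s≤s (time-search (length bs) c _ _ bs ℕₚ.≤-refl)) (ℕₚ.≤-reflexive (sym (ℕₚ.+-suc (940 * length bs) 2)))

  space-rounds : ∀ c W S u⁻ bs → space (rounds c W S u⁻ bs) ≤ 2 + 5 * length bs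
  space-rounds c W S u⁻ []       = z≤n
  space-rounds c W S u⁻ (b ∷ bs) = ℕₚ.≤-trans
    (ℕₚ.+-monoʳ-≤ 4 (space-if {k = 3 + 5 * length bs} (result (c ≤ᴿ _)) (ℕₚ.m≤m+n 2 _)
      (s≤s (space-rounds c _ _ _ bs))))
    (ℕₚ.≤-reflexive (eq (length bs)))
    where
    eq : ∀ l → 4 + (3 + 5 * l) ≡ 2 + 5 * suc l
    eq = solve-∀

  space-totalCost : ∀ bs → space (totalCost bs) ≤ 3
  space-totalCost bs = s≤s (loopSpace-const {words = λ _ → 1} {k = 2} (λ _ _ → ℕₚ.≤-refl) _ bs)

  space-bySorting : ∀ c bs → space (bySorting c bs) ≤ 32 * length bs + 8
  space-bySorting c bs = ⊔≤ (suc (space (sort Breakpoint lowerCeiling bs)))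
    (size (list Breakpoint) bs′ + suc (suc (space (totalCost bs′)) ⊔ suc (space ends)))
    (ℕₚ.≤-trans (s≤s (MergeSort.space-sort Breakpoint lowerCeiling (λ _ _ → refl) (λ _ → refl) bs))
      (slack 7 (eq₁ (length bs))))
    (ℕₚ.≤-trans
      (ℕₚ.≤-reflexive (≡.trans (size-list Breakpoint (λ _ → refl) bs′) (cong (λ l → suc (3 * l)) length-bs′))
        +≤ s≤s (⊔≤ (suc (space (totalCost bs′))) (suc (space ends)) {5 * length bs + 4}
          (s≤s (ℕₚ.≤-trans (space-totalCost bs′) (ℕₚ.m≤n+m 3 (5 * length bs + 0) )) ⟨≤⟩ ℕₚ.≤-reflexive (eq₂ (length bs)))
          (s≤s (ℕₚ.≤-trans (space-rounds c 0# S 0# bs′) (ℕₚ.≤-reflexive (cong (λ l → 2 + 5 * l) length-bs′))) ⟨≤⟩ slack 1 (eq₃ (length bs)))))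
      (slack (24 * length bs + 2) (eq₄ (length bs))))
    where
    _⟨≤⟩_ = ℕₚ.≤-trans
    bs′ = result (sort Breakpoint lowerCeiling bs)
    length-bs′ : length bs′ ≡ length bs
    length-bs′ = ↭-length (MergeSort.sort-↭ Breakpoint lowerCeiling bs)
    S = result (totalCost bs′)
    ends = rounds c 0# S 0# bs′
    eq₂ : ∀ l → suc (5 * l + 0 + 3) ≡ 5 * l + 4
    eq₂ = solve-∀
    eq₃ : ∀ l → suc (2 + 5 * l) + 1 ≡ 5 * l + 4
    eq₃ = solve-∀
    eq₄ : ∀ l → suc (3 * l) + suc (5 * l + 4) + (24 * l + 2) ≡ 32 * l + 8
    eq₄ = solve-∀
    eq₁ : ∀ l → suc (32 * l) + 7 ≡ 32 * l + 8
    eq₁ = solve-∀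

-- Programs that leave the output array unchanged.

module Purity {F : OrderedField} {n m : ℕ} (I : Instance F n m) where
  open OrderedField F using (Carrier)
  open Machine Carrier (Instance.Point I) n m
  open Run I
  open Algorithms Carrier (Instance.Point I) n m hiding (sortingBased; selectionBased; presortedSelectionBased)

  -- A record instead of the bare equation, so that the program can be inferred from the type:
  -- `output p z` computes and does not determine `p`. The property is applied to the water-level
  -- computation, which runs between the writes of the second stage.
  record Pure {t} (p : Prog t) : Set where
    constructor pure
    field preserves : ∀ z → output p z ≡ z
  open Pure public

  pure-return : ∀ {t} {x : ⟦ t ⟧} → Pure (return {t} x)
  pure-return = pure λ _ → refl

  infixr 1 _⨾_ _⟫_

  _⨾_ : ∀ {s t} {p : Prog s} {f : ⟦ s ⟧ → Prog t} → Pure p → Pure (f (result p)) → Pure (p >>= f)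
  _⨾_ {p = p} {f} pp pf = pure λ z → ≡.trans (cong (output (f (result p))) (preserves pp z)) (preserves pf z)

  _⟫_ : ∀ {s t} {p : Prog s} {f : ⟦ s ⟧ → Prog t} → (∀ z → output p z ≡ z) → Pure (f (result p)) → Pure (p >>= f)
  pp ⟫ pf = pure pp ⨾ pf

  pure-step : ∀ {t} {p : Prog t} → Pure p → Pure (step p)
  pure-step pp = pure (preserves pp)

  pure-if : ∀ {t} {p q : Prog t} b → Pure p → Pure q → Pure (if b then p else q)
  pure-if true  pp pq = pp
  pure-if false pp pq = pq

  pure-loop : ∀ {s t} {xs} {a : ⟦ t ⟧} {f : ⟦ t ⟧ → ⟦ s ⟧ → Prog t} → (∀ a x → Pure (f a x)) → Pure (loop s xs a f)
  pure-loop {s} {t} {xs} {a} {f} pf = pure (go a xs)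
    where
    go : ∀ a xs z → loopOutput (λ b x → result (f b x)) (λ b x → output (f b x)) a xs z ≡ z
    go a []       z = refl
    go a (x ∷ xs) z = ≡.trans (go _ xs (output (f a x) z)) (preserves (pf a x) z)

  module _ {t : Ty} {_≼_ : ⟦ t ⟧ → ⟦ t ⟧ → Prog bool} (pure-≼ : ∀ x y → Pure (x ≼ y)) where

    pure-split : ∀ xs → Pure (split t _≼_ xs)
    pure-split []           = pure-return
    pure-split (x ∷ [])     = pure-return
    pure-split (x ∷ y ∷ xs) = pure-step (pure-split xs ⨾ pure-return)

    pure-merge : ∀ xs ys → Pure (merge t _≼_ xs ys)
    pure-merge []       ys       = pure-return
    pure-merge (x ∷ xs) []       = pure-return
    pure-merge (x ∷ xs) (y ∷ ys) = pure-step (pure-≼ x y ⨾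
      pure-if (result (x ≼ y)) (pure-merge xs (y ∷ ys) ⨾ pure-return) (pure-merge (x ∷ xs) ys ⨾ pure-return))

    pure-mergeSort : ∀ fuel xs → Pure (mergeSort t _≼_ fuel xs)
    pure-mergeSort fuel       []           = pure-return
    pure-mergeSort fuel       (x ∷ [])     = pure-return
    pure-mergeSort zero       (x ∷ y ∷ xs) = pure-return
    pure-mergeSort (suc fuel) (x ∷ y ∷ xs) = pure-step
      (pure-split (x ∷ y ∷ xs) ⨾ pure-mergeSort fuel _ ⨾ pure-mergeSort fuel _ ⨾ pure-merge _ _)

    pure-sort : ∀ xs → Pure (sort t _≼_ xs)
    pure-sort xs = pure-mergeSort (length xs) xs

  pure-sortᴿ : ∀ xs → Pure (sort real _≤ᴿ_ xs)
  pure-sortᴿ = pure-sort (λ _ _ → pure λ _ → refl)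

  pure-count : ∀ t xs → Pure (count t xs)
  pure-count t xs = pure-loop (λ _ _ → pure λ _ → refl)

  pure-nth : ∀ r xs → Pure (nth r xs)
  pure-nth r       []       = pure λ _ → refl
  pure-nth zero    (x ∷ xs) = pure-return
  pure-nth (suc r) (x ∷ xs) = pure-step (pure-nth r xs)

  pure-mediansOfFive : ∀ xs → Pure (mediansOfFive xs)
  pure-mediansOfFive (a ∷ b ∷ c ∷ d ∷ e ∷ xs) = pure-step
    (pure-return ⨾ pure-sortᴿ (a ∷ b ∷ c ∷ d ∷ e ∷ []) ⨾ pure-nth 2 _ ⨾ pure-mediansOfFive xs ⨾ pure-return)
  pure-mediansOfFive []                   = pure-return
  pure-mediansOfFive (_ ∷ [])             = pure-return
  pure-mediansOfFive (_ ∷ _ ∷ [])         = pure-return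
  pure-mediansOfFive (_ ∷ _ ∷ _ ∷ [])     = pure-return
  pure-mediansOfFive (_ ∷ _ ∷ _ ∷ _ ∷ []) = pure-return

  pure-partition : ∀ t key p xs → Pure (partition t key p xs)
  pure-partition t key p []       = pure-return
  pure-partition t key p (x ∷ xs) = pure-step ((λ _ → refl) ⟫ (λ _ → refl) ⟫ pure-partition t key p xs ⨾ pure-return)

  pure-select : ∀ fuel r xs → Pure (select fuel r xs)
  pure-selectFrom : ∀ fuel r xs ms → Pure (selectFrom fuel r xs ms)

  pure-select zero       r xs = pure λ _ → refl
  pure-select (suc fuel) r xs = pure-step (pure-mediansOfFive xs ⨾ pure-selectFrom fuel r xs _)

  pure-selectFrom fuel r xs []       = pure-sortᴿ xs ⨾ pure-nth r _
  pure-selectFrom fuel r xs (μ ∷ μs) = pure-count real (μ ∷ μs) ⨾ (λ _ → refl) ⟫ pure-select fuel _ (μ ∷ μs) ⨾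
    pure-partition real Function.id _ xs ⨾ pure-count real _ ⨾ pure-count real _ ⨾ (λ _ → refl) ⟫ (λ _ → refl) ⟫ (λ _ → refl) ⟫
    pure-if (result (r <ᴺ nlt)) (pure-select fuel r _)
      (pure-if (result (r <ᴺ (nlt Nat.+ neq))) pure-return ((λ _ → refl) ⟫ pure-select fuel _ _))
    where
    parts = result (partition real Function.id (result (select fuel ⌊ result (count real (μ ∷ μs)) /2⌋ (μ ∷ μs))) xs)
    nlt = result (count real (proj₁ parts))
    neq = result (count real (proj₁ (proj₂ parts)))

  pure-median : ∀ xs → Pure (median xs)
  pure-median xs = pure-count real xs ⨾ (λ _ → refl) ⟫ pure-select (length xs) _ xs

  pure-totalCost : ∀ bs → Pure (totalCost bs)
  pure-totalCost bs = (λ _ → refl) ⟫ pure-loop (λ _ _ → pure λ _ → refl)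

  pure-totalMass : ∀ bs → Pure (totalMass bs)
  pure-totalMass bs = (λ _ → refl) ⟫ pure-loop (λ _ _ → pure λ _ → refl)

  pure-rounds : ∀ c W S u⁻ bs → Pure (rounds c W S u⁻ bs)
  pure-rounds c W S u⁻ []       = pure-return
  pure-rounds c W S u⁻ (b ∷ bs) = pure-step ((λ _ → refl) ⟫ (λ _ → refl) ⟫ (λ _ → refl) ⟫ (λ _ → refl) ⟫
    pure-if (result (c ≤ᴿ _)) (pure λ _ → refl) ((λ _ → refl) ⟫ pure-rounds c _ _ _ bs))

  pure-bySorting : ∀ c bs → Pure (bySorting c bs)
  pure-bySorting c bs = pure-sort (λ _ _ → pure λ _ → refl) bs ⨾ (λ _ → refl) ⟫ pure-totalCost _ ⨾ pure-rounds c _ _ _ _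

  pure-ceilings : ∀ bs → Pure (ceilings bs)
  pure-ceilings []       = pure-return
  pure-ceilings (b ∷ bs) = pure-step (pure-ceilings bs ⨾ pure-return)

  pure-search : ∀ fuel c W S bs → Pure (search fuel c W S bs)
  pure-search fuel       c W S []       = pure λ _ → refl
  pure-search zero       c W S (b ∷ bs) = pure λ _ → refl
  pure-search (suc fuel) c W S (b ∷ bs) = pure-step (pure-ceilings (b ∷ bs) ⨾ pure-median _ ⨾
    pure-partition Breakpoint proj₁ _ (b ∷ bs) ⨾ pure-totalMass _ ⨾ pure-totalMass _ ⨾ pure-totalCost _ ⨾ pure-totalCost _ ⨾
    (λ _ → refl) ⟫ (λ _ → refl) ⟫ (λ _ → refl) ⟫ (λ _ → refl) ⟫ (λ _ → refl) ⟫ (λ _ → refl) ⟫ (λ _ → refl) ⟫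
    pure-if (result (c ≤ᴿ _)) (pure-search fuel c _ _ _) (pure-search fuel c _ _ _))

  pure-bySelection : ∀ c bs → Pure (bySelection c bs)
  pure-bySelection c bs = (λ _ → refl) ⟫ pure-search (length bs) c _ _ bs

  pure-breakpoints : ∀ is → Pure (breakpoints is)
  pure-breakpoints []       = pure-return
  pure-breakpoints (i ∷ is) = pure-step ((λ _ → refl) ⟫ (λ _ → refl) ⟫ pure-breakpoints is ⨾ pure-return)

  pure-largestCeiling : ∀ is → Pure (largestCeiling is)
  pure-largestCeiling is = (λ _ → refl) ⟫ pure-loop (λ _ _ → (λ _ → refl) ⟫ (λ _ → refl) ⟫ pure-return)

  pure-solveWaterLevel : ∀ {locate} → (∀ c bs → Pure (locate c bs)) → ∀ Γ FΓ c → Pure (solveWaterLevel locate Γ FΓ c)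
  pure-solveWaterLevel pure-locate Γ FΓ c = (λ _ → refl) ⟫ (λ _ → refl) ⟫
    pure-if (result (c ≡ᴿ _)) pure-return ((λ _ → refl) ⟫
      pure-if (result (FΓ ≤ᴿ c)) (pure-largestCeiling Γ) (pure-breakpoints Γ ⨾ pure-locate c _))

-- The water level of a list of items: correctness, uniqueness and cost.

module WaterLevelSolver {F : OrderedField} {n m : ℕ} (I : Instance F n m) where
  open OrderedField F
  open OrderedFieldProperties F
  open WaterLevel
  private module I = Instance I
  open I using (mass)
  open Allocation I
  open Machine Carrier I.Point n m
  open Run I
  open Algorithms Carrier I.Point n m using (Breakpoint; Locator; breakpoints; solveWaterLevel)
  open LocatorCorrectness I
  open Extrema (DecTotalOrder.totalOrder decTotalOrder) using (argmax-sel; xs≤max; ⊥≤max)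

  breakpoint : Fin n → ⟦ Breakpoint ⟧
  breakpoint i = I.ceiling i , I.cost i

  result-breakpoints : ∀ is → result (breakpoints is) ≡ map breakpoint is
  result-breakpoints []       = refl
  result-breakpoints (i ∷ is) = cong (breakpoint i ∷_) (result-breakpoints is)

  ∑-map : ∀ {X Y : Set} (g : X → Y) (f : Y → Carrier) xs → ∑ (map g xs) f ≡ ∑ xs (f ∘ g)
  ∑-map g f []       = refl
  ∑-map g f (x ∷ xs) = cong (f (g x) +_) (∑-map g f xs)

  0<cost : ∀ i → 0# < I.cost i
  0<cost i = <-≤-trans I.0<wmin (I.wmin≤w (I.attribute i))

  -- The item with the largest ceiling is unsaturated below the larger level.
  filled-tight : ∀ S {ζ ζ′} → 0# ≤ ζ → ζ ≤ ζ′ → ζ′ ≤ maxCeiling S → filled S ζ ≡ filled S ζ′ → ζ ≡ ζ′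
  filled-tight S {ζ} {ζ′} 0≤ζ ζ≤ζ′ ζ′≤max eq with argmax-sel Function.id 0# (map I.ceiling S)
  ... | inj₁ max≡0 = ≤-antisym ζ≤ζ′ (≤-trans ζ′≤max (≤-trans (≤-reflexive max≡0) 0≤ζ))
  ... | inj₂ max∈ with ∈-map⁻ I.ceiling max∈
  ... | i , i∈S , max≡u = begin
      ζ                ≡⟨ x≤y⇒y⊓x≈x (≤-trans ζ≤ζ′ ζ′≤u) ⟨
      I.ceiling i ⊓ ζ  ≡⟨ *-cancelˡ-≡ (λ w≡0 → proj₂ (0<cost i) (sym w≡0))
                            (∑-tight (All.tabulate λ {i} _ → *-monoʳ-≤ (<⇒≤ (0<cost i)) (⊓-monoʳ-≤ (I.ceiling i) ζ≤ζ′)) eq i∈S) ⟩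
      I.ceiling i ⊓ ζ′ ≡⟨ x≤y⇒y⊓x≈x ζ′≤u ⟩
      ζ′               ∎
    where
    open ≡.≡-Reasoning
    ζ′≤u : ζ′ ≤ I.ceiling i
    ζ′≤u = ≤-trans ζ′≤max (≤-reflexive max≡u)

  isWaterLevel : ∀ {S c ζ} → 0# ≤ ζ → ζ ≤ maxCeiling S → filled S ζ ≡ c → IsWaterLevel S c ζ
  isWaterLevel {S} {c} {ζ} 0≤ζ ζ≤max solves = record
    { nonnegative = 0≤ζ ; below-max = ζ≤max ; solves = solves ; unique = unique }
    where
    unique : ∀ ζ′ → 0# ≤ ζ′ → ζ′ ≤ maxCeiling S → filled S ζ′ ≡ c → ζ′ ≡ ζ
    unique ζ′ 0≤ζ′ ζ′≤max solves′ with ≤-total ζ ζ′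
    ... | inj₁ ζ≤ζ′ = sym (filled-tight S 0≤ζ ζ≤ζ′ ζ′≤max (≡.trans solves (sym solves′)))
    ... | inj₂ ζ′≤ζ = filled-tight S 0≤ζ′ ζ′≤ζ ζ≤max (≡.trans solves′ (sym solves))

  module _ {locate : Locator} (locates : Locates locate) where

    locate-level : ∀ S {c} → 0# < c → c ≤ mass S → IsWaterLevel S c (result (locate c (result (breakpoints S))))
    locate-level S {c} 0<c c≤mass = subst (λ bs → IsWaterLevel S c (result (locate c bs))) (sym (result-breakpoints S))
      (isWaterLevel (Root.0≤ζ r) (Root.ζ≤hi r)
        (≡.trans (sym (∑-map breakpoint (λ (u , w) → w * (u ⊓ result (locate c (map breakpoint S)))) S)) (Root.fill r)))
      where
      r : Root (map breakpoint S) c (maxCeiling S) (result (locate c (map breakpoint S)))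
      r = locates (All.map⁺ (All.tabulate λ {i} _ → 0<cost i)) (All.map⁺ (All.tabulate λ {i} _ → I.0≤ceiling i))
        (All.map⁺ (All.map⁻ (xs≤max 0# (map I.ceiling S))))
        0<c (≤-trans c≤mass (≤-reflexive (sym (∑-map breakpoint (λ (u , w) → w * u) S))))

    solveWaterLevel-level : ∀ S {FΓ c} → FΓ ≡ mass S → 0# ≤ c → c < FΓ → IsWaterLevel S c (result (solveWaterLevel locate S FΓ c))
    solveWaterLevel-level S {FΓ} {c} refl 0≤c c<FΓ with c ≟ 0#
    ... | yes refl = isWaterLevel ≤-refl (⊥≤max 0# (map I.ceiling S)) (begin
        ∑ S (λ i → I.cost i * (I.ceiling i ⊓ 0#)) ≡⟨ ∑-cong {xs = S} (All.tabulate λ {i} _ → ≡.trans (cong (I.cost i *_) (x≤y⇒y⊓x≈x (I.0≤ceiling i)))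
                                                        (≡.trans (zeroʳ (I.cost i)) (sym (zeroʳ 0#)))) ⟩
        ∑ S (λ i → 0# * 0#)                       ≡⟨ ∑-*ʳ (λ _ → 0#) S 0# ⟩
        ∑ S (λ i → 0#) * 0#                       ≡⟨ zeroʳ _ ⟩
        0#                                        ∎)
      where open ≡.≡-Reasoning
    ... | no c≢0 with FΓ ≤? c
    -- The early return of the largest ceiling is never taken, because the boundary group is only
    -- partially filled.
    ... | yes FΓ≤c = ⊥-elim (<⇒≱ c<FΓ FΓ≤c)
    ... | no _     = locate-level S (0≤c , λ 0≡c → c≢0 (sym 0≡c)) (<⇒≤ c<FΓ)

module WaterLevelCost {F : OrderedField} {n m : ℕ} (I : Instance F n m) where
  open OrderedField F using (Carrier; 0#; _≟_; _≤?_; _<_)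
  open OrderedFieldProperties F using (<⇒≱)
  open Machine Carrier (Instance.Point I) n m
  open Run I
  open Algorithms Carrier (Instance.Point I) n m using (Breakpoint; Locator; breakpoints; solveWaterLevel)
  open Programs I
  open Nat using (_+_; _*_; _≤_)

  length-breakpoints : ∀ is → length (result (breakpoints is)) ≡ length is
  length-breakpoints []       = refl
  length-breakpoints (i ∷ is) = cong suc (length-breakpoints is)

  time-breakpoints : ∀ is → time (breakpoints is) ≤ 3 * length is
  time-breakpoints []       = z≤n
  time-breakpoints (i ∷ is) = ℕₚ.≤-trans
    (ℕₚ.+-monoʳ-≤ 3 (ℕₚ.≤-trans (ℕₚ.≤-reflexive (ℕₚ.+-identityʳ _)) (time-breakpoints is)))
    (ℕₚ.≤-reflexive (sym (ℕₚ.*-suc 3 (length is))))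

  size-breakpoints : ∀ is → size (list Breakpoint) (result (breakpoints is)) ≡ suc (3 * length is)
  size-breakpoints is = ≡.trans (size-list Breakpoint (λ _ → refl) (result (breakpoints is))) (cong (λ l → suc (3 * l)) (length-breakpoints is))

  space-breakpoints : ∀ is → space (breakpoints is) ≤ 3 * length is
  space-breakpoints []       = z≤n
  space-breakpoints (i ∷ is) = ℕₚ.≤-trans
    (ℕₚ.+-monoʳ-≤ 2 (⊔≤ (suc (space (breakpoints is))) (size (list Breakpoint) (result (breakpoints is)) + 0)
      (s≤s (space-breakpoints is)) (ℕₚ.≤-reflexive (≡.trans (ℕₚ.+-identityʳ _) (size-breakpoints is)))))
    (ℕₚ.≤-reflexive (sym (ℕₚ.*-suc 3 (length is))))

  module _ (locate : Locator) (Γ : List (Fin n)) {FΓ c : Carrier} (c<FΓ : c < FΓ) where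

    private
      bs = result (breakpoints Γ)

    time-solveWaterLevel : time (solveWaterLevel locate Γ FΓ c) ≤ 3 + (3 * length Γ + time (locate c bs))
    time-solveWaterLevel with c ≟ 0#
    ... | yes _ = s≤s (s≤s z≤n)
    ... | no _ with FΓ ≤? c
    ... | yes FΓ≤c = ⊥-elim (<⇒≱ c<FΓ FΓ≤c)
    ... | no _     = ℕₚ.+-monoʳ-≤ 3 (ℕₚ.+-monoˡ-≤ (time (locate c bs)) (time-breakpoints Γ))

    space-solveWaterLevel : space (solveWaterLevel locate Γ FΓ c) ≤ 4 + (3 * length Γ + space (locate c bs))
    space-solveWaterLevel with c ≟ 0#
    ... | yes _ = s≤s (s≤s z≤n)
    ... | no _ with FΓ ≤? c
    ... | yes FΓ≤c = ⊥-elim (<⇒≱ c<FΓ FΓ≤c)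
    ... | no _     = ℕₚ.+-monoʳ-≤ 3 (⊔≤ (suc (space (breakpoints Γ))) (size (list Breakpoint) bs + space (locate c bs))
      (s≤s (ℕₚ.≤-trans (space-breakpoints Γ) (ℕₚ.m≤m+n _ _)))
      (ℕₚ.≤-reflexive (cong (_+ space (locate c bs)) (size-breakpoints Γ))))

-- Rows, prefix sums and the boundary group.

module FirstStage {F : OrderedField} {n m : ℕ} (I : Instance F n m) where
  open OrderedField F
  open OrderedFieldProperties F
  private module I = Instance I
  open I using (mass)
  open Machine Carrier I.Point n m
  open Run I
  open Algorithms Carrier I.Point n m using (Row; rows; prefixSums; findBoundary)
  open LocatorCorrectness I using (foldl-+)
  open Purity I

  M : Fin m → Carrier
  M k = mass (I.members k)

  row : Fin m → ⟦ Row ⟧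
  row k = I.ratio k , M k , k

  result-rows : ∀ ks → result (rows ks) ≡ map row ks
  result-rows []       = refl
  result-rows (k ∷ ks) = cong₂ (λ F rs → (I.ratio k , F , k) ∷ rs)
    (≡.trans (foldl-+ (λ i → I.cost i * I.ceiling i) 0# (I.members k)) (+-identityˡ (M k))) (result-rows ks)

  summed : Carrier → List (Fin m) → List ⟦ Row ⟧
  summed F⁻ []       = []
  summed F⁻ (k ∷ ks) = (F⁻ + M k , M k , k) ∷ summed (F⁻ + M k) ks

  result-prefixSums : ∀ F⁻ ks → result (prefixSums F⁻ (map row ks)) ≡ summed F⁻ ks
  result-prefixSums F⁻ []       = refl
  result-prefixSums F⁻ (k ∷ ks) = cong ((F⁻ + M k , M k , k) ∷_) (result-prefixSums (F⁻ + M k) ks)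

  -- The offset `F⁻` is the mass already passed, as the induction along the list requires. `fits`
  -- covers every prefix of `before`: the nonempty ones give minimality of the boundary index, and
  -- the whole list gives `0 ≤ c⋆`.
  record Boundary (C F⁻ : Carrier) (ks : List (Fin m)) : Set where
    field
      before after : List (Fin m)
      k⋆           : Fin m
      split        : ks ≡ before ++ k⋆ ∷ after
      found        : result (findBoundary C F⁻ (summed F⁻ ks)) ≡ (before , F⁻ + ∑ before M , summed (F⁻ + ∑ before M) (k⋆ ∷ after))
      fits         : ∀ r → F⁻ + ∑ (take r before) M ≤ C
      exceeds      : C < F⁻ + ∑ before M + M k⋆

  findBoundary-stop : ∀ {C F⁻ F Fₖ k rs} → ¬ (F ≤ C) →
    result (findBoundary C F⁻ ((F , Fₖ , k) ∷ rs)) ≡ ([] , F⁻ , (F , Fₖ , k) ∷ rs)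
  findBoundary-stop {C} {F = F} F≰C with F ≤? C
  ... | yes F≤C = ⊥-elim (F≰C F≤C)
  ... | no _    = refl

  findBoundary-next : ∀ {C F⁻ F Fₖ k rs res} → F ≤ C → result (findBoundary C F rs) ≡ res →
    result (findBoundary C F⁻ ((F , Fₖ , k) ∷ rs)) ≡ (k ∷ proj₁ res , proj₂ res)
  findBoundary-next {C} {F = F} F≤C refl with F ≤? C
  ... | yes _  = refl
  ... | no F≰C = ⊥-elim (F≰C F≤C)

  boundary : ∀ {C F⁻} ks → F⁻ ≤ C → C < F⁻ + ∑ ks M → Boundary C F⁻ ks
  -- Running out of groups would mean that all of the mass fits into the budget.
  boundary {C} {F⁻} []       F⁻≤C C< = ⊥-elim (<⇒≱ C< (≤-trans (≤-reflexive (+-identityʳ F⁻)) F⁻≤C))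
  boundary {C} {F⁻} (k ∷ ks) F⁻≤C C< with F⁻ + M k ≤? C
  ... | no F≰C = record
    { before = [] ; after = ks ; k⋆ = k ; split = refl
    ; found = ≡.trans (findBoundary-stop F≰C) (cong (λ F → [] , F , summed F (k ∷ ks)) (sym (+-identityʳ F⁻)))
    ; fits = λ { zero → F⁻+0≤C ; (suc r) → F⁻+0≤C }
    ; exceeds = subst (λ F → C < F + M k) (sym (+-identityʳ F⁻)) (≰⇒> F≰C)
    }
    where
    F⁻+0≤C : F⁻ + 0# ≤ C
    F⁻+0≤C = ≤-trans (≤-reflexive (+-identityʳ F⁻)) F⁻≤C
  ... | yes F≤C = record
    { before = k ∷ B.before ; after = B.after ; k⋆ = B.k⋆ ; split = cong (k ∷_) B.split
    ; found = ≡.trans (findBoundary-next F≤C B.found)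
        (cong (λ F → k ∷ B.before , F , summed F (B.k⋆ ∷ B.after)) (assoc (∑ B.before M)))
    ; fits = λ { zero → ≤-trans (≤-reflexive (+-identityʳ F⁻)) F⁻≤C
               ; (suc r) → ≤-trans (≤-reflexive (sym (assoc (∑ (take r B.before) M)))) (B.fits r) }
    ; exceeds = subst (λ F → C < F + M B.k⋆) (assoc (∑ B.before M)) B.exceeds
    }
    where
    assoc : ∀ x → F⁻ + M k + x ≡ F⁻ + (M k + x)
    assoc x = +-assoc F⁻ (M k) x
    module B = Boundary (boundary ks F≤C (subst (C <_) (sym (assoc (∑ ks M))) C<))

  map-group-summed : ∀ F⁻ ks → map (λ r → proj₂ (proj₂ r)) (summed F⁻ ks) ≡ ks
  map-group-summed F⁻ []       = refl
  map-group-summed F⁻ (k ∷ ks) = cong (k ∷_) (map-group-summed (F⁻ + M k) ks)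

module FirstStageCost {F : OrderedField} {n m : ℕ} (I : Instance F n m) where
  open OrderedField F using (Carrier; _≤?_; 0#)
  open Machine Carrier (Instance.Point I) n m
  open Run I
  open Algorithms Carrier (Instance.Point I) n m using (Row; rows; prefixSums; findBoundary)
  open Programs I
  private module I = Instance I
  open Nat using (_+_; _*_; _≤_)

  total : List (Fin m) → ℕ
  total ks = sum (map (length ∘ I.members) ks)

  length-rows : ∀ ks → length (result (rows ks)) ≡ length ks
  length-rows []       = refl
  length-rows (k ∷ ks) = cong suc (length-rows ks)

  time-rows : ∀ ks → time (rows ks) ≤ 8 * length ks + 5 * total ks
  time-rows []       = z≤n
  time-rows (k ∷ ks) = ℕₚ.≤-trans
    (ℕₚ.+-monoʳ-≤ 7 (loopTime-const {k = 4} (λ _ _ → ℕₚ.≤-refl) 0# (I.members k) +≤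
      ℕₚ.≤-trans (ℕₚ.≤-reflexive (ℕₚ.+-identityʳ _)) (time-rows ks)))
    (ℕₚ.≤-reflexive (eq (length (I.members k)) (length ks) (total ks)))
    where
    eq : ∀ g l t → 7 + (suc (5 * g) + (8 * l + 5 * t)) ≡ 8 * suc l + 5 * (g + t)
    eq = solve-∀

  space-rows : ∀ ks → space (rows ks) ≤ 14 * length ks
  space-rows []       = z≤n
  space-rows (k ∷ ks) = ℕₚ.≤-trans
    (ℕₚ.+-monoʳ-≤ 6 (⊔≤ (suc (space massLoop)) (1 + (suc (space (rows ks)) ⊔ (size (list Row) (result (rows ks)) + 0)))
      (ℕₚ.≤-trans (s≤s (loopSpace-const {words = λ _ → 1} {k = 5} (λ _ _ → ℕₚ.≤-refl) 0# (I.members k))) (ℕₚ.m≤m+n 6 _))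
      (s≤s (⊔≤ (suc (space (rows ks))) (size (list Row) (result (rows ks)) + 0)
        (ℕₚ.≤-trans (s≤s (space-rows ks)) (ℕₚ.m≤n+m _ 6))
        (ℕₚ.≤-trans (ℕₚ.≤-reflexive (≡.trans (ℕₚ.+-identityʳ _) (≡.trans (size-list Row (λ _ → refl) (result (rows ks)))
          (cong (λ l → suc (4 * l)) (length-rows ks))))) (slack (6 + 10 * length ks) (eq₁ (length ks))))))))
    (ℕₚ.≤-reflexive (eq₂ (length ks)))
    where
    massLoop : Prog real
    massLoop = loop item (I.members k) 0# λ s i → cost i >>= λ w → ceiling i >>= λ u → (w ⊛ u) >>= λ x → s ⊕ x
    eq₁ : ∀ l → suc (4 * l) + (6 + 10 * l) ≡ 6 + suc (14 * l)
    eq₁ = solve-∀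
    eq₂ : ∀ l → 6 + suc (6 + suc (14 * l)) ≡ 14 * suc l
    eq₂ = solve-∀

  length-prefixSums : ∀ F⁻ rs → length (result (prefixSums F⁻ rs)) ≡ length rs
  length-prefixSums F⁻ []       = refl
  length-prefixSums F⁻ (r ∷ rs) = cong suc (length-prefixSums _ rs)

  time-prefixSums : ∀ F⁻ rs → time (prefixSums F⁻ rs) ≤ 2 * length rs
  time-prefixSums F⁻ []       = z≤n
  time-prefixSums F⁻ (r ∷ rs) = ℕₚ.≤-trans
    (ℕₚ.+-monoʳ-≤ 2 (ℕₚ.≤-trans (ℕₚ.≤-reflexive (ℕₚ.+-identityʳ _)) (time-prefixSums _ rs)))
    (ℕₚ.≤-reflexive (sym (ℕₚ.*-suc 2 (length rs))))

  space-prefixSums : ∀ F⁻ rs → space (prefixSums F⁻ rs) ≤ 4 * length rs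
  space-prefixSums F⁻ []       = z≤n
  space-prefixSums F⁻ (r@(_ , Fₖ , _) ∷ rs) = ℕₚ.≤-trans
    (s≤s (⊔≤ (suc (space rec)) (size (list Row) (result rec) + 0)
      (s≤s (space-prefixSums _ rs))
      (ℕₚ.≤-reflexive (≡.trans (ℕₚ.+-identityʳ _) (≡.trans (size-list Row (λ _ → refl) (result rec))
        (cong (λ l → suc (4 * l)) (length-prefixSums _ rs)))))))
    (slack 2 (eq (length rs)))
    where
    rec = prefixSums (result (F⁻ ⊕ Fₖ)) rs
    eq : ∀ l → suc (suc (4 * l)) + 2 ≡ 4 * suc l
    eq = solve-∀

  time-findBoundary : ∀ C F⁻ rs → time (findBoundary C F⁻ rs) ≤ 2 * length rs
  time-findBoundary C F⁻ []       = z≤n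
  time-findBoundary C F⁻ ((F , Fₖ , k) ∷ rs) = ℕₚ.≤-trans
    (ℕₚ.+-monoʳ-≤ 2 (time-if {k = 2 * length rs} (result (F ≤ᴿ C))
      (ℕₚ.≤-trans (ℕₚ.≤-reflexive (ℕₚ.+-identityʳ _)) (time-findBoundary C F rs)) z≤n))
    (ℕₚ.≤-reflexive (sym (ℕₚ.*-suc 2 (length rs))))

  size-findBoundary : ∀ C F⁻ rs → size (list group ⊗ real ⊗ list Row) (result (findBoundary C F⁻ rs)) ≤ 3 + 4 * length rs
  size-findBoundary C F⁻ rs = ℕₚ.≤-trans
    (ℕₚ.≤-reflexive (cong₂ (λ x y → x + suc y) (size-list group (λ _ → refl) (proj₁ res)) (size-list Row (λ _ → refl) (proj₂ (proj₂ res)))))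
    (ℕₚ.≤-trans (slack (2 * length (proj₁ res)) (eq (length (proj₁ res)) (length (proj₂ (proj₂ res)))))
      (ℕₚ.≤-reflexive (cong (λ l → 3 + 4 * l) (length-findBoundary F⁻ rs))))
    where
    res = result (findBoundary C F⁻ rs)
    length-findBoundary : ∀ F⁻ rs → length (proj₁ (result (findBoundary C F⁻ rs))) + length (proj₂ (proj₂ (result (findBoundary C F⁻ rs)))) ≡ length rs
    length-findBoundary F⁻ []       = refl
    length-findBoundary F⁻ ((F , Fₖ , k) ∷ rs) with F ≤? C
    ... | yes _ = cong suc (length-findBoundary F rs)
    ... | no _  = refl
    eq : ∀ a b → suc (2 * a) + suc (suc (4 * b)) + 2 * a ≡ 3 + 4 * (a + b)
    eq = solve-∀

  space-findBoundary : ∀ C F⁻ rs → space (findBoundary C F⁻ rs) ≤ 4 + 4 * length rs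
  space-findBoundary C F⁻ []       = z≤n
  space-findBoundary C F⁻ ((F , Fₖ , k) ∷ rs) = ℕₚ.≤-trans
    (s≤s (space-if {k = 5 + 4 * length rs} (result (F ≤ᴿ C))
      (⊔≤ (suc (space (findBoundary C F rs))) (size (list group ⊗ real ⊗ list Row) (result (findBoundary C F rs)) + 0)
        (s≤s (space-findBoundary C F rs))
        (ℕₚ.≤-trans (ℕₚ.≤-reflexive (ℕₚ.+-identityʳ _)) (ℕₚ.≤-trans (size-findBoundary C F rs) (ℕₚ.m≤n+m _ 2))))
      z≤n))
    (slack 2 (eq (length rs)))
    where
    eq : ∀ l → suc (5 + 4 * l) + 2 ≡ 4 + 4 * suc l
    eq = solve-∀

-- Lists, tabulations and permutations of positions.

module _ {X : Set} where

  take-++ˡ : ∀ r (xs ys : List X) → r Nat.≤ length xs → take r (xs ++ ys) ≡ take r xs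
  take-++ˡ zero    xs       ys _       = refl
  take-++ˡ (suc r) (x ∷ xs) ys (s≤s r≤) = cong (x ∷_) (take-++ˡ r xs ys r≤)

  take-length : ∀ (xs ys : List X) → take (length xs) (xs ++ ys) ≡ xs
  take-length []       ys = refl
  take-length (x ∷ xs) ys = cong (x ∷_) (take-length xs ys)

  take-suc-length : ∀ (xs : List X) y ys → take (suc (length xs)) (xs ++ y ∷ ys) ≡ xs ++ y ∷ []
  take-suc-length []       y ys = refl
  take-suc-length (x ∷ xs) y ys = cong (x ∷_) (take-suc-length xs y ys)

  unique-++-disjoint : ∀ {xs ys : List X} {x} → Unique (xs ++ ys) → x ∈ xs → x ∈ ys → ⊥
  unique-++-disjoint {_ ∷ xs} (x≢ ∷ _) (here refl) x∈ys = All.lookup x≢ (∈-++⁺ʳ xs x∈ys) refl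
  unique-++-disjoint (_ ∷ unique) (there x∈xs) x∈ys = unique-++-disjoint unique x∈xs x∈ys

  unique-++ʳ : ∀ (xs : List X) {ys} → Unique (xs ++ ys) → Unique ys
  unique-++ʳ []       unique       = unique
  unique-++ʳ (x ∷ xs) (_ ∷ unique) = unique-++ʳ xs unique

  concat-map-↭ : ∀ {Y : Set} (f : X → List Y) {xs ys} → xs ↭ ys → concat (map f xs) ↭ concat (map f ys)
  concat-map-↭ f refl         = ↭-refl
  concat-map-↭ f (prep x p)   = ↭.++⁺ˡ (f x) (concat-map-↭ f p)
  concat-map-↭ f (swap x y p) = ↭-trans (↭.shifts (f x) (f y)) (↭.++⁺ˡ (f y) (↭.++⁺ˡ (f x) (concat-map-↭ f p)))
  concat-map-↭ f (trans p q)  = ↭-trans (concat-map-↭ f p) (concat-map-↭ f q)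

  tabulate-lookup-cast : ∀ {m} (xs : List X) (eq : m ≡ length xs) → tabulate (λ j → lookup xs (cast eq j)) ≡ xs
  tabulate-lookup-cast xs refl = ≡.trans (tabulate-cong (λ j → cong (lookup xs) (Fin.cast-is-id refl j))) (tabulate-lookup xs)

  AllPairs-tabulate : ∀ {R : X → X → Set} → (∀ x → R x x) → ∀ {m} (g : Fin m → X) → AllPairs R (tabulate g) →
                      ∀ j k → toℕ j Nat.≤ toℕ k → R (g j) (g k)
  AllPairs-tabulate R-refl g (_ ∷ _)  zero    zero    _         = R-refl (g zero)
  AllPairs-tabulate R-refl g (r ∷ _)  zero    (suc k) _         = All.lookup r (∈-tabulate⁺ k)
  AllPairs-tabulate R-refl g (_ ∷ rs) (suc j) (suc k) (s≤s j≤k) = AllPairs-tabulate R-refl (g ∘ suc) rs j k j≤k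

  -- Translates between the two views of an order: the first stage splits a list at the boundary
  -- group, whereas the specification speaks of positions before and after `k⋆`.
  tabulate-split : ∀ {m} (g : Fin m → X) xs {y ys} → tabulate g ≡ xs ++ y ∷ ys →
    ∃ λ k → toℕ k ≡ length xs × g k ≡ y × (∀ j → toℕ j Nat.< toℕ k → g j ∈ xs) × (∀ j → toℕ k Nat.< toℕ j → g j ∈ ys)
  tabulate-split {suc m} g [] eq = zero , refl , ∷-injectiveˡ eq , (λ _ ()) , λ where
    (suc j) _ → subst (g (suc j) ∈_) (∷-injectiveʳ eq) (∈-tabulate⁺ j)
  tabulate-split {suc m} g (x ∷ xs) eq with tabulate-split (g ∘ suc) xs (∷-injectiveʳ eq)
  ... | k , k≡ , gk≡ , before , after = suc k , cong suc k≡ , gk≡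
    , (λ { zero _ → here (∷-injectiveˡ eq) ; (suc j) (s≤s j<k) → there (before j j<k) })
    , (λ { (suc j) (s≤s k<j) → after j k<j })

  sum-affine : ∀ a b (f : X → ℕ) xs → sum (map (λ x → a Nat.+ b Nat.* f x) xs) ≡ a Nat.* length xs Nat.+ b Nat.* sum (map f xs)
  sum-affine a b f []       = sym (cong₂ Nat._+_ (ℕₚ.*-zeroʳ a) (ℕₚ.*-zeroʳ b))
  sum-affine a b f (x ∷ xs) = ≡.trans (cong (a Nat.+ b Nat.* f x Nat.+_) (sum-affine a b f xs)) (eq a b (f x) (length xs) (sum (map f xs)))
    where
    eq : ∀ a b y l s → a Nat.+ b Nat.* y Nat.+ (a Nat.* l Nat.+ b Nat.* s) ≡ a Nat.* suc l Nat.+ b Nat.* (y Nat.+ s)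
    eq = solve-∀

-- A permutation of lists induces a bijection of their indices, and the entry of `allFin m` at an
-- index is that index. The casts are there because both lengths equal `m` only propositionally.
order-of : ∀ {m} {os : List (Fin m)} → os ↭ allFin m → ∃ λ (order : Permutation′ m) → tabulate (order ⟨$⟩ʳ_) ≡ os
order-of {m} {os} os↭ = order , ≡.trans (tabulate-cong order≡) (tabulate-lookup-cast os m≡)
  where
  p = ↭⇒↭ₛ os↭
  m≡ : m ≡ length os
  m≡ = ≡.trans (sym (length-tabulate Function.id)) (sym (↭-length os↭))
  order : Permutation′ m
  order = cast-id m≡ ∘ₚ ↭ₛ.onIndices p ∘ₚ cast-id (length-tabulate Function.id)
  e : length (allFin m) ≡ m
  e = length-tabulate Function.id
  -- `lookup-tabulate` speaks of positions cast back from `Fin m`, so a plain index must first be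
  -- brought into that form.
  round-trip : ∀ k → cast (sym e) (cast e k) ≡ k
  round-trip = Fin.cast-involutive (sym e) e
  lookup-allFin : ∀ k → lookup (allFin m) k ≡ cast e k
  lookup-allFin k = ≡.trans (cong (lookup (allFin m)) (sym (round-trip k))) (lookup-tabulate {n = m} Function.id (cast e k))
  order≡ : ∀ j → order ⟨$⟩ʳ j ≡ lookup os (cast m≡ j)
  order≡ j = ≡.trans (sym (lookup-allFin _)) (sym (↭ₛ.onIndices-lookup (≡.setoid (Fin m)) p (cast m≡ j)))

-- Contents of the output array after the second stage.

module Writes {F : OrderedField} {n m : ℕ} (I : Instance F n m) where
  open Run I

  module _ {A X : Set} {next : A → X → A} {body : A → X → Output → Output} {i : Fin n} {P : X → Set} where

    loopOutput-keeps : (∀ a x z → ¬ P x → body a x z i ≡ z i) →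
                       ∀ a xs z → All (λ x → ¬ P x) xs → loopOutput next body a xs z i ≡ z i
    loopOutput-keeps keeps a []       z []        = refl
    loopOutput-keeps keeps a (x ∷ xs) z (¬p ∷ ¬ps) = ≡.trans (loopOutput-keeps keeps (next a x) xs (body a x z) ¬ps) (keeps a x z ¬p)

    -- The last round that touches `i` decides its final value, so the induction first asks whether
    -- the tail still touches it. Decidability of `P` is what makes that question answerable.
    loopOutput-writes : ∀ {y} → (∀ x → Dec (P x)) → (∀ a x z → P x → body a x z i ≡ y) → (∀ a x z → ¬ P x → body a x z i ≡ z i) →
                        ∀ a xs z → Any P xs → loopOutput next body a xs z i ≡ y
    loopOutput-writes P? writes keeps a (x ∷ xs) z p with any? P? xs
    ... | yes ps = loopOutput-writes P? writes keeps (next a x) xs (body a x z) ps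
    ... | no ¬ps with p
    ... | here px  = ≡.trans (loopOutput-keeps keeps (next a x) xs (body a x z) (All.¬Any⇒All¬ xs ¬ps)) (writes a x z px)
    ... | there ps = ⊥-elim (¬ps ps)

module Filling {F : OrderedField} {n m : ℕ} (I : Instance F n m) where
  open OrderedField F
  open OrderedFieldProperties F
  private module I = Instance I
  open Machine Carrier I.Point n m
  open Run I
  open Algorithms Carrier I.Point n m using (Row; Locator; saturate; clear; solveWaterLevel; fill)
  open Purity I
  open Writes I
  open DecMembership (Fin._≟_ {n}) using (_∈?_)

  module _ {A : Set} {next : A → Fin n → A} {f : A → Fin n → Carrier} {v : Fin n → Carrier} (f≡v : ∀ a j → f a j ≡ v j) (i : Fin n) where

    private
      body : A → Fin n → Output → Output
      body a j z = updateAt z j (const (f a j))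

      body-writes : ∀ a j z → i ≡ j → body a j z i ≡ v i
      body-writes a j z refl = ≡.trans (updateAt-updates i z) (f≡v a i)

      body-keeps : ∀ a j z → ¬ (i ≡ j) → body a j z i ≡ z i
      body-keeps a j z i≢j = updateAt-minimal i j z i≢j

    items-written : ∀ a is z → i ∈ is → loopOutput next body a is z i ≡ v i
    items-written = loopOutput-writes (i Fin.≟_) body-writes body-keeps

    items-kept : ∀ a is z → i ∉ is → loopOutput next body a is z i ≡ z i
    items-kept a is z i∉ = loopOutput-keeps body-keeps a is z (All.¬Any⇒All¬ is i∉)

  saturate-written : ∀ {i} k z → i ∈ I.members k → output (saturate k) z i ≡ I.ceiling i
  saturate-written {i} k z = items-written (λ _ _ → refl) i tt (I.members k) z

  saturate-kept : ∀ {i} k z → i ∉ I.members k → output (saturate k) z i ≡ z i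
  saturate-kept {i} k z = items-kept (λ _ _ → refl) i tt (I.members k) z

  clear-written : ∀ {i} k z → i ∈ I.members k → output (clear k) z i ≡ 0#
  clear-written {i} k z = items-written (λ _ _ → refl) i tt (I.members k) z

  clear-kept : ∀ {i} k z → i ∉ I.members k → output (clear k) z i ≡ z i
  clear-kept {i} k z = items-kept (λ _ _ → refl) i tt (I.members k) z

  module _ {locate : Locator} (pure-locate : ∀ c bs → Pure (locate c bs))
           (C : Carrier) (ks : List (Fin m)) (F⁻ Fₖ FΓ : Carrier) (k⋆ : Fin m) (rs : List ⟦ Row ⟧) (z : Output) (i : Fin n) where

    private
      Γ = I.members k⋆
      ζ = result (solveWaterLevel locate Γ FΓ (C - F⁻))
      z₁ = output (loop group ks tt (λ _ k → saturate k)) z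
      z₂ = output (loop Row rs tt (λ _ r → clear (proj₂ (proj₂ r)))) z₁
      z₃ = output (solveWaterLevel locate Γ FΓ (C - F⁻)) z₂
      filled = output (fill locate C ks F⁻ ((Fₖ , FΓ , k⋆) ∷ rs)) z

      z₃≡z₂ : z₃ i ≡ z₂ i
      z₃≡z₂ = cong (λ z → z i) (preserves (pure-solveWaterLevel pure-locate Γ FΓ (C - F⁻)) z₂)

      level≡ : ∀ j → (if does (I.ceiling j ≤? ζ) then I.ceiling j else ζ) ≡ I.ceiling j ⊓ ζ
      level≡ j with I.ceiling j ≤? ζ
      ... | yes u≤ζ = sym (x≤y⇒x⊓y≈x u≤ζ)
      ... | no u≰ζ  = sym (x≤y⇒y⊓x≈x (<⇒≤ (≰⇒> u≰ζ)))

      kept : i ∉ Γ → filled i ≡ z₂ i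
      kept i∉Γ = ≡.trans (items-kept {next = λ _ _ → tt} (λ _ → level≡) i tt Γ z₃ i∉Γ) z₃≡z₂

    -- The writes come in the order saturate, clear, boundary. A later phase overrides an earlier
    -- one, so each of these three lemmas assumes disjointness from exactly the phases after its
    -- own.
    fill-boundary : i ∈ Γ → filled i ≡ I.ceiling i ⊓ ζ
    fill-boundary = items-written {next = λ _ _ → tt} (λ _ → level≡) i tt Γ z₃

    fill-after : i ∉ Γ → Any (λ r → i ∈ I.members (proj₂ (proj₂ r))) rs → filled i ≡ 0#
    fill-after i∉Γ i∈ = ≡.trans (kept i∉Γ)
      (loopOutput-writes {i = i} {λ r → i ∈ I.members (proj₂ (proj₂ r))} (λ r → i ∈? I.members (proj₂ (proj₂ r)))
        (λ _ r → clear-written (proj₂ (proj₂ r))) (λ _ r → clear-kept (proj₂ (proj₂ r))) tt rs z₁ i∈)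

    fill-before : i ∉ Γ → All (λ r → i ∉ I.members (proj₂ (proj₂ r))) rs → Any (λ k → i ∈ I.members k) ks → filled i ≡ I.ceiling i
    fill-before i∉Γ i∉rs i∈ks = ≡.trans (kept i∉Γ) (≡.trans
      (loopOutput-keeps {i = i} {λ r → i ∈ I.members (proj₂ (proj₂ r))} (λ _ r → clear-kept (proj₂ (proj₂ r))) tt rs z₁ i∉rs)
      (loopOutput-writes {i = i} {λ k → i ∈ I.members k} (λ k → i ∈? I.members k)
        (λ _ → saturate-written) (λ _ → saturate-kept) tt ks z i∈ks))

-- Summing up time and space of the whole program.

module _ where
  open Nat using (_+_; _*_; _≤_)

  program-time-bound : ∀ {m n a b p q g r s f z A T} → a + suc b ≡ m → p + (g + q) ≡ n → 1 ≤ m → m ≤ n →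
    r ≤ 8 * m + 5 * n → s ≤ 2 * m → f ≤ 2 * m →
    z ≤ suc (3 * a + 3 * p) + (suc (3 * b + 3 * q) + (2 + (3 + (3 * g + T) + suc (4 * g)))) →
    suc (r + (A + suc (s + (f + z)))) ≤ 37 * n + (A + T)
  program-time-bound {m} {n} {a} {b} {p} {q} {g} {r} {s} {f} {z} {A} {T} refl refl h₁ h₂ t₁ t₂ t₃ t₄ =
    -- The work per group is 15, and the constants amount to 7, charged to groups by `1 ≤ m`. The
    -- resulting `22 * m` is charged to items by `m ≤ n`; the work per item accounts for the rest of
    -- 37.
    lin (3 * g + 7 * p + 7 * q) (7 *≤ h₁ +≤ 22 *≤ h₂ +≤ t₁ +≤ t₂ +≤ t₃ +≤ t₄) (eq a b p q g r s f z A T)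
    where
    eq : ∀ a b p q g r s f z A T →
      suc (r + (A + suc (s + (f + z))))
        + (7 * (a + suc b) + 22 * (p + (g + q)) + (8 * (a + suc b) + 5 * (p + (g + q))) + 2 * (a + suc b) + 2 * (a + suc b)
          + (suc (3 * a + 3 * p) + (suc (3 * b + 3 * q) + (2 + (3 + (3 * g + T) + suc (4 * g))))))
        + (3 * g + 7 * p + 7 * q)
      ≡ 37 * (p + (g + q)) + (A + T) + (7 * 1 + 22 * (a + suc b) + r + s + f + z)
    eq = solve-∀

  -- The program has a fixed number of stages, so replacing maxima by sums costs a constant factor
  -- only and makes the space bound linear.
  ⊔-chain≤+-chain : ∀ {s₁ s₂ s₃ s₄ s₅ z₁ z₂ z₃ z₄} →
    suc (suc s₁ ⊔ (z₁ + (suc s₂ ⊔ (z₂ + suc (suc s₃ ⊔ (z₃ + (suc s₄ ⊔ (z₄ + s₅))))))))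
    ≤ suc (suc s₁ + (z₁ + (suc s₂ + (z₂ + suc (suc s₃ + (z₃ + (suc s₄ + (z₄ + s₅))))))))
  ⊔-chain≤+-chain {s₁} {s₂} {s₃} {s₄} {s₅} {z₁} {z₂} {z₃} {z₄} = s≤s (⊔⇒+ (suc s₁) (ℕₚ.+-monoʳ-≤ z₁ (⊔⇒+ (suc s₂) (ℕₚ.+-monoʳ-≤ z₂
    (s≤s (⊔⇒+ (suc s₃) (ℕₚ.+-monoʳ-≤ z₃ (⊔⇒+ (suc s₄) ℕₚ.≤-refl))))))))
    where
    ⊔⇒+ : ∀ x {y y′} → y ≤ y′ → x ⊔ y ≤ x + y′
    ⊔⇒+ x {y} y≤ = ℕₚ.≤-trans (ℕₚ.m⊔n≤m+n x y) (ℕₚ.+-monoʳ-≤ x y≤)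

  program-space-bound : ∀ {m g s₁ A s₃ s₄ s₅ z₁ z₂ z₃ z₄ L} → 1 ≤ m → s₁ ≤ 14 * m → s₃ ≤ 4 * m → s₄ ≤ 4 + 4 * m →
    s₅ ≤ 28 + (3 * g + L) → z₁ ≡ suc (4 * m) → z₂ ≡ suc (4 * m) → z₃ ≡ suc (4 * m) → z₄ ≤ 3 + 4 * m →
    suc (suc s₁ + (z₁ + (suc A + (z₂ + suc (suc s₃ + (z₃ + (suc s₄ + (z₄ + s₅)))))))) ≤ 82 * (m + g) + (A + L)
  program-space-bound {m} {g} {s₁} {A} {s₃} {s₄} {s₅} {z₄ = z₄} {L} h s₁≤ s₃≤ s₄≤ s₅≤ refl refl refl z₄≤ =
    -- The stages and the lists between them take 38 words per group; the constants sum to 44 and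
    -- are absorbed through `1 ≤ m`. Together this is 82.
    lin (79 * g) (44 *≤ h +≤ s₁≤ +≤ s₃≤ +≤ s₄≤ +≤ s₅≤ +≤ z₄≤) (eq m g s₁ A s₃ s₄ s₅ z₄ L)
    where
    eq : ∀ m g s₁ A s₃ s₄ s₅ z₄ L →
      suc (suc s₁ + (suc (4 * m) + (suc A + (suc (4 * m) + suc (suc s₃ + (suc (4 * m) + (suc s₄ + (z₄ + s₅))))))))
        + (44 * m + 14 * m + 4 * m + (4 + 4 * m) + (28 + (3 * g + L)) + (3 + 4 * m)) + 79 * g
      ≡ 82 * (m + g) + (A + L) + (44 * 1 + s₁ + s₃ + s₄ + s₅ + z₄)
    eq = solve-∀

module FillingCost {F : OrderedField} {n m : ℕ} (I : Instance F n m) where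
  open OrderedField F using (Carrier; _-_; _<_)
  private module I = Instance I
  open Machine Carrier I.Point n m
  open Run I
  open Algorithms Carrier I.Point n m using (Row; Locator; breakpoints; saturate; clear; solveWaterLevel; fill)
  open Programs I
  open WaterLevelCost I
  open FirstStageCost I
  open Nat using (_+_; _*_; _≤_)

  time-saturate : ∀ k → time (saturate k) ≤ 2 + 3 * length (I.members k)
  time-saturate k = s≤s (loopTime-const {k = 2} (λ _ _ → ℕₚ.≤-refl) tt (I.members k))

  time-clear : ∀ k → time (clear k) ≤ 2 + 3 * length (I.members k)
  time-clear k = s≤s (loopTime-const {k = 2} (λ _ _ → ℕₚ.≤-refl) tt (I.members k))

  space-saturate : ∀ k → space (saturate k) ≤ 4
  space-saturate k = s≤s (loopSpace-const {words = λ _ → 1} {k = 3} (λ _ _ → ℕₚ.≤-refl) tt (I.members k))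

  space-clear : ∀ k → space (clear k) ≤ 4
  space-clear k = s≤s (loopSpace-const {words = λ _ → 1} {k = 3} (λ _ _ → ℕₚ.≤-refl) tt (I.members k))

  groups : List ⟦ Row ⟧ → List (Fin m)
  groups = map (λ r → proj₂ (proj₂ r))

  module _ (locate : Locator) (C : Carrier) (ks : List (Fin m)) (F⁻ Fₖ FΓ : Carrier) (k⋆ : Fin m) (rs : List ⟦ Row ⟧)
           (c<FΓ : (C - F⁻) < FΓ) where

    private
      Γ = I.members k⋆
      c = C - F⁻
      g = length Γ

      clearing : Prog unit
      clearing = loop Row rs tt λ _ r → clear (proj₂ (proj₂ r))

      saturating : Prog unit
      saturating = loop group ks tt λ _ k → saturate k

      time-saturating : time saturating ≤ suc (3 * length ks + 3 * total ks)
      time-saturating = ℕₚ.≤-trans (loopTime-≤ {f = λ k → 2 + 3 * length (I.members k)} (λ _ → time-saturate) tt ks)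
        (s≤s (ℕₚ.≤-reflexive (sum-affine 3 3 (length ∘ I.members) ks)))

      time-clearing : time clearing ≤ suc (3 * length rs + 3 * total (groups rs))
      time-clearing = ℕₚ.≤-trans (loopTime-≤ {f = λ r → 2 + 3 * length (I.members (proj₂ (proj₂ r)))} (λ _ r → time-clear (proj₂ (proj₂ r))) tt rs)
        (s≤s (ℕₚ.≤-reflexive (≡.trans (sum-affine 3 3 (λ r → length (I.members (proj₂ (proj₂ r)))) rs)
          (cong (λ ls → 3 * length rs + 3 * sum ls) (map-∘ rs)))))

    time-fill : time (fill locate C ks F⁻ ((Fₖ , FΓ , k⋆) ∷ rs))
                ≤ suc (3 * length ks + 3 * total ks) + (suc (3 * length rs + 3 * total (groups rs)) +
                  (2 + (3 + (3 * g + time (locate c (result (breakpoints Γ)))) + suc (4 * g))))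
    time-fill = time-saturating +≤ (time-clearing +≤ s≤s (s≤s (time-solveWaterLevel locate Γ c<FΓ +≤
      loopTime-const {k = 3} (λ _ _ → ℕₚ.≤-refl) tt Γ)))

    space-fill : space (fill locate C ks F⁻ ((Fₖ , FΓ , k⋆) ∷ rs)) ≤ 28 + (3 * g + space (locate c (result (breakpoints Γ))))
    space-fill = ⊔≤ (suc (space saturating)) (suc (suc (space clearing) ⊔ suc inner))
      (ℕₚ.≤-trans (s≤s (loopSpace-const {words = λ _ → 1} {k = 6} (λ _ k → s≤s (s≤s (space-saturate k))) tt ks)) (ℕₚ.m≤m+n 7 _))
      (s≤s (⊔≤ (suc (space clearing)) (suc inner)
        (ℕₚ.≤-trans (s≤s (loopSpace-const {words = λ _ → 1} {k = 6} (λ _ r → s≤s (s≤s (space-clear (proj₂ (proj₂ r))))) tt rs)) (ℕₚ.m≤m+n 7 _))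
        (s≤s (s≤s (s≤s (⊔≤ (suc (space solving)) (suc (space writing))
          (ℕₚ.≤-trans (s≤s (space-solveWaterLevel locate Γ c<FΓ)) (ℕₚ.m≤n+m _ 19))
          (s≤s (ℕₚ.≤-trans (loopSpace-const {words = λ _ → 1} {k = 4} (λ _ _ → ℕₚ.≤-refl) tt Γ) (ℕₚ.m≤m+n 4 _)))))))))
      where
      solving = solveWaterLevel locate Γ FΓ c
      writing : Prog unit
      writing = loop item Γ tt λ _ i → ceiling i >>= λ u → (u ≤ᴿ result solving) >>= λ b → write i (if b then u else result solving)
        where open import Data.Bool using (if_then_else_)
      inner = suc (suc (suc (space solving) ⊔ suc (space writing)))

-- The program for an arbitrary arrangement of the groups.

module Assembly {F : OrderedField} {n m : ℕ} (I : Instance F n m) where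
  open OrderedField F
  open OrderedFieldProperties F
  open SemiringSolver commutativeSemiring using (solve; _:=_; _:+_)
  private module I = Instance I
  open I using (mass)
  open Allocation I
  open Machine Carrier I.Point n m
  open Run I
  open Algorithms Carrier I.Point n m using (Row; Locator; rows; prefixSums; findBoundary; breakpoints; solveWaterLevel; fill; groupedKnapsack)
  open Programs I using (size-list)
  open LocatorCorrectness I using (Locates)
  open Purity I using (Pure)
  open WaterLevelSolver I
  open FirstStage I
  open FirstStageCost I
  open Filling I
  open FillingCost I

  length-allFin : ∀ k → length (allFin k) ≡ k
  length-allFin k = length-tabulate {n = k} Function.id

  ∑-concat-map : ∀ {X Y : Set} (f : X → List Y) (h : Y → Carrier) xs → ∑ (concat (map f xs)) h ≡ ∑ xs (λ x → ∑ (f x) h)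
  ∑-concat-map f h []       = refl
  ∑-concat-map f h (x ∷ xs) = ≡.trans (∑-++ (f x) (concat (map f xs)) h) (cong (∑ (f x) h +_) (∑-concat-map f h xs))

  members-↭ : ∀ {os} → os ↭ allFin m → concat (map I.members os) ↭ allFin n
  members-↭ os↭ = ↭-trans (concat-map-↭ I.members os↭)
    (↭-trans (↭-reflexive (cong concat (map-tabulate Function.id I.members))) I.partition)

  -- The three programs differ only in `arrange` and `locate`, so one analysis serves all of them:
  -- `arrange` has to return the rows of some permutation `os` of the groups. The ratios enter
  -- later, together with `order`.
  module Arranged (arrange : List ⟦ Row ⟧ → Prog (list Row)) {locate : Locator} (locates : Locates locate)
                  (pure-locate : ∀ c bs → Pure (locate c bs)) {os : List (Fin m)} (os↭ : os ↭ allFin m)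
                  (arranged : result (arrange (result (rows (allFin m)))) ≡ map row os) where

    total-mass : ∑ os M ≡ mass (allFin n)
    total-mass = ≡.trans (sym (∑-concat-map I.members _ os)) (∑-↭ _ (members-↭ os↭))

    -- In every order the group masses add up to the mass of all items, which exceeds the budget;
    -- hence a boundary group exists, and there is at least one group.
    B : Boundary I.budget 0# os
    B = boundary os I.0≤budget (subst (I.budget <_) (sym (≡.trans (+-identityˡ _) total-mass)) I.budget<mass)

    open Boundary B

    F⋆ c : Carrier
    F⋆ = 0# + ∑ before M
    c = I.budget - F⋆

    Γ : List (Fin n)
    Γ = I.members k⋆

    0≤c : 0# ≤ c
    0≤c = 0≤y-x (subst (λ ks → 0# + ∑ ks M ≤ I.budget) take-before (fits (length before)))
      where
      take-before : take (length before) before ≡ before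
      take-before = ≡.trans (sym (take-++ˡ (length before) before [] ℕₚ.≤-refl)) (take-length before [])

    c<M : c < M k⋆
    c<M = <-from exceeds (≡.trans
      (solve 3 (λ c F M → c :+ (F :+ M) := M :+ (c :+ F)) refl c F⋆ (M k⋆))
      (cong (M k⋆ +_) (x-y+y≡x I.budget F⋆)))

    ζ : Carrier
    ζ = result (solveWaterLevel locate Γ (M k⋆) c)

    level-ζ : IsWaterLevel Γ c ζ
    level-ζ = solveWaterLevel-level {locate} locates Γ refl 0≤c c<M

    rs₀ rs₁ ps : List ⟦ Row ⟧
    rs₀ = result (rows (allFin m))
    rs₁ = result (arrange rs₀)
    ps = result (prefixSums 0# rs₁)

    ps≡ : ps ≡ summed 0# os
    ps≡ = ≡.trans (cong (λ rs → result (prefixSums 0# rs)) arranged) (result-prefixSums 0# os)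

    res : ⟦ list group ⊗ real ⊗ list Row ⟧
    res = result (findBoundary I.budget 0# ps)

    res≡ : res ≡ (before , F⋆ , summed F⋆ (k⋆ ∷ after))
    res≡ = ≡.trans (cong (λ ps → result (findBoundary I.budget 0# ps)) ps≡) found

    fillFrom : ⟦ list group ⊗ real ⊗ list Row ⟧ → Prog unit
    fillFrom (ks , F⁻ , rs⋆) = fill locate I.budget ks F⁻ rs⋆

    program : Prog unit
    program = groupedKnapsack arrange locate

    -- What earlier stages write is irrelevant: fill overwrites every item.
    output-program : ∀ z₀ → ∃ λ z → output program z₀ ≡ output (fillFrom (before , F⋆ , summed F⋆ (k⋆ ∷ after))) z
    output-program z₀ = z , cong (λ r → output (fillFrom r) z) res≡
      where
      z = output (findBoundary I.budget 0# ps) (output (prefixSums 0# rs₁) (output (arrange rs₀) (output (rows (allFin m)) z₀)))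

    items↭ : concat (map I.members before) ++ (Γ ++ concat (map I.members after)) ↭ allFin n
    items↭ = ↭-trans (↭-reflexive (≡.trans (concat-++ (map I.members before) (map I.members (k⋆ ∷ after)))
      (cong concat (sym (map-++ I.members before (k⋆ ∷ after))))))
      (subst (λ os → concat (map I.members os) ↭ allFin n) split (members-↭ os↭))

    -- Transported from `allFin n` along the partition. All disjointness statements about groups
    -- below are read off from it.
    items-unique : Unique (concat (map I.members before) ++ (Γ ++ concat (map I.members after)))
    items-unique = ↭ₛ.Unique-resp-↭ (≡.setoid (Fin n)) (↭⇒↭ₛ (↭-sym items↭)) (allFin⁺ n)

    ∈-concat-map : ∀ {i k ks} → i ∈ I.members k → k ∈ ks → i ∈ concat (map I.members ks)
    ∈-concat-map i∈ k∈ = ∈-concat⁺′ i∈ (∈-map⁺ I.members k∈)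

    before-disjoint-Γ : ∀ {i k} → k ∈ before → i ∈ I.members k → i ∉ Γ
    before-disjoint-Γ k∈ i∈ i∈Γ = unique-++-disjoint items-unique (∈-concat-map i∈ k∈) (∈-++⁺ˡ i∈Γ)

    before-disjoint-after : ∀ {i k l} → k ∈ before → i ∈ I.members k → l ∈ after → i ∉ I.members l
    before-disjoint-after k∈ i∈ l∈ i∈l = unique-++-disjoint items-unique (∈-concat-map i∈ k∈) (∈-++⁺ʳ Γ (∈-concat-map i∈l l∈))

    after-disjoint-Γ : ∀ {i k} → k ∈ after → i ∈ I.members k → i ∉ Γ
    after-disjoint-Γ k∈ i∈ i∈Γ = unique-++-disjoint (unique-++ʳ (concat (map I.members before)) items-unique) i∈Γ (∈-concat-map i∈ k∈)

    after-rows : List ⟦ Row ⟧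
    after-rows = summed (F⋆ + M k⋆) after

    groups-after : groups after-rows ≡ after
    groups-after = map-group-summed (F⋆ + M k⋆) after

    module _ (order : Permutation′ m) (os≡ : tabulate (order ⟨$⟩ʳ_) ≡ os) (nonIncreasing : NonIncreasing order)
             (z₀ : Fin n → Carrier) where

      private
        z = proj₁ (output-program z₀)

        output≡ : ∀ i → output program z₀ i ≡ output (fillFrom (before , F⋆ , summed F⋆ (k⋆ ∷ after))) z i
        output≡ i = cong (λ z → z i) (proj₂ (output-program z₀))

        position = tabulate-split (order ⟨$⟩ʳ_) before (≡.trans os≡ split)
        j⋆ = proj₁ position
        j⋆≡ : toℕ j⋆ ≡ length before
        j⋆≡ = proj₁ (proj₂ position)
        order-j⋆ : order ⟨$⟩ʳ j⋆ ≡ k⋆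
        order-j⋆ = proj₁ (proj₂ (proj₂ position))
        earlier = proj₁ (proj₂ (proj₂ (proj₂ position)))
        later = proj₂ (proj₂ (proj₂ (proj₂ position)))

        Γ≡ : groupAt order j⋆ ≡ Γ
        Γ≡ = cong I.members order-j⋆

        prefix≡ : ∀ r → prefix order r ≡ ∑ (take r os) M
        prefix≡ r = begin
          ∑ (take r (tabulate (groupAt order))) mass
            ≡⟨ cong (λ ls → ∑ (take r ls) mass) (≡.trans (sym (map-tabulate (order ⟨$⟩ʳ_) I.members)) (cong (map I.members) os≡)) ⟩
          ∑ (take r (map I.members os)) mass
            ≡⟨ cong (λ ls → ∑ ls mass) (take-map r os) ⟩
          ∑ (map I.members (take r os)) mass
            ≡⟨ ∑-map I.members mass (take r os) ⟩
          ∑ (take r os) M ∎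
          where open ≡.≡-Reasoning

        prefix-j⋆ : prefix order (toℕ j⋆) ≡ F⋆
        prefix-j⋆ = ≡.trans (prefix≡ (toℕ j⋆)) (≡.trans
          (cong (λ ks → ∑ ks M) (≡.trans (cong₂ take j⋆≡ split) (take-length before (k⋆ ∷ after))))
          (sym (+-identityˡ _)))

        prefix-suc-j⋆ : prefix order (suc (toℕ j⋆)) ≡ F⋆ + M k⋆
        prefix-suc-j⋆ = begin
          prefix order (suc (toℕ j⋆))           ≡⟨ prefix≡ (suc (toℕ j⋆)) ⟩
          ∑ (take (suc (toℕ j⋆)) os) M          ≡⟨ cong (λ ks → ∑ ks M) (≡.trans (cong₂ (λ j os → take (suc j) os) j⋆≡ split) (take-suc-length before k⋆ after)) ⟩
          ∑ (before ++ k⋆ ∷ []) M               ≡⟨ ∑-++ before (k⋆ ∷ []) M ⟩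
          ∑ before M + (M k⋆ + 0#)              ≡⟨ cong₂ _+_ (sym (+-identityˡ _)) (+-identityʳ (M k⋆)) ⟩
          F⋆ + M k⋆                             ∎
          where open ≡.≡-Reasoning

      isGroupedAllocation : IsGroupedAllocation order (output program z₀)
      isGroupedAllocation = record
        { sorted   = nonIncreasing
        ; k⋆       = j⋆
        ; exceeds  = subst (I.budget <_) (sym prefix-suc-j⋆) exceeds
        ; minimal  = λ j j<j⋆ C<prefix → <⇒≱ C<prefix (≤-trans (≤-reflexive (prefix-early j j<j⋆)) (fits (suc (toℕ j))))
        ; ζ⋆       = ζ
        ; level    = subst₂ (λ S c → IsWaterLevel S c ζ) (sym Γ≡) (cong (λ F → I.budget - F) (sym prefix-j⋆)) level-ζ
        ; before   = λ j j<j⋆ i i∈ → ≡.trans (output≡ i)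
            (fill-before pure-locate I.budget before F⋆ (F⋆ + M k⋆) (M k⋆) k⋆ after-rows z i
              (before-disjoint-Γ (earlier j j<j⋆) i∈)
              (All.map⁻ (subst (All (λ l → i ∉ I.members l)) (sym groups-after)
                (All.tabulate (before-disjoint-after (earlier j j<j⋆) i∈))))
              (lose (earlier j j<j⋆) i∈))
        ; after    = λ j j⋆<j i i∈ → ≡.trans (output≡ i)
            (fill-after pure-locate I.budget before F⋆ (F⋆ + M k⋆) (M k⋆) k⋆ after-rows z i
              (after-disjoint-Γ (later j j⋆<j) i∈)
              (Any.map⁻ (subst (Any (λ l → i ∈ I.members l)) (sym groups-after) (lose (later j j⋆<j) i∈))))
        ; boundary = λ i i∈ → ≡.trans (output≡ i)
            (fill-boundary pure-locate I.budget before F⋆ (F⋆ + M k⋆) (M k⋆) k⋆ after-rows z i (subst (i ∈_) Γ≡ i∈))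
        }
        where
        prefix-early : ∀ j → toℕ j Nat.< toℕ j⋆ → prefix order (suc (toℕ j)) ≡ 0# + ∑ (take (suc (toℕ j)) before) M
        prefix-early j j<j⋆ = ≡.trans (prefix≡ (suc (toℕ j))) (≡.trans
          (cong (λ ks → ∑ ks M) (≡.trans (cong (take (suc (toℕ j))) split)
            (take-++ˡ (suc (toℕ j)) before (k⋆ ∷ after) (subst (suc (toℕ j) Nat.≤_) j⋆≡ j<j⋆))))
          (sym (+-identityˡ _)))

      ∣Γ∣≡ : ∣Γ∣ isGroupedAllocation ≡ length Γ
      ∣Γ∣≡ = cong length Γ≡

    open Nat using () renaming (_+_ to _+ₙ_; _*_ to _*ₙ_; _≤_ to _≤ₙ_)

    private
      m≡ : length before +ₙ suc (length after) ≡ m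
      m≡ = ≡.trans (sym (length-++ before)) (≡.trans (cong length (sym split)) (≡.trans (↭-length os↭) (length-allFin _)))

      total-concat : ∀ ks → total ks ≡ length (concat (map I.members ks))
      total-concat []       = refl
      total-concat (k ∷ ks) = ≡.trans (cong (length (I.members k) +ₙ_) (total-concat ks)) (sym (length-++ (I.members k)))

      total≡ : total (allFin m) ≡ n
      total≡ = ≡.trans (total-concat (allFin m)) (≡.trans (↭-length (members-↭ ↭-refl)) (length-allFin _))

      n≡ : total before +ₙ (length Γ +ₙ total after) ≡ n
      n≡ = ≡.trans (cong₂ _+ₙ_ (total-concat before) (cong (length Γ +ₙ_) (total-concat after)))
        (≡.trans (sym (≡.trans (length-++ (concat (map I.members before))) (cong (length (concat (map I.members before)) +ₙ_) (length-++ Γ))))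
          (≡.trans (↭-length items↭) (length-allFin _)))

      length≤total : ∀ ks → length ks ≤ₙ total ks
      length≤total []       = z≤n
      length≤total (k ∷ ks) = ℕₚ.+-mono-≤ (1≤length (I.members k) (I.nonempty k)) (length≤total ks)
        where
        1≤length : ∀ is → is ≢ [] → 1 ≤ₙ length is
        1≤length []      is≢[] = ⊥-elim (is≢[] refl)
        1≤length (_ ∷ _) _     = s≤s z≤n

      length-rs₁ : length rs₁ ≡ m
      length-rs₁ = ≡.trans (cong length arranged) (≡.trans (length-map row os) (≡.trans (↭-length os↭) (length-allFin _)))

      length-rs₀ : length rs₀ ≡ m
      length-rs₀ = ≡.trans (length-rows (allFin m)) (length-allFin _)

      length-ps : length ps ≡ m
      length-ps = ≡.trans (length-prefixSums 0# rs₁) length-rs₁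

      length-summed : ∀ F ks → length (summed F ks) ≡ length ks
      length-summed F []       = refl
      length-summed F (k ∷ ks) = cong suc (length-summed (F + M k) ks)

    1≤m : 1 ≤ₙ m
    1≤m = ℕₚ.≤-trans (s≤s z≤n) (ℕₚ.≤-trans (ℕₚ.m≤n+m (suc (length after)) (length before)) (ℕₚ.≤-reflexive m≡))

    m≤n : m ≤ₙ n
    m≤n = subst₂ _≤ₙ_ (length-allFin m) total≡ (length≤total (allFin m))

    Γ≤n : length Γ ≤ₙ n
    Γ≤n = ℕₚ.≤-trans (ℕₚ.≤-trans (ℕₚ.m≤m+n _ _) (ℕₚ.m≤n+m _ (total before))) (ℕₚ.≤-reflexive n≡)

    bs : List (Carrier × Carrier)
    bs = result (breakpoints Γ)

    time-program : time program ≤ₙ 37 *ₙ n +ₙ (time (arrange rs₀) +ₙ time (locate c bs))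
    time-program = program-time-bound {m} {n} {length before} {length after} {total before} {total after} {length Γ}
      m≡ n≡ 1≤m m≤n
      (subst₂ (λ l t → time (rows (allFin m)) ≤ₙ 8 *ₙ l +ₙ 5 *ₙ t) (length-allFin m) total≡ (time-rows (allFin m)))
      (subst (λ l → time (prefixSums 0# rs₁) ≤ₙ 2 *ₙ l) length-rs₁ (time-prefixSums 0# rs₁))
      (subst (λ l → time (findBoundary I.budget 0# ps) ≤ₙ 2 *ₙ l) length-ps (time-findBoundary I.budget 0# ps))
      -- The bound for `fill` needs a visibly nonempty list of rows, so the computed triple is first
      -- replaced by the one exhibited in `res≡`.
      (subst₂ (λ r ks → time (fillFrom r) ≤ₙ suc (3 *ₙ length before +ₙ 3 *ₙ total before) +ₙ
          (suc (3 *ₙ length after +ₙ 3 *ₙ total ks) +ₙ (2 +ₙ (3 +ₙ (3 *ₙ length Γ +ₙ time (locate c bs)) +ₙ suc (4 *ₙ length Γ)))))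
        (sym res≡) groups-after
        (subst (λ l → time (fillFrom (before , F⋆ , summed F⋆ (k⋆ ∷ after))) ≤ₙ suc (3 *ₙ length before +ₙ 3 *ₙ total before) +ₙ
          (suc (3 *ₙ l +ₙ 3 *ₙ total (groups after-rows)) +ₙ (2 +ₙ (3 +ₙ (3 *ₙ length Γ +ₙ time (locate c bs)) +ₙ suc (4 *ₙ length Γ)))))
          (length-summed (F⋆ + M k⋆) after)
          (time-fill locate I.budget before F⋆ (F⋆ + M k⋆) (M k⋆) k⋆ after-rows c<M)))
    space-program : space program ≤ₙ 82 *ₙ (m +ₙ length Γ) +ₙ (space (arrange rs₀) +ₙ space (locate c bs))
    space-program = ℕₚ.≤-trans
      (⊔-chain≤+-chain {space (rows (allFin m))} {space (arrange rs₀)} {space (prefixSums 0# rs₁)} {space (findBoundary I.budget 0# ps)} {space (fillFrom res)}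
                 {size (list Row) rs₀} {size (list Row) rs₁} {size (list Row) ps} {size (list group ⊗ real ⊗ list Row) res})
      (program-space-bound {m} {length Γ} 1≤m
        (subst (λ l → space (rows (allFin m)) ≤ₙ 14 *ₙ l) (length-allFin m) (space-rows (allFin m)))
        (subst (λ l → space (prefixSums 0# rs₁) ≤ₙ 4 *ₙ l) length-rs₁ (space-prefixSums 0# rs₁))
        (subst (λ l → space (findBoundary I.budget 0# ps) ≤ₙ 4 +ₙ 4 *ₙ l) length-ps (space-findBoundary I.budget 0# ps))
        (subst (λ r → space (fillFrom r) ≤ₙ 28 +ₙ (3 *ₙ length Γ +ₙ space (locate c bs))) (sym res≡)
          (space-fill locate I.budget before F⋆ (F⋆ + M k⋆) (M k⋆) k⋆ after-rows c<M))
        (size-rows rs₀ length-rs₀) (size-rows rs₁ length-rs₁) (size-rows ps length-ps)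
        (subst (λ l → size (list group ⊗ real ⊗ list Row) res ≤ₙ 3 +ₙ 4 *ₙ l) length-ps (size-findBoundary I.budget 0# ps)))
      where
      size-rows : ∀ rs → length rs ≡ m → size (list Row) rs ≡ suc (4 *ₙ m)
      size-rows rs l≡m = ≡.trans (size-list Row (λ _ → refl) rs) (cong (λ l → suc (4 *ₙ l)) l≡m)

open import Data.Fin.Permutation using (Permutation′; _⟨$⟩ʳ_; id)
open import Data.Nat using (ℕ; _+_; _*_; _≤_)
open Allocation using (IsGroupedAllocation; NonIncreasing)
open import Data.List using (List; []; _∷_; map; length; tabulate; allFin)
open import Data.List.Relation.Binary.Permutation.Propositional using (_↭_; ↭-refl; ↭-sym; ↭-trans; ↭-reflexive)
open import Data.List.Relation.Binary.Permutation.Propositional.Properties using (↭-map-inv)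
open import Data.List.Relation.Unary.AllPairs using (AllPairs)
import Data.List.Relation.Unary.AllPairs.Properties as AllPairs
import Data.Nat.Properties as ℕₚ
open import Data.Nat.Tactic.RingSolver using (solve-∀)
open import Data.Product using (∃; _,_; proj₁; proj₂)
open import Relation.Binary.PropositionalEquality as ≡ using (_≡_; refl; sym; cong; subst; subst₂)

-- The order produced by sorting, and the three algorithms with their constants.

module Sorted {F : OrderedField} {n m : ℕ} (I : Instance F n m) where
  open OrderedField F using (Carrier) renaming (_≤_ to _≤ᶠ_)
  open OrderedFieldProperties F using (<⇒≤) renaming (≤-trans to ≤ᶠ-trans; ≤-refl to ≤ᶠ-refl)
  open Machine Carrier (Instance.Point I) n m
  open Run I
  open Algorithms Carrier (Instance.Point I) n m using (Row; rows; sortRows; higherRatio)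
  open Programs I
  open Selection I using (≤ᴿ-true; ≤ᴿ-false)
  open FirstStage I
  open FirstStageCost I using (length-rows)
  open Instance I using (ratio)

  private
    rs₀ = result (rows (allFin m))

    length-rs₀ : length rs₀ ≡ m
    length-rs₀ = ≡.trans (length-rows (allFin m)) (Assembly.length-allFin I m)

    -- Sorting permutes the rows, and a permutation of an image under `row` is again such an image.
    -- The inversion yields the order of the groups, with ties resolved as merge sort resolved them.
    sorted-order : ∃ λ os → result (sortRows rs₀) ≡ map row os × allFin m ↭ os
    sorted-order = ↭-map-inv row (↭-trans (↭-reflexive (sym (result-rows (allFin m))))
      (↭-sym (MergeSort.sort-↭ Row higherRatio rs₀)))

  os : List (Fin m)
  os = proj₁ sorted-order

  os↭ : os ↭ allFin m
  os↭ = ↭-sym (proj₂ (proj₂ sorted-order))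

  arranged : result (sortRows rs₀) ≡ map row os
  arranged = proj₁ (proj₂ sorted-order)

  order : Permutation′ m
  order = proj₁ (order-of os↭)

  os≡ : tabulate (order ⟨$⟩ʳ_) ≡ os
  os≡ = proj₂ (order-of os↭)

  ratios-sorted : AllPairs (λ k l → ratio l ≤ᶠ ratio k) os
  ratios-sorted = AllPairs.map⁻ (subst (AllPairs λ r r′ → proj₁ r′ ≤ᶠ proj₁ r) arranged
    (MergeSort.sort-sorted Row higherRatio (λ p q → ≤ᶠ-trans q p) ≤ᴿ-true (λ eq → <⇒≤ (≤ᴿ-false eq)) rs₀))

  nonIncreasing : NonIncreasing I order
  nonIncreasing = AllPairs-tabulate (λ _ → ≤ᶠ-refl) (order ⟨$⟩ʳ_) (subst (AllPairs λ k l → ratio l ≤ᶠ ratio k) (sym os≡) ratios-sorted)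

  time-sortRows : time (sortRows rs₀) ≤ 4 * (m * ⌈log₂ m ⌉)
  time-sortRows = subst (λ l → time (sortRows rs₀) ≤ 4 * (l * ⌈log₂ l ⌉)) length-rs₀
    (MergeSort.time-sort Row higherRatio (λ _ _ → refl) rs₀)

  space-sortRows : space (sortRows rs₀) ≤ 40 * m
  space-sortRows = subst (λ l → space (sortRows rs₀) ≤ 40 * l) length-rs₀
    (MergeSort.space-sort Row higherRatio (λ _ _ → refl) (λ _ → refl) rs₀)

module SortingBased {F : OrderedField} {n m : ℕ} (I : Instance F n m) where
  open Sorted I
  open Assembly I
  open LocatorCorrectness I using (bySorting-locates)
  open LocatorCost I using (time-bySorting; space-bySorting)
  open WaterLevelCost I using (length-breakpoints)
  open Purity I using (pure-bySorting)
  open Algorithms (OrderedField.Carrier F) (Instance.Point I) n m using (sortRows; bySorting)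
  open Arranged sortRows {bySorting} bySorting-locates pure-bySorting os↭ arranged

  theorem : ∀ z₀ → ∃[ order ] Σ[ gp ∈ IsGroupedAllocation I order (outputOf sortingBased I z₀) ]
    timeOf sortingBased I ≤ 130 * (n + m * ⌈log₂ m ⌉ + ∣Γ∣ gp * ⌈log₂ ∣Γ∣ gp ⌉)
    × spaceOf sortingBased I ≤ 130 * (m + ∣Γ∣ gp)
  theorem z₀ = order , isGroupedAllocation order os≡ nonIncreasing z₀
    , subst (λ g → timeOf sortingBased I ≤ 130 * (n + m * ⌈log₂ m ⌉ + g * ⌈log₂ g ⌉)) {g} (sym (∣Γ∣≡ order os≡ nonIncreasing z₀))
        (ℕₚ.≤-trans time-program (ℕₚ.≤-trans (ℕₚ.+-monoʳ-≤ (37 * n) (time-sortRows +≤ time-locate))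
          (bound₁ n (m * ⌈log₂ m ⌉) g (g * ⌈log₂ g ⌉) (ℕₚ.≤-trans 1≤m m≤n) Γ≤n)))
    , subst (λ g → spaceOf sortingBased I ≤ 130 * (m + g)) {g} (sym (∣Γ∣≡ order os≡ nonIncreasing z₀))
        (ℕₚ.≤-trans space-program (ℕₚ.≤-trans (ℕₚ.+-monoʳ-≤ (82 * (m + g)) (space-sortRows +≤ space-locate)) (bound₂ m g 1≤m)))
    where
    open Run I using (time; space)
    g = length Γ
    time-locate = subst (λ l → time (bySorting c bs) ≤ 4 * (l * ⌈log₂ l ⌉) + (10 * l + 3)) (length-breakpoints Γ)
      (time-bySorting c bs)
    space-locate = subst (λ l → space (bySorting c bs) ≤ 32 * l + 8) (length-breakpoints Γ) (space-bySorting c bs)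
    bound₁ : ∀ n x g y → 1 ≤ n → g ≤ n → 37 * n + (4 * x + (4 * y + (10 * g + 3))) ≤ 130 * (n + x + y)
    bound₁ n x g y 1≤n g≤n = lin (80 * n + 126 * x + 126 * y) (3 *≤ 1≤n +≤ 10 *≤ g≤n) (eq n x g y)
      where
      eq : ∀ n x g y → 37 * n + (4 * x + (4 * y + (10 * g + 3))) + (3 * n + 10 * n) + (80 * n + 126 * x + 126 * y)
                       ≡ 130 * (n + x + y) + (3 * 1 + 10 * g)
      eq = solve-∀
    bound₂ : ∀ m g → 1 ≤ m → 82 * (m + g) + (40 * m + (32 * g + 8)) ≤ 130 * (m + g)
    -- Space determines the constant 130: 82 for the stages and 40 for sorting the rows, both per
    -- group, and the additive 8 charged to the first group. The time bound would fit with less.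
    bound₂ m g 1≤m = lin (16 * g) (8 *≤ 1≤m) (eq m g)
      where
      eq : ∀ m g → 82 * (m + g) + (40 * m + (32 * g + 8)) + 8 * m + 16 * g ≡ 130 * (m + g) + 8 * 1
      eq = solve-∀

module SelectionBased {F : OrderedField} {n m : ℕ} (I : Instance F n m) where
  open Sorted I
  open Assembly I
  open LocatorCorrectness I using (bySelection-locates)
  open LocatorCost I using (time-bySelection)
  open WaterLevelCost I using (length-breakpoints)
  open FirstStage I using (result-rows)
  open Purity I using (pure-bySelection)
  open Machine (OrderedField.Carrier F) (Instance.Point I) n m using (return)
  open Algorithms (OrderedField.Carrier F) (Instance.Point I) n m using (sortRows; bySelection; breakpoints)
  private
    module A = Arranged sortRows {bySelection} bySelection-locates pure-bySelection os↭ arranged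
    module P = Arranged return {bySelection} bySelection-locates pure-bySelection ↭-refl (result-rows (allFin m))
  open Run I using (result; time)

  time-locate : ∀ (Γ : List (Fin n)) c → length Γ ≤ n →
                time (bySelection c (result (breakpoints Γ))) ≤ 940 * n + 3
  time-locate Γ c Γ≤n = ℕₚ.≤-trans (time-bySelection c (result (breakpoints Γ)))
    (ℕₚ.+-monoˡ-≤ 3 (940 *≤ ℕₚ.≤-trans (ℕₚ.≤-reflexive (length-breakpoints Γ)) Γ≤n))

  theorem : ∀ z₀ → ∃[ order ] IsGroupedAllocation I order (outputOf selectionBased I z₀)
    × timeOf selectionBased I ≤ 980 * (n + m * ⌈log₂ m ⌉)
  theorem z₀ = order , A.isGroupedAllocation order os≡ nonIncreasing z₀
    , ℕₚ.≤-trans A.time-program (ℕₚ.≤-trans (ℕₚ.+-monoʳ-≤ (37 * n) (time-sortRows +≤ time-locate A.Γ A.c A.Γ≤n))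
        (bound n (m * ⌈log₂ m ⌉) (ℕₚ.≤-trans A.1≤m A.m≤n)))
    where
    bound : ∀ n x → 1 ≤ n → 37 * n + (4 * x + (940 * n + 3)) ≤ 980 * (n + x)
    bound n x 1≤n = lin (976 * x) (3 *≤ 1≤n) (eq n x)
      where
      eq : ∀ n x → 37 * n + (4 * x + (940 * n + 3)) + 3 * n + 976 * x ≡ 980 * (n + x) + 3 * 1
      eq = solve-∀

  presorted : ∀ z₀ → NonIncreasing I id →
    IsGroupedAllocation I id (outputOf presortedSelectionBased I z₀) × timeOf presortedSelectionBased I ≤ 980 * n
  -- The arranged list is `allFin m` itself, which is definitionally the tabulation of the identity
  -- permutation.
  presorted z₀ nonIncreasing = P.isGroupedAllocation id refl nonIncreasing z₀
    , ℕₚ.≤-trans P.time-program (ℕₚ.≤-trans (ℕₚ.+-monoʳ-≤ (37 * n) (time-locate P.Γ P.c P.Γ≤n))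
        (bound n (ℕₚ.≤-trans P.1≤m P.m≤n)))
    where
    bound : ∀ n → 1 ≤ n → 37 * n + (940 * n + 3) ≤ 980 * n
    -- Exact: 980 = 37 + 940 + 3, for the stages, the search, and its additive constant charged to
    -- the first item.
    bound n 1≤n = lin 0 (3 *≤ 1≤n) (eq n)
      where
      eq : ∀ n → 37 * n + (940 * n + 3) + 3 * n + 0 ≡ 980 * n + 3 * 1
      eq = solve-∀

theorem7 : (∃[ K ] ∀ (F : OrderedField) (n m : ℕ) (I : Instance F n m) (z₀ : Fin n → OrderedField.Carrier F) →
    ∃[ order ] Σ[ gp ∈ IsGroupedAllocation I order (outputOf sortingBased I z₀) ]
    timeOf sortingBased I ≤ K * (n + m * ⌈log₂ m ⌉ + ∣Γ∣ gp * ⌈log₂ ∣Γ∣ gp ⌉)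
    × spaceOf sortingBased I ≤ K * (m + ∣Γ∣ gp))
    ×
    (∃[ K ] ∀ (F : OrderedField) (n m : ℕ) (I : Instance F n m) (z₀ : Fin n → OrderedField.Carrier F) →
    ∃[ order ] IsGroupedAllocation I order (outputOf selectionBased I z₀)
    × timeOf selectionBased I ≤ K * (n + m * ⌈log₂ m ⌉))
    ×
    (∃[ K ] ∀ (F : OrderedField) (n m : ℕ) (I : Instance F n m) (z₀ : Fin n → OrderedField.Carrier F) →
    NonIncreasing I id →
    IsGroupedAllocation I id (outputOf presortedSelectionBased I z₀)
    × timeOf presortedSelectionBased I ≤ K * n)
theorem7 =
    (130 , λ F n m I → SortingBased.theorem I)
  , (980 , λ F n m I → SelectionBased.theorem I)
  , (980 , λ F n m I → SelectionBased.presorted I)
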